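{- Let $n\ge 1$ and let $A\subset \mathbb{F}_5^n$ be sum-free, i.e. there are no $a,b,c\in A$ with $a+b=c$. If $|A|>1.2\cdot 5^{n-1}$, then $A$ is normal: there exist a subspace $V<\mathbb{F}_5^n$ of co-dimension $1$ and an element $w\in\mathbb{F}_5^n\setminus V$ such that $A\subset \{2w,3w\}+V$.
   Context: A set $A$ in an abelian group is sum-free if $(A+A)\cap A=\emptyset$. For a prime $p\equiv 2 \pmod 3$ let $m_p=(p+1)/3$; a sum-free set $A\subset\mathbb{F}_p^n$ is called normal if $A\subset\{m_pw,(m_p+1)w,\ldots,(2m_p-1)w\}+V$ for some subspace $V$ of co-dimension $1$ and some $w\notin V$. For $p=5$, $m_5=2$. -}

module Defs where

open import Data.Nat using (ℕ; _∸_; _^_; _*_; _<_)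
open import Data.Fin using (Fin; toℕ; fromℕ<; #_)
open import Data.Nat.DivMod using (_%_; m%n<n)
open import Data.Vec using (Vec; zipWith; map; replicate)
open import Data.List using (List; length)
open import Data.List.Membership.Propositional using (_∈_)
open import Data.List.Relation.Unary.Unique.Propositional using (Unique)
open import Data.Product using (Σ; ∃; _×_; _,_)
open import Data.Sum using (_⊎_)
open import Relation.Nullary using (¬_)
open import Relation.Binary.PropositionalEquality using (_≡_)
open import Level using (Level; _⊔_; suc; 0ℓ)

F5 : Set
F5 = Fin 5

infixl 6 _+₅_
infixl 7 _*₅_
_+₅_ : F5 → F5 → F5
a +₅ b = fromℕ< (m%n<n (toℕ a Data.Nat.+ toℕ b) 5)

_*₅_ : F5 → F5 → F5
a *₅ b = fromℕ< (m%n<n (toℕ a * toℕ b) 5)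

Vec5 : ℕ → Set
Vec5 n = Vec F5 n

infixl 6 _⊕_
_⊕_ : ∀ {n} → Vec5 n → Vec5 n → Vec5 n
_⊕_ = zipWith _+₅_

infixr 7 _·_
_·_ : ∀ {n} → F5 → Vec5 n → Vec5 n
c · x = map (c *₅_) x

𝟎 : ∀ {n} → Vec5 n
𝟎 = replicate _ Data.Fin.zero

-- A finite set A ⊆ F_5^n, given as a duplicate-free list; |A| = length.
-- Sum-free: no a, b, c ∈ A with a + b = c.
SumFree : ∀ {n} → List (Vec5 n) → Set
SumFree A = ∀ a b c → a ∈ A → b ∈ A → c ∈ A → ¬ (a ⊕ b ≡ c)

record IsSubspace {n : ℕ} (V : Vec5 n → Set) : Set where
  field
    zero∈  : V 𝟎
    ⊕-closed : ∀ x y → V x → V y → V (x ⊕ y)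
    ·-closed : ∀ c x → V x → V (c · x)

-- Co-dimension 1: the quotient F_5^n / V is one-dimensional, i.e. there is
-- some u ∉ V such that every x is  λu + v  for some scalar λ and v ∈ V.
CodimOne : ∀ {n} → (Vec5 n → Set) → Set
CodimOne {n} V =
  Σ (Vec5 n) λ u → ¬ V u × (∀ x → Σ F5 λ l → Σ (Vec5 n) λ v → V v × x ≡ l · u ⊕ v)

InShift : ∀ {n} → (Vec5 n → Set) → Vec5 n → Vec5 n → Set
InShift {n} V w x = Σ (Vec5 n) λ v → V v × (x ≡ (# 2) · w ⊕ v ⊎ x ≡ (# 3) · w ⊕ v)

Normal : ∀ {n} → List (Vec5 n) → Set₁
Normal {n} A = Σ (Vec5 n → Set) λ V → IsSubspace V × CodimOne V ×
  Σ (Vec5 n) λ w → ¬ V w × (∀ x → x ∈ A → InShift V w x)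

{-# OPTIONS --safe #-}

-- Induction on n, with linear functionals in place of subspaces of codimension 1. Averaging |A ∩ H| over all hyperplanes H
-- gives one with |A ∩ H| > 1.2·|H|/5 unless n = 3. For n = 3, either A contains some ± a and averaging over the planes through
-- a suffices, or A, 2A, 3A, 4A partition the nonzero vectors, which is impossible already inside a single plane. By induction
-- A ∩ H lies in two opposite cosets ± w + W of a hyperplane W of H.
-- Let β x, for x ∈ F₅², be the density of A in the corresponding coset of W, so that Σ β > 6. If x + y = z and A meets all
-- three cosets, then β z > k/5 implies β x + β y ≤ 1 - k/5, and likewise for any other choice of the distinguished coset:
-- this follows from Dyson's e-transform, as in Kneser's theorem. Row 0 has weight > 1.2, all of it at (0 , ± 1), and a shear
-- moves the heaviest coset outside row 0 to (1 , 0). Under these conditions the support of β lies in two opposite parallel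
-- lines of F₅². This is a finite case distinction, recorded in a certificate: each impossible case is closed by a cover of
-- F₅² by pairs {x , y} with a bound on β x + β y, the bounds adding up to at most 6.

module Submission where

open import Defs
open import Data.Nat using (ℕ; zero; suc; pred; _+_; _*_; _^_; _∸_; _⊓_; _⊔_; _≤_; _<_; _≥_; _≤?_; _<?_; _≟_; z≤n; s≤s; s≤s⁻¹; >-nonZero)
import Data.Nat.Properties as ℕ
open import Data.Nat.Divisibility using (_∣_; divides)
import Data.Nat.Divisibility as ∣
open import Data.Nat.DivMod using (_mod_)
open import Data.Nat.Induction using (<-wellFounded)
open import Data.Nat.ListAction using (sum)
open import Data.Nat.Primality using (Prime; prime?; euclidsLemma)
open import Data.Nat.Tactic.RingSolver using (solve-∀)
open import Data.Fin using (Fin; zero; suc; #_; toℕ; combine; remQuot)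
import Data.Fin.Properties as Fin
open import Data.Bool using (Bool; true; false; _∧_; T)
open import Data.Bool.Properties using (T-∧)
open import Data.Empty using (⊥; ⊥-elim)
open import Data.Unit using (tt)
open import Data.Product using (∃; _×_; _,_; proj₁; proj₂)
open import Data.Sum using (_⊎_; inj₁; inj₂; [_,_]′)
open import Data.List as List using (List; []; _∷_; length; map; filter; _++_; allFin; cartesianProduct; cartesianProductWith)
import Data.List.Properties as List
open import Data.List.Membership.Propositional using (_∈_; _∉_; find; lose)
import Data.List.Membership.Propositional.Properties as ∈
open import Data.List.Relation.Unary.All as All using ([]; _∷_)
open import Data.List.Relation.Unary.AllPairs using ([]; _∷_)
open import Data.List.Relation.Unary.Any as Any using (here; there)
open import Data.List.Relation.Unary.Unique.Propositional using (Unique)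
import Data.List.Relation.Unary.Unique.Propositional.Properties as Unique
open import Data.Vec as Vec using (Vec; []; _∷_; lookup; removeAt; insertAt; updateAt; _[_]≔_; tabulate; replicate)
import Data.Vec.Properties as Vec
open import Function using (_∘_; id; Equivalence)
open import Induction.WellFounded using (Acc; acc)
open import Level using (Level)
open import Relation.Nullary using (¬_; Dec; yes; no; does)
open import Relation.Nullary.Decidable using (¬?; _→-dec_; _⊎-dec_; _×-dec_; ⌊_⌋; toWitness; from-yes; from-no; decidable-stable)
open import Relation.Unary using (Pred; Decidable)
open import Relation.Binary.PropositionalEquality

-- In the average over hyperplanes, the integrality of |A| gains one element, while leaving out the
-- zero functional costs about as much. In dimension 3 the two cancel exactly: 31 · 24 = 124 · 6, so
-- averaging alone gives no contradiction there.
--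
-- Densities are compared with multiples of 1/5 only, and nothing is lost by this: the index of a
-- proper stabiliser is divisible by 5, so that k/5 of the group is a whole number of cosets, and a
-- strict inequality between numbers of cosets leaves one coset free for the second summand.
--
-- The total 6 is 1 + 1 + 10 · (2/5). The two cells of row 0 have density at most 1 each. One of
-- them exceeds 3/5, and the twenty cells outside row 0 fall into ten pairs whose sum or difference
-- is that cell, so that two nonempty partners have densities adding up to at most 2/5. If no cell
-- outside row 0 exceeds 2/5, this already contradicts Σ β > 6. All further work concerns a cell
-- above 2/5, and this is why the heaviest one is put in a fixed place.

private
  variable
    n m : ℕ
    ℓ ℓ′ : Level
    A B : Set ℓ

-- Linear algebra over F₅

+₅-assoc : ∀ a b c → (a +₅ b) +₅ c ≡ a +₅ (b +₅ c)
+₅-assoc = from-yes (Fin.all? λ a → Fin.all? λ b → Fin.all? λ c → (a +₅ b) +₅ c Fin.≟ a +₅ (b +₅ c))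

+₅-comm : ∀ a b → a +₅ b ≡ b +₅ a
+₅-comm = from-yes (Fin.all? λ a → Fin.all? λ b → a +₅ b Fin.≟ b +₅ a)

+₅-identityˡ : ∀ a → zero +₅ a ≡ a
+₅-identityˡ = from-yes (Fin.all? λ a → zero +₅ a Fin.≟ a)

+₅-cancelʳ : ∀ a b c → a +₅ c ≡ b +₅ c → a ≡ b
+₅-cancelʳ = from-yes (Fin.all? λ a → Fin.all? λ b → Fin.all? λ c → (a +₅ c Fin.≟ b +₅ c) →-dec (a Fin.≟ b))

*₅-comm : ∀ a b → a *₅ b ≡ b *₅ a
*₅-comm = from-yes (Fin.all? λ a → Fin.all? λ b → a *₅ b Fin.≟ b *₅ a)

*₅-assoc : ∀ a b c → (a *₅ b) *₅ c ≡ a *₅ (b *₅ c)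
*₅-assoc = from-yes (Fin.all? λ a → Fin.all? λ b → Fin.all? λ c → (a *₅ b) *₅ c Fin.≟ a *₅ (b *₅ c))

*₅-identityˡ : ∀ a → # 1 *₅ a ≡ a
*₅-identityˡ = from-yes (Fin.all? λ a → # 1 *₅ a Fin.≟ a)

*₅-distribˡ-+₅ : ∀ a b c → a *₅ (b +₅ c) ≡ a *₅ b +₅ a *₅ c
*₅-distribˡ-+₅ = from-yes (Fin.all? λ a → Fin.all? λ b → Fin.all? λ c → a *₅ (b +₅ c) Fin.≟ a *₅ b +₅ a *₅ c)

*₅-cancelˡ : ∀ a b c → ¬ a ≡ zero → a *₅ b ≡ a *₅ c → b ≡ c
*₅-cancelˡ = from-yes (Fin.all? λ a → Fin.all? λ b → Fin.all? λ c →
  ¬? (a Fin.≟ zero) →-dec ((a *₅ b Fin.≟ a *₅ c) →-dec (b Fin.≟ c)))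

a-b+b≡a : ∀ a b → (a +₅ # 4 *₅ b) +₅ b ≡ a
a-b+b≡a = from-yes (Fin.all? λ a → Fin.all? λ b → (a +₅ # 4 *₅ b) +₅ b Fin.≟ a)

⊕-assoc : ∀ (x y z : Vec5 n) → (x ⊕ y) ⊕ z ≡ x ⊕ (y ⊕ z)
⊕-assoc = Vec.zipWith-assoc +₅-assoc

⊕-comm : ∀ (x y : Vec5 n) → x ⊕ y ≡ y ⊕ x
⊕-comm = Vec.zipWith-comm +₅-comm

⊕-identityˡ : ∀ (x : Vec5 n) → 𝟎 ⊕ x ≡ x
⊕-identityˡ = Vec.zipWith-identityˡ +₅-identityˡ

⊕-cancelʳ : ∀ (x y z : Vec5 n) → x ⊕ z ≡ y ⊕ z → x ≡ y
⊕-cancelʳ []      []      []      _ = refl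
⊕-cancelʳ (a ∷ x) (b ∷ y) (c ∷ z) e =
  cong₂ _∷_ (+₅-cancelʳ a b c (cong Vec.head e)) (⊕-cancelʳ x y z (cong Vec.tail e))

⊕-cancelˡ : ∀ (z x y : Vec5 n) → z ⊕ x ≡ z ⊕ y → x ≡ y
⊕-cancelˡ z x y e = ⊕-cancelʳ x y z (trans (⊕-comm x z) (trans e (⊕-comm z y)))

infixl 6 _⊖_
_⊖_ : Vec5 n → Vec5 n → Vec5 n
x ⊖ y = x ⊕ # 4 · y

x⊖y⊕y≡x : ∀ (x y : Vec5 n) → (x ⊖ y) ⊕ y ≡ x
x⊖y⊕y≡x []      []      = refl
x⊖y⊕y≡x (a ∷ x) (b ∷ y) = cong₂ _∷_ (a-b+b≡a a b) (x⊖y⊕y≡x x y)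

x⊕y⊖y≡x : ∀ (x y : Vec5 n) → (x ⊕ y) ⊖ y ≡ x
x⊕y⊖y≡x x y = ⊕-cancelʳ _ _ y (x⊖y⊕y≡x (x ⊕ y) y)

⊖⊕-swap : ∀ (x y z : Vec5 n) → (x ⊖ y) ⊕ z ≡ (z ⊖ y) ⊕ x
⊖⊕-swap x y z = trans (⊕-comm (x ⊖ y) z) (trans (cong (z ⊕_) (⊕-comm x (# 4 · y))) (sym (⊕-assoc z (# 4 · y) x)))

⊕⊕-swap : ∀ (x y z : Vec5 n) → (x ⊕ y) ⊕ z ≡ (x ⊕ z) ⊕ y
⊕⊕-swap x y z = trans (⊕-assoc x y z) (trans (cong (x ⊕_) (⊕-comm y z)) (sym (⊕-assoc x z y)))

·-identityˡ : ∀ (x : Vec5 n) → # 1 · x ≡ x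
·-identityˡ []      = refl
·-identityˡ (a ∷ x) = cong₂ _∷_ (*₅-identityˡ a) (·-identityˡ x)

·-cancelˡ : ∀ c (x y : Vec5 n) → ¬ c ≡ zero → c · x ≡ c · y → x ≡ y
·-cancelˡ c []      []      _   _ = refl
·-cancelˡ c (a ∷ x) (b ∷ y) c≢0 e =
  cong₂ _∷_ (*₅-cancelˡ c a b c≢0 (cong Vec.head e)) (·-cancelˡ c x y c≢0 (cong Vec.tail e))

⟨_,_⟩ : Vec5 n → Vec5 n → F5
⟨ []    , []    ⟩ = zero
⟨ a ∷ u , b ∷ x ⟩ = a *₅ b +₅ ⟨ u , x ⟩

+₅-interchange : ∀ a b c d → (a +₅ b) +₅ (c +₅ d) ≡ (a +₅ c) +₅ (b +₅ d)
+₅-interchange a b c d = trans (+₅-assoc a b (c +₅ d)) (trans (cong (a +₅_)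
  (trans (sym (+₅-assoc b c d)) (trans (cong (_+₅ d) (+₅-comm b c)) (+₅-assoc c b d)))) (sym (+₅-assoc a c (b +₅ d))))

⟨,⟩-comm : ∀ (u x : Vec5 n) → ⟨ u , x ⟩ ≡ ⟨ x , u ⟩
⟨,⟩-comm []      []      = refl
⟨,⟩-comm (a ∷ u) (b ∷ x) = cong₂ _+₅_ (*₅-comm a b) (⟨,⟩-comm u x)

⟨,⟩-⊕ʳ : ∀ (u x y : Vec5 n) → ⟨ u , x ⊕ y ⟩ ≡ ⟨ u , x ⟩ +₅ ⟨ u , y ⟩
⟨,⟩-⊕ʳ []      []      []      = refl
⟨,⟩-⊕ʳ (a ∷ u) (b ∷ x) (c ∷ y) = trans (cong₂ _+₅_ (*₅-distribˡ-+₅ a b c) (⟨,⟩-⊕ʳ u x y))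
  (+₅-interchange (a *₅ b) (a *₅ c) _ _)

⟨,⟩-·ʳ : ∀ (u : Vec5 n) c x → ⟨ u , c · x ⟩ ≡ c *₅ ⟨ u , x ⟩
⟨,⟩-·ʳ []      c []      = *₅-comm zero c
⟨,⟩-·ʳ (a ∷ u) c (b ∷ x) = trans (cong₂ _+₅_ (trans (sym (*₅-assoc a c b))
  (trans (cong (_*₅ b) (*₅-comm a c)) (*₅-assoc c a b))) (⟨,⟩-·ʳ u c x)) (sym (*₅-distribˡ-+₅ c (a *₅ b) ⟨ u , x ⟩))

⟨,⟩-⊕ˡ : ∀ (u v x : Vec5 n) → ⟨ u ⊕ v , x ⟩ ≡ ⟨ u , x ⟩ +₅ ⟨ v , x ⟩
⟨,⟩-⊕ˡ u v x = trans (⟨,⟩-comm (u ⊕ v) x) (trans (⟨,⟩-⊕ʳ x u v) (cong₂ _+₅_ (⟨,⟩-comm x u) (⟨,⟩-comm x v)))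

⟨,⟩-·ˡ : ∀ c (u x : Vec5 n) → ⟨ c · u , x ⟩ ≡ c *₅ ⟨ u , x ⟩
⟨,⟩-·ˡ c u x = trans (⟨,⟩-comm (c · u) x) (trans (⟨,⟩-·ʳ x c u) (cong (c *₅_) (⟨,⟩-comm x u)))

𝟎-⟨,⟩ : ∀ (x : Vec5 n) → ⟨ 𝟎 , x ⟩ ≡ zero
𝟎-⟨,⟩ []      = refl
𝟎-⟨,⟩ (a ∷ x) = cong (zero +₅_) (𝟎-⟨,⟩ x)

⟨,⟩-𝟎 : ∀ (u : Vec5 n) → ⟨ u , 𝟎 ⟩ ≡ zero
⟨,⟩-𝟎 u = trans (⟨,⟩-comm u 𝟎) (𝟎-⟨,⟩ u)

removeAt-⊕ : ∀ (x y : Vec5 (suc n)) k → removeAt (x ⊕ y) k ≡ removeAt x k ⊕ removeAt y k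
removeAt-⊕ (a ∷ x)           (b ∷ y)           zero    = refl
removeAt-⊕ (a ∷ x@(_ ∷ _)) (b ∷ y@(_ ∷ _)) (suc k) = cong (_ ∷_) (removeAt-⊕ x y k)

⟨,⟩-removeAt : ∀ (u x : Vec5 (suc n)) k →
  ⟨ u , x ⟩ ≡ lookup u k *₅ lookup x k +₅ ⟨ removeAt u k , removeAt x k ⟩
⟨,⟩-removeAt (a ∷ u)           (b ∷ x)           zero    = refl
⟨,⟩-removeAt (a ∷ u@(_ ∷ _)) (b ∷ x@(_ ∷ _)) (suc k) = begin
  a *₅ b +₅ ⟨ u , x ⟩        ≡⟨ cong (a *₅ b +₅_) (⟨,⟩-removeAt u x k) ⟩
  a *₅ b +₅ (p +₅ q)         ≡⟨ sym (+₅-assoc (a *₅ b) p q) ⟩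
  (a *₅ b +₅ p) +₅ q         ≡⟨ cong (_+₅ q) (+₅-comm (a *₅ b) p) ⟩
  (p +₅ a *₅ b) +₅ q         ≡⟨ +₅-assoc p (a *₅ b) q ⟩
  p +₅ (a *₅ b +₅ q)         ∎
  where
  open ≡-Reasoning
  p = lookup u k *₅ lookup x k
  q = ⟨ removeAt u k , removeAt x k ⟩

⟨,⟩-insertAt : ∀ (v : Vec5 n) k x → ⟨ insertAt v k zero , x ⟩ ≡ ⟨ v , removeAt x k ⟩
⟨,⟩-insertAt v k x = begin
  ⟨ insertAt v k zero , x ⟩
    ≡⟨ ⟨,⟩-removeAt (insertAt v k zero) x k ⟩
  lookup (insertAt v k zero) k *₅ lookup x k +₅ ⟨ removeAt (insertAt v k zero) k , removeAt x k ⟩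
    ≡⟨ cong₂ (λ a w → a *₅ lookup x k +₅ ⟨ w , removeAt x k ⟩) (Vec.insertAt-lookup v k zero) (Vec.removeAt-insertAt v k zero) ⟩
  zero +₅ ⟨ v , removeAt x k ⟩
    ≡⟨ +₅-identityˡ _ ⟩
  ⟨ v , removeAt x k ⟩ ∎
  where open ≡-Reasoning

-- Since `lookup u k` is invertible, the value of the functional recovers the deleted coordinate.
-- Deleting a pivot thus embeds each level set of `u` in a space of one dimension less.
removeAt-injective : ∀ (u x y : Vec5 (suc n)) k → ¬ lookup u k ≡ zero →
  ⟨ u , x ⟩ ≡ ⟨ u , y ⟩ → removeAt x k ≡ removeAt y k → x ≡ y
removeAt-injective u x y k uₖ≢0 ux≡uy e = begin
  x                                       ≡⟨ sym (Vec.insertAt-removeAt x k) ⟩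
  insertAt (removeAt x k) k (lookup x k)  ≡⟨ cong₂ (λ w a → insertAt w k a) e xₖ≡yₖ ⟩
  insertAt (removeAt y k) k (lookup y k)  ≡⟨ Vec.insertAt-removeAt y k ⟩
  y                                       ∎
  where
  open ≡-Reasoning
  xₖ≡yₖ : lookup x k ≡ lookup y k
  xₖ≡yₖ = *₅-cancelˡ (lookup u k) _ _ uₖ≢0 (+₅-cancelʳ _ _ ⟨ removeAt u k , removeAt y k ⟩ (begin
    lookup u k *₅ lookup x k +₅ ⟨ removeAt u k , removeAt y k ⟩
      ≡⟨ cong (λ w → lookup u k *₅ lookup x k +₅ ⟨ removeAt u k , w ⟩) (sym e) ⟩
    lookup u k *₅ lookup x k +₅ ⟨ removeAt u k , removeAt x k ⟩ ≡⟨ sym (⟨,⟩-removeAt u x k) ⟩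
    ⟨ u , x ⟩ ≡⟨ ux≡uy ⟩
    ⟨ u , y ⟩ ≡⟨ ⟨,⟩-removeAt u y k ⟩
    lookup u k *₅ lookup y k +₅ ⟨ removeAt u k , removeAt y k ⟩ ∎))

pivot : ∀ (u : Vec5 n) → ¬ u ≡ 𝟎 → ∃ λ k → ¬ lookup u k ≡ zero
pivot []            u≢𝟎 = ⊥-elim (u≢𝟎 refl)
pivot (suc a ∷ u)   _   = zero , λ ()
pivot (zero  ∷ u)   u≢𝟎 with pivot u (λ e → u≢𝟎 (cong (zero ∷_) e))
... | k , uₖ≢0 = suc k , uₖ≢0

-- Counting in lists

⊆⇒length≤ : ∀ {xs ys : List A} → Unique xs → (∀ {x} → x ∈ xs → x ∈ ys) → length xs ≤ length ys
⊆⇒length≤ {xs = []}     _          _   = z≤n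
⊆⇒length≤ {xs = x ∷ xs} (x≢ ∷ uxs) sub with ∈.∈-∃++ (sub (here refl))
... | ls , rs , refl = begin
  suc (length xs)              ≤⟨ s≤s (⊆⇒length≤ uxs sub′) ⟩
  suc (length (ls ++ rs))      ≡⟨ cong suc (List.length-++ ls) ⟩
  suc (length ls + length rs)  ≡⟨ sym (ℕ.+-suc (length ls) (length rs)) ⟩
  length ls + suc (length rs)  ≡⟨ sym (List.length-++ ls) ⟩
  length (ls ++ x ∷ rs)        ∎
  where
  open ℕ.≤-Reasoning
  sub′ : ∀ {y} → y ∈ xs → y ∈ ls ++ rs
  sub′ y∈ with ∈.∈-++⁻ ls (sub (there y∈))
  ... | inj₁ y∈ls         = ∈.∈-++⁺ˡ y∈ls
  ... | inj₂ (here refl)  = ⊥-elim (All.lookup x≢ y∈ refl)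
  ... | inj₂ (there y∈rs) = ∈.∈-++⁺ʳ ls y∈rs

unique-map : ∀ (f : A → B) {xs} → (∀ {x y} → x ∈ xs → y ∈ xs → f x ≡ f y → x ≡ y) → Unique xs → Unique (map f xs)
unique-map f inj []         = []
unique-map f {x ∷ xs} inj (x≢ ∷ uxs) =
  All.tabulate (λ fy∈ fx≡ → let y , y∈ , e = ∈.∈-map⁻ f fy∈ in
    All.lookup x≢ y∈ (inj (here refl) (there y∈) (trans fx≡ e)))
  ∷ unique-map f (λ x∈ y∈ → inj (there x∈) (there y∈)) uxs

injection⇒length≤ : ∀ (f : A → B) {xs ys} → Unique xs →
  (∀ {x y} → x ∈ xs → y ∈ xs → f x ≡ f y → x ≡ y) → (∀ {x} → x ∈ xs → f x ∈ ys) → length xs ≤ length ys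
injection⇒length≤ f {xs} {ys} uxs inj sub = subst (_≤ length ys) (List.length-map f xs)
  (⊆⇒length≤ (unique-map f inj uxs) λ z∈ → let x , x∈ , e = ∈.∈-map⁻ f z∈ in subst (_∈ ys) (sym e) (sub x∈))

length-filter-¬ : ∀ {P : Pred A ℓ′} (P? : Decidable P) xs →
  length (filter P? xs) + length (filter (¬? ∘ P?) xs) ≡ length xs
length-filter-¬ P? []       = refl
length-filter-¬ P? (x ∷ xs) with does (P? x)
... | true  = cong suc (length-filter-¬ P? xs)
... | false = trans (ℕ.+-suc _ _) (cong suc (length-filter-¬ P? xs))

count-swap : ∀ {R : A → B → Set ℓ} (R? : ∀ a b → Dec (R a b)) (xs : List A) (ys : List B) →
  sum (map (λ x → length (filter (R? x) ys)) xs) ≡ sum (map (λ y → length (filter (λ x → R? x y) xs)) ys)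
count-swap R? []       ys = sym (sum-0 ys)
  where
  sum-0 : ∀ ys → sum (map (λ _ → 0) ys) ≡ 0
  sum-0 []       = refl
  sum-0 (_ ∷ ys) = sum-0 ys
count-swap R? (x ∷ xs) ys = trans (cong (length (filter (R? x) ys) +_) (count-swap R? xs ys)) (step ys)
  where
  c = λ y → length (filter (λ x → R? x y) xs)
  exchange : ∀ a b d → a + (b + d) ≡ b + (a + d)
  exchange a b d = trans (sym (ℕ.+-assoc a b d)) (trans (cong (_+ d) (ℕ.+-comm a b)) (ℕ.+-assoc b a d))
  step : ∀ ys → length (filter (R? x) ys) + sum (map c ys)
              ≡ sum (map (λ y → length (filter (λ x → R? x y) (x ∷ xs))) ys)
  step []       = refl
  step (y ∷ ys) with does (R? x y)
  ... | true  = cong suc (trans (exchange (length (filter (R? x) ys)) (c y) _) (cong (c y +_) (step ys)))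
  ... | false = trans (exchange (length (filter (R? x) ys)) (c y) _) (cong (c y +_) (step ys))

sum-upper : ∀ (f : A → ℕ) c xs → (∀ {x} → x ∈ xs → f x ≤ c) → sum (map f xs) ≤ length xs * c
sum-upper f c []       _ = z≤n
sum-upper f c (x ∷ xs) h = ℕ.+-mono-≤ (h (here refl)) (sum-upper f c xs (h ∘ there))

sum-lower : ∀ (f : A → ℕ) c xs → (∀ {x} → x ∈ xs → c ≤ f x) → length xs * c ≤ sum (map f xs)
sum-lower f c []       _ = z≤n
sum-lower f c (x ∷ xs) h = ℕ.+-mono-≤ (h (here refl)) (sum-lower f c xs (h ∘ there))

abstract
  vectors : ∀ n → List (Vec5 n)
  vectors zero    = [] ∷ []
  vectors (suc n) = cartesianProductWith _∷_ (allFin 5) (vectors n)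

  ∈-vectors : ∀ (x : Vec5 n) → x ∈ vectors n
  ∈-vectors []      = here refl
  ∈-vectors (a ∷ x) = ∈.∈-cartesianProductWith⁺ _∷_ (∈.∈-allFin a) (∈-vectors x)

  unique-vectors : ∀ n → Unique (vectors n)
  unique-vectors zero    = [] ∷ []
  unique-vectors (suc n) = Unique.cartesianProductWith⁺ _∷_ Vec.∷-injective (Unique.allFin⁺ 5) (unique-vectors n)

  length-vectors : ∀ n → length (vectors n) ≡ 5 ^ n
  length-vectors zero    = refl
  length-vectors (suc n) = trans (lem (allFin 5)) (cong (5 *_) (length-vectors n))
    where
    lem : ∀ as → length (cartesianProductWith (λ a x → a ∷ x) as (vectors n)) ≡ length as * length (vectors n)
    lem []       = refl
    lem (a ∷ as) = trans (List.length-++ (map (a ∷_) (vectors n))) (cong₂ _+_ (List.length-map (a ∷_) (vectors n)) (lem as))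

length≤5^ : ∀ {xs : List (Vec5 n)} → Unique xs → length xs ≤ 5 ^ n
length≤5^ {n} {xs} uxs = subst (length xs ≤_) (length-vectors n) (⊆⇒length≤ uxs λ {x} _ → ∈-vectors x)

infix 4 _≟ᵥ_
_≟ᵥ_ : (x y : Vec5 n) → Dec (x ≡ y)
_≟ᵥ_ = Vec.≡-dec Fin._≟_

-- Sumsets

infix 4 _∈?_
_∈?_ : (x : Vec5 n) (xs : List (Vec5 n)) → Dec (x ∈ xs)
x ∈? xs = Any.any? (x ≟ᵥ_) xs

stabiliser : List (Vec5 n) → List (Vec5 n)
stabiliser {n} X = filter (λ g → All.all? (λ x → (g ⊕ x) ∈? X) X) (vectors n)

module _ {X : List (Vec5 n)} where

  ∈-stabiliser⁺ : ∀ {g} → (∀ {x} → x ∈ X → g ⊕ x ∈ X) → g ∈ stabiliser X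
  ∈-stabiliser⁺ h = ∈.∈-filter⁺ _ (∈-vectors _) (All.tabulate h)

  ∈-stabiliser⁻ : ∀ {g x} → g ∈ stabiliser X → x ∈ X → g ⊕ x ∈ X
  ∈-stabiliser⁻ g∈ = All.lookup (proj₂ (∈.∈-filter⁻ _ {xs = vectors n} g∈))

  stabiliser-𝟎 : 𝟎 ∈ stabiliser X
  stabiliser-𝟎 = ∈-stabiliser⁺ λ {x} x∈ → subst (_∈ X) (sym (⊕-identityˡ x)) x∈

  stabiliser-⊕ : ∀ {g h} → g ∈ stabiliser X → h ∈ stabiliser X → g ⊕ h ∈ stabiliser X
  stabiliser-⊕ {g} {h} g∈ h∈ = ∈-stabiliser⁺ λ {x} x∈ →
    subst (_∈ X) (sym (⊕-assoc g h x)) (∈-stabiliser⁻ g∈ (∈-stabiliser⁻ h∈ x∈))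

4a+b : ∀ a b → # 4 *₅ a +₅ b ≡ a +₅ (a +₅ (a +₅ (a +₅ b)))
4a+b = from-yes (Fin.all? λ a → Fin.all? λ b → # 4 *₅ a +₅ b Fin.≟ a +₅ (a +₅ (a +₅ (a +₅ b))))

-- Translation by `-g` is translation by `g` four times, which makes a stabiliser closed under
-- negation.
4g⊕x : ∀ (g x : Vec5 n) → # 4 · g ⊕ x ≡ g ⊕ (g ⊕ (g ⊕ (g ⊕ x)))
4g⊕x []      []      = refl
4g⊕x (a ∷ g) (b ∷ x) = cong₂ _∷_ (4a+b a b) (4g⊕x g x)

stabiliser-neg : ∀ {X : List (Vec5 n)} {g} → g ∈ stabiliser X → # 4 · g ∈ stabiliser X
stabiliser-neg {X = X} {g} g∈ = ∈-stabiliser⁺ λ {x} x∈ →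
  subst (_∈ X) (sym (4g⊕x g x)) (shift (shift (shift (shift x∈))))
  where
  shift : ∀ {x} → x ∈ X → g ⊕ x ∈ X
  shift = ∈-stabiliser⁻ g∈

unique-stabiliser : ∀ (X : List (Vec5 n)) → Unique (stabiliser X)
unique-stabiliser {n} X = Unique.filter⁺ _ (unique-vectors n)

module _ (X : List (Vec5 n)) where
  private
    S = stabiliser X

  -- Lagrange's theorem for a union of cosets: the coset of the first element of `T` is split off,
  -- and the rest is again invariant. A general `T` covers both `X` itself and the whole group.
  stabiliser-∣ : ∀ {T} → Unique T → (∀ {g x} → g ∈ S → x ∈ T → g ⊕ x ∈ T) → length S ∣ length T
  stabiliser-∣ {T} = go T (<-wellFounded (length T))
    where
    go : ∀ T → Acc _<_ (length T) → Unique T → (∀ {g x} → g ∈ S → x ∈ T → g ⊕ x ∈ T) → length S ∣ length T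
    go []           _        _  _   = _ ∣.∣0
    go T@(t ∷ _) (acc rs) uT per = subst (length S ∣_) (length-filter-¬ inCoset? T)
      (∣.∣m∣n⇒∣m+n (∣.∣-reflexive (ℕ.≤-antisym S≤coset coset≤S))
        (go rest (rs (List.filter-notAll (¬? ∘ inCoset?) T (here λ t∉ → t∉ t∈coset)))
          (Unique.filter⁺ (¬? ∘ inCoset?) uT) rest-periodic))
      where
      inCoset? = λ x → (x ⊖ t) ∈? S
      coset = filter inCoset? T
      rest = filter (¬? ∘ inCoset?) T
      t∈coset : t ⊖ t ∈ S
      t∈coset = subst (_∈ S) (⊕-cancelʳ _ _ t (trans (⊕-identityˡ t) (sym (x⊖y⊕y≡x t t)))) stabiliser-𝟎
      coset≤S : length coset ≤ length S
      coset≤S = injection⇒length≤ (_⊖ t) (Unique.filter⁺ inCoset? uT)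
        (λ _ _ → ⊕-cancelʳ _ _ _) (λ x∈ → proj₂ (∈.∈-filter⁻ inCoset? {xs = T} x∈))
      S≤coset : length S ≤ length coset
      S≤coset = injection⇒length≤ (_⊕ t) (unique-stabiliser X) (λ _ _ → ⊕-cancelʳ _ _ t)
        (λ {g} g∈ → ∈.∈-filter⁺ inCoset? (per g∈ (here refl)) (subst (_∈ S) (sym (x⊕y⊖y≡x g t)) g∈))
      rest-periodic : ∀ {g x} → g ∈ S → x ∈ rest → g ⊕ x ∈ rest
      rest-periodic {g} {x} g∈ x∈ with ∈.∈-filter⁻ (¬? ∘ inCoset?) {xs = T} x∈
      -- If `g ⊕ x` lay in the coset of `t`, then adding `-g`, which is in `S` too, would put `x`
      -- there.
      ... | x∈T , x∉ = ∈.∈-filter⁺ (¬? ∘ inCoset?) (per g∈ x∈T) λ gx∈ → x∉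
        (subst (_∈ S) (⊕-cancelˡ g _ _ (begin
            g ⊕ (# 4 · g ⊕ (g ⊕ x ⊖ t))   ≡⟨ ⊕-comm g _ ⟩
            # 4 · g ⊕ (g ⊕ x ⊖ t) ⊕ g     ≡⟨ cong (_⊕ g) (⊕-comm (# 4 · g) _) ⟩
            (g ⊕ x ⊖ t) ⊖ g ⊕ g           ≡⟨ x⊖y⊕y≡x (g ⊕ x ⊖ t) g ⟩
            g ⊕ x ⊖ t                     ≡⟨ ⊕-assoc g x _ ⟩
            g ⊕ (x ⊖ t)                   ∎))
          (stabiliser-⊕ (stabiliser-neg g∈) gx∈))
        where open ≡-Reasoning

prime-5 : Prime 5
prime-5 = from-yes (prime? 5)

-- Euclid's lemma finds a factor 5 in `d` or in `q`; in the first case it cancels against the power.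
-- For the index `q` of a proper stabiliser this makes `k / 5` of the group a whole number of
-- cosets.
proper-divisor-cofactor : ∀ m d q → d * q ≡ 5 ^ m → ¬ q ≡ 1 → 5 ∣ q
proper-divisor-cofactor zero    d q dq≡ q≢1 = ⊥-elim (q≢1 (ℕ.m*n≡1⇒n≡1 d q dq≡))
proper-divisor-cofactor (suc m) d q dq≡ q≢1 with euclidsLemma d q prime-5 (divides (5 ^ m) (trans dq≡ (ℕ.*-comm 5 (5 ^ m))))
... | inj₂ 5∣q = 5∣q
... | inj₁ (divides e refl) = proper-divisor-cofactor m e q (ℕ.*-cancelˡ-≡ (e * q) (5 ^ m) 5 (trans (reassoc e q) dq≡)) q≢1
  where
  reassoc : ∀ e q → 5 * (e * q) ≡ e * 5 * q
  reassoc = solve-∀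

private
  Avoids : List (Vec5 n) → List (Vec5 n) → List (Vec5 n) → Set
  Avoids X Y Z = ∀ {x y z} → x ∈ X → y ∈ Y → z ∈ Z → ¬ x ⊕ y ≡ z

-- The terminal position of the transform below: X is a union of cosets of its stabiliser S, which contains
-- a translate of Y and is proper, so that |S| divides both |X| and 5^(n-1).
kneser-periodic : ∀ {k} {X Y Z : List (Vec5 n)} {x₀ y₀ z₀} → k ≤ 5 → Unique X → Unique Y → Unique Z →
  x₀ ∈ X → y₀ ∈ Y → z₀ ∈ Z → Avoids X Y Z → k * 5 ^ n < 5 * length Z →
  (∀ {x y y′} → x ∈ X → y ∈ Y → y′ ∈ Y → (x ⊖ y′) ⊕ y ∈ X) →
  5 * (length X + length Y) ≤ (5 ∸ k) * 5 ^ n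
kneser-periodic {n} {k} {X} {Y} {Z} {x₀} {y₀} {z₀} k≤5 uX uY uZ x₀∈ y₀∈ z₀∈ avoid large periodic
  with stabiliser-∣ X uX ∈-stabiliser⁻
     | stabiliser-∣ X (unique-vectors n) (λ _ _ → ∈-vectors _)
... | divides a |X|≡ | divides q |G|≡
  with proper-divisor-cofactor n s q (trans (ℕ.*-comm s q) (trans (sym |G|≡) (length-vectors n))) q≢1
  where
  s = length (stabiliser X)
  -- Translation by `g₀` takes `x₀ ⊕ y₀` to `z₀`. In the stabiliser it would move `x₀` within `X`
  -- and produce a forbidden sum, so the stabiliser is proper.
  g₀ = z₀ ⊖ (x₀ ⊕ y₀)
  g₀∉ : g₀ ∉ stabiliser X
  g₀∉ g₀∈ = avoid (∈-stabiliser⁻ g₀∈ x₀∈) y₀∈ z₀∈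
    (trans (⊕-assoc g₀ x₀ y₀) (x⊖y⊕y≡x z₀ (x₀ ⊕ y₀)))
  q≢1 : ¬ q ≡ 1
  q≢1 refl = ℕ.<⇒≢ (⊆⇒length≤ {xs = g₀ ∷ stabiliser X} {ys = vectors n}
      (All.tabulate (λ g∈ g₀≡ → g₀∉ (subst (_∈ stabiliser X) (sym g₀≡) g∈)) ∷ unique-stabiliser X) (λ _ → ∈-vectors _))
    (sym (trans |G|≡ (ℕ.+-identityʳ s)))
... | divides c refl = begin
  5 * (length X + length Y)   ≤⟨ ℕ.*-monoʳ-≤ 5 (ℕ.+-mono-≤ (ℕ.≤-reflexive |X|≡) |Y|≤s) ⟩
  5 * (a * s + s)             ≡⟨ eq₁ a s ⟩
  -- Both `a` and `(5 ∸ k) * c` count cosets, so the strict inequality between them leaves a whole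
  -- coset free, which is enough room for the at most `s` elements of `Y`.
  suc a * (5 * s)             ≤⟨ ℕ.*-monoˡ-≤ (5 * s) a<  ⟩
  ((5 ∸ k) * c) * (5 * s)     ≡⟨ eq₂ (5 ∸ k) c s ⟩
  (5 ∸ k) * (c * 5 * s)       ≡⟨ cong ((5 ∸ k) *_) |G|≡5^n ⟩
  (5 ∸ k) * 5 ^ n             ∎
  where
  open ℕ.≤-Reasoning
  s = length (stabiliser X)
  |G|≡5^n : c * 5 * s ≡ 5 ^ n
  |G|≡5^n = trans (sym |G|≡) (length-vectors n)
  eq₁ : ∀ a s → 5 * (a * s + s) ≡ suc a * (5 * s)
  eq₁ = solve-∀
  eq₂ : ∀ d c s → (d * c) * (5 * s) ≡ d * (c * 5 * s)
  eq₂ = solve-∀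
  |Y|≤s : length Y ≤ s
  |Y|≤s = injection⇒length≤ (_⊖ y₀) uY (λ _ _ → ⊕-cancelʳ _ _ _)
    λ {y} y∈ → ∈-stabiliser⁺ λ {x} x∈ → subst (_∈ X) (⊖⊕-swap x y₀ y) (periodic x∈ y∈ y₀∈)
  |X|+|Z|≤ : length X + length Z ≤ 5 ^ n
  |X|+|Z|≤ = subst (_≤ 5 ^ n) (trans (List.length-++ (map (_⊕ y₀) X)) (cong (_+ length Z) (List.length-map (_⊕ y₀) X)))
    (length≤5^ (Unique.++⁺ (Unique.map⁺ (⊕-cancelʳ _ _ y₀) uX) uZ
      λ (v∈ , v∈Z) → let x , x∈ , v≡ = ∈.∈-map⁻ (_⊕ y₀) v∈ in avoid x∈ y₀∈ v∈Z (sym v≡)))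
  -- `X ⊕ y₀` is disjoint from `Z`, which fills more than `k / 5` of the group; the rest is
  -- conversion from elements to cosets, with `5 * c` cosets in all.
  a< : a < (5 ∸ k) * c
  a< = ℕ.*-cancelʳ-< (5 * s) _ _ (ℕ.+-cancelʳ-< (k * 5 ^ n) _ _ (begin-strict
    a * (5 * s) + k * 5 ^ n             <⟨ ℕ.+-monoʳ-< (a * (5 * s)) large ⟩
    a * (5 * s) + 5 * length Z          ≡⟨ cong (_+ 5 * length Z) (trans (eq₃ a s) (cong (5 *_) (sym |X|≡))) ⟩
    5 * length X + 5 * length Z         ≡⟨ sym (ℕ.*-distribˡ-+ 5 (length X) (length Z)) ⟩
    5 * (length X + length Z)           ≤⟨ ℕ.*-monoʳ-≤ 5 |X|+|Z|≤ ⟩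
    5 * 5 ^ n                           ≡⟨ cong (_* 5 ^ n) (sym (ℕ.m∸n+n≡m k≤5)) ⟩
    (5 ∸ k + k) * 5 ^ n                 ≡⟨ ℕ.*-distribʳ-+ (5 ^ n) (5 ∸ k) k ⟩
    (5 ∸ k) * 5 ^ n + k * 5 ^ n         ≡⟨ cong (λ w → (5 ∸ k) * w + k * 5 ^ n) (sym |G|≡5^n) ⟩
    (5 ∸ k) * (c * 5 * s) + k * 5 ^ n   ≡⟨ cong (_+ k * 5 ^ n) (sym (eq₂ (5 ∸ k) c s)) ⟩
    (5 ∸ k) * c * (5 * s) + k * 5 ^ n   ∎))
    where
    eq₃ : ∀ a s → a * (5 * s) ≡ 5 * (a * s)
    eq₃ = solve-∀

-- Dyson's e-transform (X , Y) ↦ (X ∪ (e + Y) , Y ∩ (X - e)) keeps |X| + |Y| and shrinks X + Y and Y.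
kneser : ∀ {k} {X Y Z : List (Vec5 n)} {x₀ y₀ z₀} → k ≤ 5 → Unique X → Unique Y → Unique Z →
  x₀ ∈ X → y₀ ∈ Y → z₀ ∈ Z → Avoids X Y Z → k * 5 ^ n < 5 * length Z →
  5 * (length X + length Y) ≤ (5 ∸ k) * 5 ^ n
kneser {n} {k} {X₀} {Y₀} {Z} k≤5 uX₀ uY₀ uZ x₀∈ y₀∈ z₀∈ avoid₀ large =
  go X₀ Y₀ (<-wellFounded (length Y₀)) uX₀ uY₀ x₀∈ y₀∈ avoid₀
  where
  go : ∀ X Y → Acc _<_ (length Y) → Unique X → Unique Y → ∀ {x₀ y₀} → x₀ ∈ X → y₀ ∈ Y → Avoids X Y Z →
    5 * (length X + length Y) ≤ (5 ∸ k) * 5 ^ n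
  go X Y (acc rs) uX uY x₀∈ y₀∈ avoid
    -- A shift `x ⊖ y′` is sought that takes some element of `Y` out of `X`. If there is none, `X`
    -- is invariant under all differences of elements of `Y`.
    with Any.any? (λ x → Any.any? (λ y → Any.any? (λ y′ → ¬? (((x ⊖ y′) ⊕ y) ∈? X)) Y) Y) X
  ... | no ¬escape = kneser-periodic k≤5 uX uY uZ x₀∈ y₀∈ z₀∈ avoid large λ {x} {y} {y′} x∈ y∈ y′∈ →
    decidable-stable (((x ⊖ y′) ⊕ y) ∈? X) λ esc → ¬escape (lose x∈ (lose y∈ (lose y′∈ esc)))
  ... | yes escape with find escape
  ... | x , x∈ , escape₁ with find escape₁
  ... | y , y∈ , escape₂ with find escape₂
  ... | y′ , y′∈ , esc = subst (λ l → 5 * l ≤ (5 ∸ k) * 5 ^ n) same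
    -- The escaping `y` leaves, so `Y` shrinks strictly; `y′` stays, because `e ⊕ y′` is `x`, so
    -- `Y′` is not empty.
    (go X′ Y′ (rs (List.filter-notAll stays? Y (lose y∈ esc)))
      (Unique.++⁺ uX (Unique.map⁺ (⊕-cancelˡ e _ _) (Unique.filter⁺ _ uY)) disjoint) (Unique.filter⁺ _ uY)
      (∈.∈-++⁺ˡ x∈) (∈.∈-filter⁺ stays? y′∈ (subst (_∈ X) (sym (x⊖y⊕y≡x x y′)) x∈)) avoid′)
    where
    e = x ⊖ y′
    stays? = λ y → (e ⊕ y) ∈? X
    leaving = filter (¬? ∘ stays?) Y
    Y′ = filter stays? Y
    -- Only the shifts of leaving elements are new to `X`. The union is therefore disjoint, and what
    -- `Y` loses `X` gains.
    X′ = X ++ map (e ⊕_) leaving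
    disjoint : ∀ {v} → ¬ (v ∈ X × v ∈ map (e ⊕_) leaving)
    disjoint (v∈X , v∈) with ∈.∈-map⁻ (e ⊕_) v∈
    ... | _ , u∈ , refl = proj₂ (∈.∈-filter⁻ (¬? ∘ stays?) {xs = Y} u∈) v∈X
    avoid′ : Avoids X′ Y′ Z
    avoid′ {u} {v} u∈ v∈ z∈ u⊕v≡z with ∈.∈-filter⁻ stays? {xs = Y} v∈ | ∈.∈-++⁻ X u∈
    ... | v∈Y , _   | inj₁ u∈X = avoid u∈X v∈Y z∈ u⊕v≡z
    ... | _ , e⊕v∈X | inj₂ u∈′ with ∈.∈-map⁻ (e ⊕_) u∈′
    -- For `u = e ⊕ w` the shift passes to the other summand: `(e ⊕ w) ⊕ v = (e ⊕ v) ⊕ w`, where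
    -- `e ⊕ v` is in `X` because `v` stayed, and `w` is in `Y`.
    ... | w , w∈ , refl = avoid e⊕v∈X (proj₁ (∈.∈-filter⁻ (¬? ∘ stays?) {xs = Y} w∈)) z∈ (trans (⊕⊕-swap e v w) u⊕v≡z)
    same : length X′ + length Y′ ≡ length X + length Y
    same = begin
      length X′ + length Y′                            ≡⟨ cong (_+ length Y′) (trans (List.length-++ X) (cong (length X +_) (List.length-map (e ⊕_) leaving))) ⟩
      length X + length leaving + length Y′            ≡⟨ ℕ.+-assoc (length X) _ _ ⟩
      length X + (length leaving + length Y′)          ≡⟨ cong (length X +_) (trans (ℕ.+-comm _ (length Y′)) (length-filter-¬ stays? Y)) ⟩
      length X + length Y                              ∎
      where open ≡-Reasoning

-- Hyperplane sections

filter-⊆ : ∀ {A : Set ℓ} {P : Pred A ℓ′} (P? : Decidable P) xs {x} → x ∈ filter P? xs → x ∈ xs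
filter-⊆ P? xs = proj₁ ∘ ∈.∈-filter⁻ P? {xs = xs}

fibre-sum : ∀ {k} (κ : B → Fin k) xs →
  sum (map (λ c → length (filter (λ x → κ x Fin.≟ c) xs)) (allFin k)) ≡ length xs
fibre-sum {k = k} κ xs = trans (count-swap (λ c x → κ x Fin.≟ c) (allFin k) xs) (ones xs)
  where
  one : ∀ a → length (filter (a Fin.≟_) (allFin k)) ≡ 1
  one a = ℕ.≤-antisym
    (⊆⇒length≤ {ys = a ∷ []} (Unique.filter⁺ (a Fin.≟_) (Unique.allFin⁺ k)) λ b∈ → here (sym (proj₂ (∈.∈-filter⁻ (a Fin.≟_) {xs = allFin k} b∈))))
    (⊆⇒length≤ {xs = a ∷ []} {ys = filter (a Fin.≟_) (allFin k)} ([] ∷ []) λ { (here refl) → ∈.∈-filter⁺ (a Fin.≟_) (∈.∈-allFin a) refl })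
  ones : ∀ xs → sum (map (λ x → length (filter (κ x Fin.≟_) (allFin k))) xs) ≡ length xs
  ones []       = refl
  ones (x ∷ xs) = cong₂ _+_ (one (κ x)) (ones xs)

sum-lower-bonus : ∀ {A : Set ℓ} {P : Pred A ℓ′} (P? : Decidable P) (f : A → ℕ) c d xs → (∀ {x} → x ∈ xs → c ≤ f x) →
  (∀ {x} → x ∈ xs → P x → c + d ≤ f x) → length xs * c + length (filter P? xs) * d ≤ sum (map f xs)
sum-lower-bonus P? f c d []       _ _ = z≤n
sum-lower-bonus P? f c d (x ∷ xs) h h′ with sum-lower-bonus P? f c d xs (h ∘ there) (h′ ∘ there) | P? x
... | ih | yes px = subst (_≤ f x + sum (map f xs)) (regroup c d _ _) (ℕ.+-mono-≤ (h′ (here refl) px) ih)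
  where
  regroup : ∀ c d a b → (c + d) + (a + b) ≡ (c + a) + (d + b)
  regroup = solve-∀
... | ih | no _   = subst (_≤ f x + sum (map f xs)) (sym (ℕ.+-assoc c _ _)) (ℕ.+-mono-≤ (h (here refl)) ih)

infix 4 _⊥?_
_⊥?_ : (u x : Vec5 n) → Dec (⟨ u , x ⟩ ≡ zero)
u ⊥? x = ⟨ u , x ⟩ Fin.≟ zero

kernelOf : Vec5 n → List (Vec5 n) → List (Vec5 n)
kernelOf u = filter (u ⊥?_)

annihilators : List (Vec5 n) → Vec5 n → List (Vec5 n)
annihilators us x = filter (_⊥? x) us

⟨,⟩-⊖ˡ : ∀ (u v x : Vec5 n) → ⟨ u ⊖ v , x ⟩ ≡ ⟨ u , x ⟩ +₅ # 4 *₅ ⟨ v , x ⟩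
⟨,⟩-⊖ˡ u v x = trans (⟨,⟩-⊕ˡ u (# 4 · v) x) (cong (⟨ u , x ⟩ +₅_) (⟨,⟩-·ˡ (# 4) v x))

a-a≡0 : ∀ a → a +₅ # 4 *₅ a ≡ zero
a-a≡0 = from-yes (Fin.all? λ a → a +₅ # 4 *₅ a Fin.≟ zero)

annihilators-⊖-closed : ∀ {us : List (Vec5 n)} {x} → (∀ {u v} → u ∈ us → v ∈ us → u ⊖ v ∈ us) →
  ∀ {u v} → u ∈ annihilators us x → v ∈ annihilators us x → u ⊖ v ∈ annihilators us x
annihilators-⊖-closed {us = us} {x} closed {u} {v} u∈ v∈
  with ∈.∈-filter⁻ (_⊥? x) {xs = us} u∈ | ∈.∈-filter⁻ (_⊥? x) {xs = us} v∈
... | u∈us , u⊥ | v∈us , v⊥ = ∈.∈-filter⁺ (_⊥? x) (closed u∈us v∈us)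
  (trans (⟨,⟩-⊖ˡ u v x) (cong₂ (λ a b → a +₅ # 4 *₅ b) u⊥ v⊥))

-- Subtracting one of its elements embeds a fibre of `u ↦ ⟨ u , x ⟩` in the fibre over zero. Only
-- closure under `⊖` is assumed of `us`, since in dimension 3 the bound is also applied inside the
-- annihilator of a vector.
length≤5*annihilators : ∀ {us : List (Vec5 n)} x → Unique us → (∀ {u v} → u ∈ us → v ∈ us → u ⊖ v ∈ us) →
  length us ≤ 5 * length (annihilators us x)
length≤5*annihilators {us = us} x uus closed = subst (_≤ 5 * length (annihilators us x)) (fibre-sum (λ u → ⟨ u , x ⟩) us)
  (sum-upper (λ c → length (fibre c)) _ (allFin 5) λ {c} _ → fibre≤ c (fibre c) refl)
  where
  fibre : F5 → List (Vec5 _)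
  fibre c = filter (λ u → ⟨ u , x ⟩ Fin.≟ c) us
  fibre⁻ : ∀ c {u} → u ∈ fibre c → u ∈ us × ⟨ u , x ⟩ ≡ c
  fibre⁻ c = ∈.∈-filter⁻ (λ u → ⟨ u , x ⟩ Fin.≟ c) {xs = us}
  fibre≤ : ∀ c vs → fibre c ≡ vs → length vs ≤ length (annihilators us x)
  fibre≤ c []          _ = z≤n
  fibre≤ c vs@(v ∷ _) e = injection⇒length≤ (_⊖ v)
    (subst Unique e (Unique.filter⁺ _ uus)) (λ _ _ → ⊕-cancelʳ _ _ _) λ {u} u∈ →
      let u∈us , ux = fibre⁻ c (subst (u ∈_) (sym e) u∈)
          v∈us , vx = fibre⁻ c (subst (v ∈_) (sym e) (here refl))
      in ∈.∈-filter⁺ (_⊥? x) (closed u∈us v∈us)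
           (trans (⟨,⟩-⊖ˡ u v x) (trans (cong₂ (λ a b → a +₅ # 4 *₅ b) ux vx) (a-a≡0 c)))

nonzero? : (u : Vec5 n) → Dec (¬ u ≡ 𝟎)
nonzero? u = ¬? (u ≟ᵥ 𝟎)

nonzeros : List (Vec5 n) → List (Vec5 n)
nonzeros = filter nonzero?

1+length-nonzeros : ∀ {us : List (Vec5 n)} → Unique us → 𝟎 ∈ us → suc (length (nonzeros us)) ≤ length us
1+length-nonzeros {us = us} uus 𝟎∈ = ⊆⇒length≤
  (All.tabulate (λ v∈ 𝟎≡v → proj₂ (∈.∈-filter⁻ nonzero? {xs = us} v∈) (sym 𝟎≡v)) ∷ Unique.filter⁺ nonzero? uus)
  λ { (here refl) → 𝟎∈ ; (there v∈) → filter-⊆ nonzero? us v∈ }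

annihilators-nonzeros : ∀ {us : List (Vec5 n)} x → Unique us →
  length (annihilators us x) ≤ suc (length (annihilators (nonzeros us) x))
annihilators-nonzeros {us = us} x uus = ⊆⇒length≤ {ys = 𝟎 ∷ annihilators (nonzeros us) x} (Unique.filter⁺ (_⊥? x) uus) sub
  where
  sub : ∀ {v} → v ∈ annihilators us x → v ∈ 𝟎 ∷ annihilators (nonzeros us) x
  sub {v} v∈ with v ≟ᵥ 𝟎 | ∈.∈-filter⁻ (_⊥? x) {xs = us} v∈
  ... | yes v≡𝟎 | _         = here v≡𝟎
  ... | no v≢𝟎  | v∈us , v⊥ = there (∈.∈-filter⁺ (_⊥? x) (∈.∈-filter⁺ nonzero? v∈us v≢𝟎) v⊥)

𝟎∉ : ∀ {A : List (Vec5 n)} → SumFree A → 𝟎 ∉ A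
𝟎∉ sf 𝟎∈ = sf 𝟎 𝟎 𝟎 𝟎∈ 𝟎∈ 𝟎∈ (⊕-identityˡ 𝟎)

-- Double counting of the pairs (u , a) with u ≠ 𝟎 and u ⊥ a.
average-all : ∀ (A : List (Vec5 n)) c b → 5 * suc c ≤ 5 ^ n →
  (∀ u → ¬ u ≡ 𝟎 → length (kernelOf u A) ≤ b) →
  ∃ λ l → suc l ≤ 5 ^ n × length A * c ≤ l * b
average-all {n} A c b 5c≤ small = length us , 1+|us|≤ , (begin
  length A * c                                    ≤⟨ sum-lower (λ a → length (annihilators us a)) c A (λ {a} _ → c≤ a) ⟩
  sum (map (λ a → length (annihilators us a)) A)  ≡⟨ sym (count-swap _⊥?_ us A) ⟩
  sum (map (λ u → length (kernelOf u A)) us)      ≤⟨ sum-upper (λ u → length (kernelOf u A)) b us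
                                                       (λ {u} u∈ → small u (proj₂ (∈.∈-filter⁻ nonzero? {xs = vectors n} u∈))) ⟩
  length us * b                                   ∎)
  where
  open ℕ.≤-Reasoning
  us = nonzeros (vectors n)
  1+|us|≤ : suc (length us) ≤ 5 ^ n
  1+|us|≤ = subst (suc (length us) ≤_) (length-vectors n) (1+length-nonzeros (unique-vectors n) (∈-vectors 𝟎))
  c≤ : ∀ a → c ≤ length (annihilators us a)
  c≤ a = s≤s⁻¹ (ℕ.*-cancelˡ-≤ 5 (begin
    5 * suc c                                ≤⟨ 5c≤ ⟩
    5 ^ n                                    ≡⟨ sym (length-vectors n) ⟩
    length (vectors n)                       ≤⟨ length≤5*annihilators a (unique-vectors n) (λ _ _ → ∈-vectors _) ⟩
    5 * length (annihilators (vectors n) a)  ≤⟨ ℕ.*-monoʳ-≤ 5 (annihilators-nonzeros a (unique-vectors n)) ⟩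
    5 * suc (length (annihilators us a))     ∎))

-- The coordinate of an annihilator at a pivot of `x` is determined by the others. This upper bound
-- limits the number of functionals when the average runs only over those vanishing at a given
-- vector.
length-annihilators≤ : ∀ (x : Vec5 (suc n)) → ¬ x ≡ 𝟎 → length (annihilators (vectors (suc n)) x) ≤ 5 ^ n
length-annihilators≤ {n} x x≢𝟎 with pivot x x≢𝟎
... | k , xₖ≢0 = subst (length (annihilators (vectors (suc n)) x) ≤_) (length-vectors n)
  (injection⇒length≤ (λ u → removeAt u k) (Unique.filter⁺ (_⊥? x) (unique-vectors (suc n)))
    (λ {u} {v} u∈ v∈ → removeAt-injective x u v k xₖ≢0 (trans (⊥⇒ u∈) (sym (⊥⇒ v∈)))) (λ _ → ∈-vectors _))
  where
  ⊥⇒ : ∀ {u} → u ∈ annihilators (vectors (suc n)) x → ⟨ x , u ⟩ ≡ zero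
  ⊥⇒ {u} u∈ = trans (⟨,⟩-comm x u) (proj₂ (∈.∈-filter⁻ (_⊥? x) {xs = vectors (suc n)} u∈))

a≡4a⇒0 : ∀ a → # 4 *₅ a ≡ a → a ≡ zero
a≡4a⇒0 = from-yes (Fin.all? λ a → (# 4 *₅ a Fin.≟ a) →-dec (a Fin.≟ zero))

4x≡x⇒x≡𝟎 : ∀ (x : Vec5 n) → # 4 · x ≡ x → x ≡ 𝟎
4x≡x⇒x≡𝟎 []      _ = refl
4x≡x⇒x≡𝟎 (a ∷ x) e = cong₂ _∷_ (a≡4a⇒0 a (cong Vec.head e)) (4x≡x⇒x≡𝟎 x (cong Vec.tail e))

-- Double counting of the pairs (u , b) with 𝟎 ≠ u ⊥ a and u ⊥ b; the elements b = ± a count five times as much.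
antipodal-pair⇒large-section : ∀ {A : List (Vec5 3)} {a} → Unique A → SumFree A → 31 ≤ length A → a ∈ A → # 4 · a ∈ A →
  ¬ (∀ u → ¬ u ≡ 𝟎 → length (kernelOf u A) ≤ 6)
antipodal-pair⇒large-section {A} {a} uA sf 31≤ a∈ -a∈ small = ℕ.<⇒≱ 144<164 (begin
  -- Each `b` in `A` is orthogonal to at least 25 / 5 - 1 = 4 nonzero `u` with `u ⊥ a`, and `± a` to
  -- at least 24, which is 20 more. The total 164 exceeds the 24 · 6 = 144 that small sections
  -- allow.
  31 * 4 + 2 * 20                                    ≤⟨ ℕ.+-mono-≤ (ℕ.*-monoˡ-≤ 4 31≤) (ℕ.*-monoˡ-≤ 20 two) ⟩
  length A * 4 + length (filter ±a? A) * 20          ≤⟨ sum-lower-bonus ±a? (λ b → length (annihilators us b)) 4 20 A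
                                                          (λ {b} _ → four b) (λ {b} _ → twenty-four b) ⟩
  sum (map (λ b → length (annihilators us b)) A)     ≡⟨ sym (count-swap _⊥?_ us A) ⟩
  sum (map (λ u → length (kernelOf u A)) us)         ≤⟨ sum-upper (λ u → length (kernelOf u A)) 6 us
                                                          (λ {u} u∈ → small u (proj₂ (∈.∈-filter⁻ nonzero? {xs = perp} u∈))) ⟩
  length us * 6                                      ≤⟨ ℕ.*-monoˡ-≤ 6 |us|≤24 ⟩
  144                                                ∎)
  where
  open ℕ.≤-Reasoning
  144<164 : 144 < 164
  144<164 = from-yes (144 <? 164)
  a≢𝟎 : ¬ a ≡ 𝟎
  a≢𝟎 a≡𝟎 = 𝟎∉ sf (subst (_∈ A) a≡𝟎 a∈)
  ±a? : Decidable (λ b → b ≡ a ⊎ b ≡ # 4 · a)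
  ±a? b = (b ≟ᵥ a) ⊎-dec (b ≟ᵥ # 4 · a)
  perp = annihilators (vectors 3) a
  us = nonzeros perp
  u-perp : Unique perp
  u-perp = Unique.filter⁺ (_⊥? a) (unique-vectors 3)
  perp-closed : ∀ {u v} → u ∈ perp → v ∈ perp → u ⊖ v ∈ perp
  perp-closed = annihilators-⊖-closed (λ _ _ → ∈-vectors _)
  25≤|perp| : 25 ≤ length perp
  25≤|perp| = ℕ.*-cancelˡ-≤ {25} {length perp} 5 (subst (_≤ 5 * length perp) (length-vectors 3)
    (length≤5*annihilators {us = vectors 3} a (unique-vectors 3) λ _ _ → ∈-vectors _))
  |us|≤24 : length us ≤ 24
  |us|≤24 = s≤s⁻¹ {length us} {24} (begin
    suc (length us)  ≤⟨ 1+length-nonzeros {us = perp} u-perp (∈.∈-filter⁺ (_⊥? a) (∈-vectors 𝟎) (𝟎-⟨,⟩ a)) ⟩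
    length perp      ≤⟨ length-annihilators≤ {2} a a≢𝟎 ⟩
    25               ∎)
  four : ∀ b → 4 ≤ length (annihilators us b)
  four b = s≤s⁻¹ {4} {length (annihilators us b)} (begin
    5                                  ≤⟨ ℕ.*-cancelˡ-≤ {5} {length (annihilators perp b)} 5 (ℕ.≤-trans 25≤|perp| (length≤5*annihilators {us = perp} b u-perp perp-closed)) ⟩
    length (annihilators perp b)       ≤⟨ annihilators-nonzeros {us = perp} b u-perp ⟩
    suc (length (annihilators us b))   ∎)
  annihilated : ∀ {b} → b ≡ a ⊎ b ≡ # 4 · a → ∀ {u} → u ∈ perp → ⟨ u , b ⟩ ≡ zero
  annihilated (inj₁ refl) u∈ = proj₂ (∈.∈-filter⁻ (_⊥? a) {xs = vectors 3} u∈)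
  annihilated (inj₂ refl) {u} u∈ = trans (⟨,⟩-·ʳ u (# 4) a) (cong (# 4 *₅_) (annihilated (inj₁ refl) u∈))
  twenty-four : ∀ b → b ≡ a ⊎ b ≡ # 4 · a → 24 ≤ length (annihilators us b)
  twenty-four b b≡ = s≤s⁻¹ {24} {length (annihilators us b)} (begin
    25                                 ≤⟨ 25≤|perp| ⟩
    length perp                        ≡⟨ cong length (sym (List.filter-all (_⊥? b) (All.tabulate (annihilated b≡)))) ⟩
    length (annihilators perp b)       ≤⟨ annihilators-nonzeros {us = perp} b u-perp ⟩
    suc (length (annihilators us b))   ∎)
  two : 2 ≤ length (filter ±a? A)
  two = ⊆⇒length≤ {xs = a ∷ # 4 · a ∷ []} {ys = filter ±a? A} (((λ a≡4a → a≢𝟎 (4x≡x⇒x≡𝟎 a (sym a≡4a))) ∷ []) ∷ [] ∷ [])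
    λ { (here refl) → ∈.∈-filter⁺ ±a? a∈ (inj₁ refl) ; (there (here refl)) → ∈.∈-filter⁺ ±a? -a∈ (inj₂ refl) }

-- Dimension 3 without antipodal pairs

abstract
  -- `suc e` is the quotient of the units `suc c` and `suc d`. The quantifier over `a` stands
  -- inside, so that one `e` serves all coordinates of a vector.
  units-quotient : ∀ (c d : Fin 4) → ∃ λ (e : Fin 4) → ∀ (a : F5) → suc c *₅ a ≡ suc d *₅ (suc e *₅ a)
  units-quotient = from-yes (Fin.all? λ c → Fin.all? λ d → Fin.any? λ e → Fin.all? λ a → suc c *₅ a Fin.≟ suc d *₅ (suc e *₅ a))

·-units-quotient : ∀ (c d : Fin 4) → ∃ λ (e : Fin 4) → ∀ {n} (x : Vec5 n) → suc c · x ≡ suc d · (suc e · x)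
·-units-quotient c d with units-quotient c d
... | e , h = e , go
  where
  go : ∀ {n} (x : Vec5 n) → suc c · x ≡ suc d · (suc e · x)
  go []      = refl
  go (a ∷ x) = cong₂ _∷_ (h a) (go x)

*₅-cancelʳ : ∀ a b c → ¬ c ≡ zero → a *₅ c ≡ b *₅ c → a ≡ b
*₅-cancelʳ a b c c≢0 e = *₅-cancelˡ c a b c≢0 (trans (*₅-comm c a) (trans e (*₅-comm b c)))

·-cancelʳ : ∀ c d (x : Vec5 n) → ¬ x ≡ 𝟎 → c · x ≡ d · x → c ≡ d
·-cancelʳ c d x x≢𝟎 e with pivot x x≢𝟎
... | k , xₖ≢0 = *₅-cancelʳ c d (Vec.lookup x k) xₖ≢0
  (trans (sym (Vec.lookup-map k (c *₅_) x)) (trans (cong (λ y → Vec.lookup y k) e) (Vec.lookup-map k (d *₅_) x)))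

·-𝟎 : ∀ c → c · 𝟎 {n} ≡ 𝟎
·-𝟎 {zero}  c = refl
·-𝟎 {suc n} c = cong₂ _∷_ (*₅-comm c zero) (·-𝟎 c)

module _ {A : List (Vec5 n)} (uA : Unique A) (sf : SumFree A) (no-pair : ∀ {a} → a ∈ A → ¬ # 4 · a ∈ A) where

  ∈⇒≢𝟎 : ∀ {a} → a ∈ A → ¬ a ≡ 𝟎
  ∈⇒≢𝟎 a∈ a≡𝟎 = 𝟎∉ sf (subst (_∈ A) a≡𝟎 a∈)

  -- Sum-freeness excludes `2a` because `a + a = 2a`, and `3a` because `3a + 3a = a`. Only `4a = -a`
  -- needs `no-pair`.
  multiple∈⇒1 : ∀ {a} (e : Fin 4) → a ∈ A → suc e · a ∈ A → e ≡ zero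
  multiple∈⇒1 zero                       _  _   = refl
  multiple∈⇒1 {a} (suc zero)             a∈ 2a∈ = ⊥-elim (sf a a (# 2 · a) a∈ a∈ 2a∈ (a+a≡2a a))
    where
    a+a≡2a : ∀ {n} (x : Vec5 n) → x ⊕ x ≡ # 2 · x
    a+a≡2a []      = refl
    a+a≡2a (b ∷ x) = cong₂ _∷_ (from-yes (Fin.all? λ b → b +₅ b Fin.≟ # 2 *₅ b) b) (a+a≡2a x)
  multiple∈⇒1 {a} (suc (suc zero))       a∈ 3a∈ = ⊥-elim (sf (# 3 · a) (# 3 · a) a 3a∈ 3a∈ a∈ (3a+3a≡a a))
    where
    3a+3a≡a : ∀ {n} (x : Vec5 n) → # 3 · x ⊕ # 3 · x ≡ x
    3a+3a≡a []      = refl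
    3a+3a≡a (b ∷ x) = cong₂ _∷_ (from-yes (Fin.all? λ b → # 3 *₅ b +₅ # 3 *₅ b Fin.≟ b) b) (3a+3a≡a x)
  multiple∈⇒1 (suc (suc (suc zero)))     a∈ 4a∈ = ⊥-elim (no-pair a∈ 4a∈)

  private
    pairs : List (Fin 4 × Vec5 n)
    pairs = cartesianProduct (allFin 4) A
    multiple : Fin 4 × Vec5 n → Vec5 n
    multiple (e , a) = suc e · a
    ∈-pairs : ∀ {p} → p ∈ pairs → proj₂ p ∈ A
    ∈-pairs p∈ = proj₂ (∈.∈-cartesianProduct⁻ (allFin 4) A p∈)

    multiple-injective : ∀ {p q} → p ∈ pairs → q ∈ pairs → multiple p ≡ multiple q → p ≡ q
    multiple-injective {c , a} {d , b} p∈ q∈ e with ·-units-quotient c d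
    ... | f , quot with ·-cancelˡ (suc d) (suc f · a) b (λ ()) (trans (sym (quot a)) e)
    ... | fa≡b with multiple∈⇒1 f (∈-pairs p∈) (subst (_∈ A) (sym fa≡b) (∈-pairs q∈))
    ... | refl with trans (sym (·-identityˡ a)) fa≡b
    ... | refl = cong (_, a) (Fin.suc-injective (·-cancelʳ (suc c) (suc d) a (∈⇒≢𝟎 (∈-pairs p∈)) e))

  -- The sets A, 2A, 3A and 4A are disjoint and avoid 𝟎.
  meets-all-lines : 5 ^ n ≤ suc (4 * length A) → ∀ v → ¬ v ≡ 𝟎 → ∃ λ (e : Fin 4) → suc e · v ∈ A
  meets-all-lines full v v≢𝟎 with v ∈? map multiple pairs
  ... | yes v∈ with ∈.∈-map⁻ multiple v∈
  ... | (c , a) , p∈ , refl with ·-units-quotient zero c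
  ... | e , quot = e , subst (_∈ A) (·-cancelˡ (suc c) a _ (λ ()) ca≡cecA) (∈-pairs p∈)
    where
    ca≡cecA : suc c · a ≡ suc c · (suc e · (suc c · a))
    ca≡cecA = trans (sym (·-identityˡ _)) (quot (suc c · a))
  -- A vector `v` that is no multiple would give, together with `𝟎`, `4 * length A + 2` distinct
  -- vectors.
  meets-all-lines full v v≢𝟎 | no v∉ = ⊥-elim (ℕ.<⇒≱ (begin-strict
    5 ^ n                                  ≤⟨ full ⟩
    suc (4 * length A)                     ≡⟨ cong suc (sym (trans (List.length-map multiple pairs) (length-cartesianProduct (allFin 4)))) ⟩
    suc (length (map multiple pairs))      <⟨ ℕ.n<1+n _ ⟩
    length (𝟎 ∷ v ∷ map multiple pairs)    ∎) (length≤5^ ((All.tabulate 𝟎≢) ∷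
      All.tabulate (λ w∈ v≡w → v∉ (subst (_∈ _) (sym v≡w) w∈)) ∷
      unique-map multiple multiple-injective (Unique.cartesianProduct⁺ (Unique.allFin⁺ 4) uA))))
    where
    open ℕ.≤-Reasoning
    length-cartesianProduct : ∀ (es : List (Fin 4)) → length (cartesianProduct es A) ≡ length es * length A
    length-cartesianProduct []       = refl
    length-cartesianProduct (e ∷ es) = trans (List.length-++ (map (e ,_) A)) (cong₂ _+_ (List.length-map (e ,_) A) (length-cartesianProduct es))
    𝟎≢ : ∀ {w} → w ∈ v ∷ map multiple pairs → ¬ 𝟎 ≡ w
    𝟎≢ (here refl) 𝟎≡v = v≢𝟎 (sym 𝟎≡v)
    𝟎≢ (there w∈)  𝟎≡w with ∈.∈-map⁻ multiple w∈
    ... | (c , a) , p∈ , refl = ∈⇒≢𝟎 (∈-pairs p∈) (·-cancelˡ (suc c) a 𝟎 (λ ()) (trans (sym 𝟎≡w) (sym (·-𝟎 (suc c)))))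

module _ (k : Fin 4 → Fin 4) where

  -- One point on each of the six lines through the origin of the plane: on the axes it is
  -- normalised by the choice of coordinates, on the line of slope `suc t` it is determined up to
  -- the scalar `suc (k t)`.
  planePoint : Fin 6 → F5 × F5
  planePoint zero          = # 1 , # 0
  planePoint (suc zero)    = # 0 , # 1
  planePoint (suc (suc t)) = suc (k t) *₅ # 1 , suc (k t) *₅ suc t

SumOfPlanePoints : (Fin 4 → Fin 4) → Set
SumOfPlanePoints k = ∃ λ h → ∃ λ i → ∃ λ j →
  proj₁ (planePoint k h) +₅ proj₁ (planePoint k i) ≡ proj₁ (planePoint k j) ×
  proj₂ (planePoint k h) +₅ proj₂ (planePoint k i) ≡ proj₂ (planePoint k j)

abstract
  -- A check of the 4 · 4 · 4 · 4 = 256 choices of scalars. The four values are quantified one by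
  -- one, because `Fin.all?` runs over elements of `Fin 4` and not over functions.
  sumOfPlanePoints : ∀ k₁ k₂ k₃ k₄ → SumOfPlanePoints (Vec.lookup (k₁ ∷ k₂ ∷ k₃ ∷ k₄ ∷ []))
  sumOfPlanePoints = from-yes (Fin.all? λ k₁ → Fin.all? λ k₂ → Fin.all? λ k₃ → Fin.all? λ k₄ →
    let P = planePoint (Vec.lookup (k₁ ∷ k₂ ∷ k₃ ∷ k₄ ∷ [])) in Fin.any? λ h → Fin.any? λ i → Fin.any? λ j →
    (proj₁ (P h) +₅ proj₁ (P i) Fin.≟ proj₁ (P j)) ×-dec (proj₂ (P h) +₅ proj₂ (P i) Fin.≟ proj₂ (P j)))

*₅-swap : ∀ a b c → a *₅ (b *₅ c) ≡ b *₅ (a *₅ c)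
*₅-swap a b c = trans (sym (*₅-assoc a b c)) (trans (cong (_*₅ c) (*₅-comm a b)) (*₅-assoc b a c))

sumFree⇒misses-line : ∀ {A : List (Vec5 (2 + n))} → SumFree A → ¬ (∀ v → ¬ v ≡ 𝟎 → ∃ λ (e : Fin 4) → suc e · v ∈ A)
sumFree⇒misses-line {n} {A} sf meets =
  let h , i , j , e₁ , e₂ = sumOfPlanePoints (k (# 0)) (k (# 1)) (k (# 2)) (k (# 3))
  in sf _ _ _ (embed∈ h) (embed∈ i) (embed∈ j) (embed-+ (P h) (P i) (P j) e₁ e₂)
  where
  -- Rescaling the first two coordinates by `suc c` and `suc d` makes the elements of `A` on the
  -- axes the images of (1 , 0) and (0 , 1) under `embed`.
  c = proj₁ (meets (# 1 ∷ # 0 ∷ 𝟎) (λ ()))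
  d = proj₁ (meets (# 0 ∷ # 1 ∷ 𝟎) (λ ()))
  embed : F5 × F5 → Vec5 (2 + n)
  embed (a , b) = suc c *₅ a ∷ suc d *₅ b ∷ 𝟎
  embed≢𝟎 : ∀ (c : Fin 4) b {m} {x : Vec5 m} → ¬ suc c *₅ # 1 ∷ b ∷ x ≡ 𝟎
  embed≢𝟎 zero                   b ()
  embed≢𝟎 (suc zero)             b ()
  embed≢𝟎 (suc (suc zero))       b ()
  embed≢𝟎 (suc (suc (suc zero))) b ()
  k : Fin 4 → Fin 4
  k t = proj₁ (meets (embed (# 1 , suc t)) (embed≢𝟎 c (suc d *₅ suc t)))
  P = planePoint (Vec.lookup (k (# 0) ∷ k (# 1) ∷ k (# 2) ∷ k (# 3) ∷ []))
  embed-· : ∀ e a b → e · embed (a , b) ≡ embed (e *₅ a , e *₅ b)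
  embed-· e a b = cong₂ _∷_ (*₅-swap e (suc c) a) (cong₂ _∷_ (*₅-swap e (suc d) b) (·-𝟎 e))
  embed-+ : ∀ p q r → proj₁ p +₅ proj₁ q ≡ proj₁ r → proj₂ p +₅ proj₂ q ≡ proj₂ r → embed p ⊕ embed q ≡ embed r
  embed-+ p q r e₁ e₂ = cong₂ _∷_ (trans (sym (*₅-distribˡ-+₅ (suc c) (proj₁ p) (proj₁ q))) (cong (suc c *₅_) e₁))
    (cong₂ _∷_ (trans (sym (*₅-distribˡ-+₅ (suc d) (proj₂ p) (proj₂ q))) (cong (suc d *₅_) e₂)) (⊕-identityˡ 𝟎))
  line∈ : ∀ t → embed (suc (k t) *₅ # 1 , suc (k t) *₅ suc t) ∈ A
  line∈ t = subst (_∈ A) (embed-· (suc (k t)) (# 1) (suc t))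
    (proj₂ (meets (embed (# 1 , suc t)) (embed≢𝟎 c (suc d *₅ suc t))))
  embed∈ : ∀ i → embed (P i) ∈ A
  embed∈ zero          = subst (_∈ A) (cong (suc c *₅ # 1 ∷_) (cong₂ _∷_ (trans (*₅-comm (suc c) zero) (*₅-comm zero (suc d))) (·-𝟎 (suc c))))
    (proj₂ (meets (# 1 ∷ # 0 ∷ 𝟎) (λ ())))
  embed∈ (suc zero)    = subst (_∈ A) (cong₂ _∷_ (trans (*₅-comm (suc d) zero) (*₅-comm zero (suc c))) (cong (suc d *₅ # 1 ∷_) (·-𝟎 (suc d))))
    (proj₂ (meets (# 0 ∷ # 1 ∷ 𝟎) (λ ())))
  embed∈ (suc (suc zero))                   = line∈ (# 0)
  embed∈ (suc (suc (suc zero)))             = line∈ (# 1)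
  embed∈ (suc (suc (suc (suc zero))))       = line∈ (# 2)
  embed∈ (suc (suc (suc (suc (suc zero))))) = line∈ (# 3)

-- Existence of a large hyperplane section

kernelBound : ℕ → ℕ
-- The integer part of 6 / 5. This rounding decides dimension 2, where the bound 1.2 would leave 7 ·
-- 4 = 28 below 24 · 1.2.
kernelBound zero    = 1
kernelBound (suc m) = 6 * 5 ^ m

no-small-kernels : ∀ m {A : List (Vec5 (2 + m))} → Unique A → SumFree A → 6 * 5 ^ m < length A →
  ¬ (∀ u → ¬ u ≡ 𝟎 → length (kernelOf u A) ≤ kernelBound m)
no-small-kernels zero {A} _ _ large small =
  let l , l≤ , bound = average-all A 4 1 ℕ.≤-refl small
  -- Seven elements, each orthogonal to at least four nonzero functionals, against at most 24
  -- functionals with at most one element of `A` in each kernel.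
  in from-no (28 ≤? 24) (ℕ.≤-trans (ℕ.*-monoˡ-≤ 4 large) (ℕ.≤-trans bound (ℕ.≤-trans (ℕ.≤-reflexive (ℕ.*-identityʳ l)) (s≤s⁻¹ l≤))))
no-small-kernels (suc zero) {A} uA sf large small with Any.any? (λ a → (# 4 · a) ∈? A) A
... | yes pair = let a , a∈ , -a∈ = find pair in antipodal-pair⇒large-section uA sf large a∈ -a∈ small
-- With 31 elements, 1 + 4 · 31 = 125 is exactly the size of the space.
... | no ¬pair = sumFree⇒misses-line sf (meets-all-lines uA sf (λ a∈ -a∈ → ¬pair (lose a∈ -a∈)) (s≤s (ℕ.*-monoʳ-≤ 4 large)))
no-small-kernels (suc (suc m)) {A} _ _ large small = ℕ.<⇒≱ 24r<c (ℕ.+-cancelˡ-≤ (30 * r * c) _ _ (begin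
  -- The excess of `length A` over `30 * r` contributes `c = 25 * r - 1`. That there may be
  -- `5 * c + 4` functionals, and not just `5 * c`, costs `24 * r`. The comparison is won as soon as
  -- `r > 1`.
  30 * r * c + c                  ≡⟨ eq₁ r c ⟩
  suc (6 * (5 * r)) * c           ≤⟨ ℕ.*-monoˡ-≤ c large ⟩
  length A * c                    ≤⟨ bound ⟩
  l * (6 * r)                     ≤⟨ ℕ.*-monoˡ-≤ (6 * r) l≤5c+4 ⟩
  (5 * c + 4) * (6 * r)           ≡⟨ eq₂ r c ⟩
  30 * r * c + 24 * r             ∎))
  where
  open ℕ.≤-Reasoning
  r = 5 * 5 ^ m
  c = pred (25 * r)
  eq₁ : ∀ r c → 30 * r * c + c ≡ suc (6 * (5 * r)) * c
  eq₁ = solve-∀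
  eq₂ : ∀ r c → (5 * c + 4) * (6 * r) ≡ 30 * r * c + 24 * r
  eq₂ = solve-∀
  eq₃ : ∀ r → 5 * (25 * r) ≡ 5 * (5 * (5 * r))
  eq₃ = solve-∀
  eq₄ : ∀ c → 5 * suc c ≡ suc (5 * c + 4)
  eq₄ = solve-∀
  5≤r : 5 ≤ r
  5≤r = ℕ.*-monoʳ-≤ 5 (ℕ.m^n>0 5 m)
  1+c≡25r : suc c ≡ 25 * r
  1+c≡25r = ℕ.suc-pred (25 * r) {{>-nonZero (ℕ.≤-trans (s≤s z≤n) (ℕ.*-monoʳ-≤ 25 5≤r))}}
  averaged = average-all A c (6 * r) (ℕ.≤-reflexive (trans (cong (5 *_) 1+c≡25r) (eq₃ r))) small
  l = proj₁ averaged
  bound = proj₂ (proj₂ averaged)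
  l≤5c+4 : l ≤ 5 * c + 4
  l≤5c+4 = s≤s⁻¹ (begin
    suc l              ≤⟨ proj₁ (proj₂ averaged) ⟩
    5 * (5 * (5 * r))  ≡⟨ trans (sym (eq₃ r)) (cong (5 *_) (sym 1+c≡25r)) ⟩
    5 * suc c          ≡⟨ eq₄ c ⟩
    suc (5 * c + 4)    ∎)
  24r<c : 24 * r < c
  24r<c = s≤s⁻¹ (begin
    2 + 24 * r         ≤⟨ ℕ.+-monoˡ-≤ (24 * r) (ℕ.≤-trans (s≤s (s≤s z≤n)) 5≤r) ⟩
    r + 24 * r         ≡⟨⟩
    25 * r             ≡⟨ sym 1+c≡25r ⟩
    suc c              ∎)

large-section : ∀ m {A : List (Vec5 (2 + m))} → Unique A → SumFree A → 6 * 5 ^ suc m < 5 * length A →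
  ∃ λ u → ¬ u ≡ 𝟎 × 6 * 5 ^ m < 5 * length (kernelOf u A)
large-section m {A} uA sf large
  with Any.any? (λ u → nonzero? u ×-dec (6 * 5 ^ m <? 5 * length (kernelOf u A))) (vectors (2 + m))
... | yes found = let u , _ , h = find found in u , h
... | no ¬found = ⊥-elim (no-small-kernels m uA sf (ℕ.*-cancelˡ-< 5 _ _ (subst (_< 5 * length A) (eq (5 ^ m)) large))
    λ u u≢𝟎 → bound m (ℕ.≮⇒≥ λ big → ¬found (lose (∈-vectors u) (u≢𝟎 , big))))
  where
  eq : ∀ q → 6 * (5 * q) ≡ 5 * (6 * q)
  eq = solve-∀
  bound : ∀ m {k} → 5 * k ≤ 6 * 5 ^ m → k ≤ kernelBound m
  bound zero    {k} h = s≤s⁻¹ (ℕ.*-cancelˡ-< 5 k 2 (ℕ.≤-<-trans h (from-yes (6 <? 10))))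
  bound (suc m) {k} h = ℕ.*-cancelˡ-≤ 5 (subst (5 * k ≤_) (eq (5 ^ m)) h)

-- Weights on F₅²

n≡0⊎n>0 : ∀ n → n ≡ 0 ⊎ 0 < n
n≡0⊎n>0 zero    = inj₁ refl
n≡0⊎n>0 (suc n) = inj₂ (s≤s z≤n)

Cell : Set
Cell = Fin 25

cell : F5 → F5 → Cell
cell = combine

row col : Cell → F5
row p = proj₁ (remQuot {5} 5 p)
col p = proj₂ (remQuot {5} 5 p)

infixl 6 _⊞_ _⊟_
_⊞_ _⊟_ : Cell → Cell → Cell
p ⊞ q = cell (row p +₅ row q) (col p +₅ col q)
p ⊟ q = cell (row p +₅ # 4 *₅ row q) (col p +₅ # 4 *₅ col q)

Σ-all : (Fin n → ℕ) → ℕ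
Σ-all {zero}  f = 0
Σ-all {suc n} f = f zero + Σ-all (f ∘ suc)

dot : Vec ℕ n → (Fin n → ℕ) → ℕ
dot []      f = 0
dot (c ∷ v) f = c * f zero + dot v (f ∘ suc)

dot-increment : ∀ (v : Vec ℕ n) i f → dot (updateAt v i suc) f ≡ f i + dot v f
dot-increment (c ∷ v) zero    f = ℕ.+-assoc (f zero) (c * f zero) _
dot-increment (c ∷ v) (suc i) f = trans (cong (c * f zero +_) (dot-increment v i (f ∘ suc)))
  (exchange (c * f zero) (f (suc i)) _)
  where
  exchange : ∀ a b d → a + (b + d) ≡ b + (a + d)
  exchange = solve-∀

dot-zero : ∀ n f → dot (replicate n 0) f ≡ 0
dot-zero zero    f = refl
dot-zero (suc n) f = dot-zero n (f ∘ suc)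

-- With coverage c of each position: what it costs to raise the coverage to D, and what lowering it to D gains.
raise lower : ℕ → Vec ℕ n → Vec ℕ n → ℕ
raise D []      []       = 0
raise D (c ∷ v) (h ∷ hi) = (D ∸ c) * h + raise D v hi
lower D []      []       = 0
lower D (c ∷ v) (l ∷ lo) = (c ∸ D) * (l ∸ 1) + lower D v lo

-- One of `D ∸ c` and `c ∸ D` vanishes: a position covered too little needs only the upper bound on
-- `b`, one covered too often only the lower bound.
adjust : ∀ D c h l b N → (l ∸ 1) * N ≤ b → b ≤ h * N → D * b + (c ∸ D) * (l ∸ 1) * N ≤ c * b + (D ∸ c) * h * N
adjust D c h l b N l≤ ≤h with ℕ.≤-total c D
... | inj₁ c≤D rewrite ℕ.m≤n⇒m∸n≡0 c≤D = begin
  D * b + 0                     ≡⟨ ℕ.+-identityʳ (D * b) ⟩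
  D * b                         ≡⟨ cong (_* b) (sym (ℕ.m+[n∸m]≡n c≤D)) ⟩
  (c + (D ∸ c)) * b             ≡⟨ ℕ.*-distribʳ-+ b c (D ∸ c) ⟩
  c * b + (D ∸ c) * b           ≤⟨ ℕ.+-monoʳ-≤ (c * b) (ℕ.*-monoʳ-≤ (D ∸ c) ≤h) ⟩
  c * b + (D ∸ c) * (h * N)     ≡⟨ cong (c * b +_) (sym (ℕ.*-assoc (D ∸ c) h N)) ⟩
  c * b + (D ∸ c) * h * N       ∎
  where open ℕ.≤-Reasoning
... | inj₂ D≤c rewrite ℕ.m≤n⇒m∸n≡0 D≤c = begin
  D * b + (c ∸ D) * (l ∸ 1) * N    ≡⟨ cong (D * b +_) (ℕ.*-assoc (c ∸ D) (l ∸ 1) N) ⟩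
  D * b + (c ∸ D) * ((l ∸ 1) * N)  ≤⟨ ℕ.+-monoʳ-≤ (D * b) (ℕ.*-monoʳ-≤ (c ∸ D) l≤) ⟩
  D * b + (c ∸ D) * b              ≡⟨ sym (ℕ.*-distribʳ-+ b D (c ∸ D)) ⟩
  (D + (c ∸ D)) * b                ≡⟨ cong (_* b) (ℕ.m+[n∸m]≡n D≤c) ⟩
  c * b                            ≡⟨ sym (ℕ.+-identityʳ (c * b)) ⟩
  c * b + 0                        ∎
  where open ℕ.≤-Reasoning

balance : ∀ D N (v lo hi : Vec ℕ n) f → (∀ i → (lookup lo i ∸ 1) * N ≤ f i) → (∀ i → f i ≤ lookup hi i * N) →
  D * Σ-all f + lower D v lo * N ≤ dot v f + raise D v hi * N
balance D N []      []       []       f l≤ ≤h = ℕ.≤-reflexive (cong (_+ 0) (ℕ.*-zeroʳ D))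
balance D N (c ∷ v) (l ∷ lo) (h ∷ hi) f l≤ ≤h = begin
  D * (f zero + Σ-all (f ∘ suc)) + ((c ∸ D) * (l ∸ 1) + lower D v lo) * N
    ≡⟨ regroup₁ D (f zero) (Σ-all (f ∘ suc)) ((c ∸ D) * (l ∸ 1)) (lower D v lo) N ⟩
  (D * f zero + (c ∸ D) * (l ∸ 1) * N) + (D * Σ-all (f ∘ suc) + lower D v lo * N)
    ≤⟨ ℕ.+-mono-≤ (adjust D c h l (f zero) N (l≤ zero) (≤h zero)) (balance D N v lo hi (f ∘ suc) (l≤ ∘ suc) (≤h ∘ suc)) ⟩
  (c * f zero + (D ∸ c) * h * N) + (dot v (f ∘ suc) + raise D v hi * N)
    ≡⟨ regroup₂ (c * f zero) (dot v (f ∘ suc)) ((D ∸ c) * h) (raise D v hi) N ⟩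
  c * f zero + dot v (f ∘ suc) + ((D ∸ c) * h + raise D v hi) * N ∎
  where
  open ℕ.≤-Reasoning
  regroup₁ : ∀ D a b x y N → D * (a + b) + (x + y) * N ≡ (D * a + x * N) + (D * b + y * N)
  regroup₁ = solve-∀
  regroup₂ : ∀ a b x y N → (a + x * N) + (b + y * N) ≡ a + b + (x + y) * N
  regroup₂ = solve-∀

-- A level l ≥ 1 at position p records (l - 1) N < β p, level 0 records nothing; a height h records β p ≤ h N.
record State : Set where
  constructor state
  field
    levels heights : Vec ℕ 25

  level height : Cell → ℕ
  level  = lookup levels
  height = lookup heights

open State

infix 6 _&_
data Pair : Set where
  _&_ : ℕ → ℕ → Pair

-- Positions are written 5 i + j. split p k distinguishes β p > k N from β p ≤ k N; cover D ps bounds D Σ β by the sum over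
-- the pairs in ps, after correcting the coverage by levels and heights; strip u v exhibits a functional as in the conclusion.
-- Position 5 = (1 , 0) is the heaviest outside row 0, so that its height caps all positions ≥ 5.
data Certificate : Set where
  split : ℕ → ℕ → Certificate → Certificate → Certificate
  cover : ℕ → List Pair → Certificate
  strip : ℕ → ℕ → Certificate

position : ℕ → Cell
position k = k mod 25

-- 10 = 5 + 5 is the trivial bound.
boundAtLevel : ℕ → ℕ
boundAtLevel zero    = 10
boundAtLevel (suc l) = 5 ∸ l

-- If one member of a pair is empty, the height of the other bounds the sum. A positive level rules
-- this case out, and the value 0 then removes it from the maximum in `pairBoundBy`.
if-empty : ℕ → ℕ → ℕ
if-empty zero    h = h
if-empty (suc _) h = 0

sumBound : State → Cell → Cell → ℕ
sumBound s x y = boundAtLevel (level s (x ⊞ y)) ⊓ (boundAtLevel (level s (x ⊟ y)) ⊓ boundAtLevel (level s (y ⊟ x)))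

-- A pair of equal positions bounds `2 β x` and so covers `x` twice. Such pairs yield half-integral
-- covers, and these are scaled to `D = 2`.
pairBoundBy : ∀ {x y : Cell} → State → Dec (x ≡ y) → ℕ
pairBoundBy {x} {y} s (yes _) = sumBound s x y
pairBoundBy {x} {y} s (no _)  = if-empty (level s x) (height s y) ⊔ if-empty (level s y) (height s x) ⊔ sumBound s x y

pairBound : State → Cell → Cell → ℕ
pairBound s x y = pairBoundBy s (x Fin.≟ y)

both-or-one : ∀ {N a b} l₁ l₂ {h₁ h₂ m} → (∀ {l} → l₁ ≡ suc l → 0 < a) → (∀ {l} → l₂ ≡ suc l → 0 < b) →
  a ≤ h₁ * N → b ≤ h₂ * N → (0 < a → 0 < b → a + b ≤ m * N) →
  a + b ≤ (if-empty l₁ h₂ ⊔ if-empty l₂ h₁ ⊔ m) * N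
both-or-one {N} {suc a} {suc b} l₁ l₂ {h₁} {h₂} {m} p₁ p₂ ≤h₁ ≤h₂ both =
  ℕ.≤-trans (both (s≤s z≤n) (s≤s z≤n)) (ℕ.*-monoˡ-≤ N (ℕ.m≤n⊔m (if-empty l₁ h₂ ⊔ if-empty l₂ h₁) m))
both-or-one {N} {zero}  {b}     (suc l) l₂ p₁ p₂ ≤h₁ ≤h₂ both = ⊥-elim (ℕ.n≮0 (p₁ refl))
both-or-one {N} {zero}  {b}     zero l₂ {h₂ = h₂} {m} p₁ p₂ ≤h₁ ≤h₂ both =
  ℕ.≤-trans ≤h₂ (ℕ.*-monoˡ-≤ N (ℕ.≤-trans (ℕ.m≤m⊔n h₂ _) (ℕ.m≤m⊔n _ m)))
both-or-one {N} {suc a} {zero}  l₁ (suc l) p₁ p₂ ≤h₁ ≤h₂ both = ⊥-elim (ℕ.n≮0 (p₂ refl))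
both-or-one {N} {suc a} {zero}  l₁ zero {h₁} {h₂} {m} p₁ p₂ ≤h₁ ≤h₂ both =
  ℕ.≤-trans (ℕ.≤-reflexive (ℕ.+-identityʳ (suc a))) (ℕ.≤-trans ≤h₁ (ℕ.*-monoˡ-≤ N (ℕ.≤-trans (ℕ.m≤n⊔m (if-empty l₁ h₂) h₁) (ℕ.m≤m⊔n _ m))))

coverage : List Pair → Vec ℕ 25
coverage []             = replicate 25 0
coverage (i & j ∷ ps) = updateAt (updateAt (coverage ps) (position i) suc) (position j) suc

cost : State → List Pair → ℕ
cost s []             = 0
cost s (i & j ∷ ps) = pairBound s (position i) (position j) + cost s ps

capEntry : ∀ {q : Cell} → Dec (5 ≤ toℕ q) → ℕ → ℕ → ℕ
capEntry (yes _) k h = h ⊓ k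
capEntry (no _)  k h = h

capTable : ℕ → Vec ℕ 25 → Cell → ℕ
capTable k hs q = capEntry {q} (5 ≤? toℕ q) k (lookup hs q)

capBy : ∀ {p : Cell} → Dec (p ≡ # 5) → ℕ → Vec ℕ 25 → Vec ℕ 25
capBy {p} (yes _) k hs = tabulate (capTable k hs)
capBy {p} (no _)  k hs = hs [ p ]≔ k

raiseLevel capHeight : State → Cell → ℕ → State
raiseLevel (state ls hs) p k = state (ls [ p ]≔ suc k) hs
capHeight  (state ls hs) p k = state ls (capBy (p Fin.≟ # 5) k hs)

OnStrip : F5 → F5 → Cell → Set
OnStrip u v p = u *₅ row p +₅ v *₅ col p ≡ # 1 ⊎ u *₅ row p +₅ v *₅ col p ≡ # 4

onStrip? : ∀ u v p → Dec (OnStrip u v p)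
onStrip? u v p = (_ Fin.≟ # 1) ⊎-dec (_ Fin.≟ # 4)

-- Levels enter the balance only as non-strict bounds. For `D > 0` strictness comes from
-- `30 * N < Σ-all β`; for `D = 0` the total does not occur and the costs themselves have to be
-- strictly smaller.
Covered : ℕ → ℕ → ℕ → Set
Covered zero      C L = C < L
Covered D@(suc _) C L = C ≤ 30 * D + L

covered? : ∀ D C L → Dec (Covered D C L)
covered? zero      C L = C <? L
covered? D@(suc _) C L = C ≤? 30 * D + L

check : State → Certificate → Bool
check s (split i k c d) = check (raiseLevel s (position i) k) c ∧ check (capHeight s (position i) k) d
check s (cover D ps)    = ⌊ covered? D (cost s ps + raise D (coverage ps) (heights s)) (lower D (coverage ps) (levels s)) ⌋
check s (strip i j)     = ⌊ Fin.all? (λ p → (height s p ≟ 0) ⊎-dec onStrip? (i mod 5) (j mod 5) p) ⌋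

-- Soundness of certificates

Triangle : Cell → Cell → Cell → Set
Triangle x y z = z ≡ x ⊞ y ⊎ z ≡ x ⊟ y ⊎ z ≡ y ⊟ x

-- In the application `N` is the size `5 ^ m` of a coset and `β p` five times the number of elements
-- in a cell. A full cell weighs `5 * N`, density `k / 5` becomes `k * N`, and the total 6 becomes
-- `30 * N`.
record Weighting (N : ℕ) (β : Cell → ℕ) : Set where
  field
    unit>0   : 0 < N
    bounded  : ∀ p → β p ≤ 5 * N
    triangle : ∀ {x y z} k → k ≤ 5 → Triangle x y z → 0 < β x → 0 < β y → k * N < β z → β x + β y ≤ (5 ∸ k) * N
    β₅-max   : ∀ p → 5 ≤ toℕ p → β p ≤ β (# 5)
    large    : 30 * N < Σ-all β

module _ {N : ℕ} {β : Cell → ℕ} (W : Weighting N β) where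
  open Weighting W

  record Valid (s : State) : Set where
    field
      level-valid  : ∀ p {l} → level s p ≡ suc l → l * N < β p
      height-valid : ∀ p → β p ≤ height s p * N

  open Valid

  -- Truncated subtraction gives level 0, which records nothing, the same bound 0 as level 1, which
  -- records only that `β p` is positive.
  level-valid-≤ : ∀ {s} → Valid s → ∀ p → (level s p ∸ 1) * N ≤ β p
  level-valid-≤ {s} val p = go (level s p) (level-valid val p)
    where
    go : ∀ m → (∀ {l} → m ≡ suc l → l * N < β p) → (m ∸ 1) * N ≤ β p
    go zero    _ = z≤n
    go (suc l) h = ℕ.<⇒≤ (h refl)

  raiseLevel-valid : ∀ {s} p k → Valid s → k * N < β p → Valid (raiseLevel s p k)
  raiseLevel-valid {s} p k val k< .height-valid = height-valid val
  raiseLevel-valid {s} p k val k< .level-valid q e = go (q Fin.≟ p) e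
    where
    go : ∀ {q l} → Dec (q ≡ p) → lookup (levels s [ p ]≔ suc k) q ≡ suc l → l * N < β q
    go (yes refl) e = subst (λ m → m * N < β p) (ℕ.suc-injective (trans (sym (Vec.lookup∘update p (levels s) (suc k))) e)) k<
    go (no q≢p)   e = level-valid val _ (trans (sym (Vec.lookup∘update′ q≢p (levels s) (suc k))) e)

  capHeight-valid : ∀ {s} p k → Valid s → β p ≤ k * N → Valid (capHeight s p k)
  capHeight-valid {s} p k val ≤k .level-valid = level-valid val
  capHeight-valid {s} p k val ≤k .height-valid q = go (p Fin.≟ # 5) (q Fin.≟ p)
    where
    capped : ∀ {q} (d : Dec (5 ≤ toℕ q)) → p ≡ # 5 → β q ≤ capEntry {q} d k (height s q) * N
    capped {q} (no _)    _    = height-valid val q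
    capped {q} (yes 5≤q) refl = subst (β q ≤_) (sym (ℕ.*-distribʳ-⊓ N (height s q) k))
      (ℕ.⊓-glb (height-valid val q) (ℕ.≤-trans (β₅-max q 5≤q) ≤k))
    go : ∀ {q} (d : Dec (p ≡ # 5)) → Dec (q ≡ p) → β q ≤ lookup (capBy d k (heights s)) q * N
    go {q} (yes p≡5) _    = subst (λ m → β q ≤ m * N) (sym (Vec.lookup∘tabulate (capTable k (heights s)) q)) (capped (5 ≤? toℕ q) p≡5)
    go (no _) (yes refl)  = subst (λ m → β p ≤ m * N) (sym (Vec.lookup∘update p (heights s) k)) ≤k
    go {q} (no _) (no q≢p) = subst (λ m → β q ≤ m * N) (sym (Vec.lookup∘update′ q≢p (heights s) k)) (height-valid val q)

  boundAtLevel-valid : ∀ l {x y z} → (∀ {l′} → l ≡ suc l′ → l′ * N < β z) → Triangle x y z → 0 < β x → 0 < β y →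
    β x + β y ≤ boundAtLevel l * N
  boundAtLevel-valid zero    {x} {y} _ _ _ _ = subst (β x + β y ≤_) (sym (ℕ.*-distribʳ-+ N 5 5)) (ℕ.+-mono-≤ (bounded x) (bounded y))
  boundAtLevel-valid (suc l) {z = z} l< t x>0 y>0 =
    triangle l (ℕ.<⇒≤ (ℕ.*-cancelʳ-< N l 5 (ℕ.<-≤-trans (l< refl) (bounded z)))) t x>0 y>0 (l< refl)

  module _ {s : State} (val : Valid s) where

    sumBound-valid : ∀ x y → 0 < β x → 0 < β y → β x + β y ≤ sumBound s x y * N
    sumBound-valid x y x>0 y>0 = meet (bound (x ⊞ y)) (bound (x ⊟ y) ⊓ bound (y ⊟ x)) (at (x ⊞ y) (inj₁ refl))
      (meet (bound (x ⊟ y)) (bound (y ⊟ x)) (at (x ⊟ y) (inj₂ (inj₁ refl))) (at (y ⊟ x) (inj₂ (inj₂ refl))))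
      where
      bound : Cell → ℕ
      bound z = boundAtLevel (level s z)
      at : ∀ z → Triangle x y z → β x + β y ≤ bound z * N
      at z t = boundAtLevel-valid (level s z) (level-valid val z) t x>0 y>0
      meet : ∀ {a} b c → a ≤ b * N → a ≤ c * N → a ≤ (b ⊓ c) * N
      meet b c ≤b ≤c = ℕ.≤-trans (ℕ.⊓-glb ≤b ≤c) (ℕ.≤-reflexive (sym (ℕ.*-distribʳ-⊓ N b c)))

    pairBound-valid : ∀ x y → β x + β y ≤ pairBound s x y * N
    pairBound-valid x y = go (x Fin.≟ y)
      where
      positive : ∀ p {l} → level s p ≡ suc l → 0 < β p
      positive p e = ℕ.≤-<-trans z≤n (level-valid val p e)
      go : ∀ {x y} (d : Dec (x ≡ y)) → β x + β y ≤ pairBoundBy s d * N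
      go {x} (yes refl)  = [ (λ x≡0 → ℕ.≤-trans (ℕ.≤-reflexive (cong₂ _+_ x≡0 x≡0)) z≤n)
                           , (λ x>0 → sumBound-valid x x x>0 x>0) ]′ (n≡0⊎n>0 (β x))
      go {x} {y} (no _) = both-or-one (level s x) (level s y) (positive x) (positive y)
        (height-valid val x) (height-valid val y) (sumBound-valid x y)

    cost-valid : ∀ ps → dot (coverage ps) β ≤ cost s ps * N
    cost-valid []             = ℕ.≤-reflexive (dot-zero 25 β)
    cost-valid (i & j ∷ ps) = begin
      dot (updateAt (updateAt (coverage ps) x suc) y suc) β   ≡⟨ dot-increment (updateAt (coverage ps) x suc) y β ⟩
      β y + dot (updateAt (coverage ps) x suc) β              ≡⟨ cong (β y +_) (dot-increment (coverage ps) x β) ⟩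
      β y + (β x + dot (coverage ps) β)                       ≡⟨ regroup (β x) (β y) _ ⟩
      (β x + β y) + dot (coverage ps) β                       ≤⟨ ℕ.+-mono-≤ (pairBound-valid x y) (cost-valid ps) ⟩
      pairBound s x y * N + cost s ps * N                     ≡⟨ sym (ℕ.*-distribʳ-+ N (pairBound s x y) (cost s ps)) ⟩
      (pairBound s x y + cost s ps) * N                       ∎
      where
      open ℕ.≤-Reasoning
      x = position i
      y = position j
      regroup : ∀ a b c → b + (a + c) ≡ (a + b) + c
      regroup = solve-∀

    cover-absurd : ∀ D ps → Covered D (cost s ps + raise D (coverage ps) (heights s)) (lower D (coverage ps) (levels s)) → ⊥
    cover-absurd D ps = go D balanced
      where
      balanced : ∀ {D} → D * Σ-all β + lower D (coverage ps) (levels s) * N ≤ (cost s ps + raise D (coverage ps) (heights s)) * N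
      balanced {D} = subst (D * Σ-all β + lower D (coverage ps) (levels s) * N ≤_) (sym (ℕ.*-distribʳ-+ N (cost s ps) _))
        (ℕ.≤-trans (balance D N (coverage ps) (levels s) (heights s) β (level-valid-≤ val) (height-valid val))
          (ℕ.+-monoˡ-≤ _ (cost-valid ps)))
      go : ∀ D {C L} → D * Σ-all β + L * N ≤ C * N → Covered D C L → ⊥
      go zero        bal C<L = ℕ.<⇒≱ (ℕ.*-monoˡ-< N {{>-nonZero unit>0}} C<L) bal
      go D@(suc _) {C} {L} bal C≤ = ℕ.<⇒≱ (begin-strict
        C * N                         ≤⟨ ℕ.*-monoˡ-≤ N C≤ ⟩
        (30 * D + L) * N              ≡⟨ regroup D L N ⟩
        D * (30 * N) + L * N          <⟨ ℕ.+-monoˡ-< (L * N) (ℕ.*-monoʳ-< D large) ⟩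
        D * Σ-all β + L * N           ∎) bal
        where
        open ℕ.≤-Reasoning
        regroup : ∀ D L N → (30 * D + L) * N ≡ D * (30 * N) + L * N
        regroup = solve-∀

  check-sound : ∀ s c → T (check s c) → Valid s → ∃ λ u → ∃ λ v → ∀ p → 0 < β p → OnStrip u v p
  check-sound s (split i k c d) ok val = go (k * N <? β (position i))
    where
    oks = Equivalence.to T-∧ ok
    go : Dec (k * N < β (position i)) → ∃ λ u → ∃ λ v → ∀ p → 0 < β p → OnStrip u v p
    go (yes k<) = check-sound _ c (proj₁ oks) (raiseLevel-valid (position i) k val k<)
    go (no k≮)  = check-sound _ d (proj₂ oks) (capHeight-valid (position i) k val (ℕ.≮⇒≥ k≮))
  check-sound s (cover D ps) ok val = ⊥-elim (cover-absurd val D ps (toWitness ok))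
  check-sound s (strip i j) ok val = i mod 5 , j mod 5 , λ p p>0 → onStrip p p>0 (toWitness ok p)
    where
    onStrip : ∀ p → 0 < β p → height s p ≡ 0 ⊎ OnStrip (i mod 5) (j mod 5) p → OnStrip (i mod 5) (j mod 5) p
    onStrip p p>0 (inj₁ h≡0) = ⊥-elim (ℕ.n≮0 (ℕ.<-≤-trans p>0 (subst (λ h → β p ≤ h * N) h≡0 (height-valid val p))))
    onStrip p p>0 (inj₂ on)  = on

-- The finite case distinction

initial : State
initial = state
  -- Levels are shifted by one: 4 stands for `β > 3 N` at (0 , 1), and 2 for `β > N` at (0 , 4).
  (0 ∷ 4 ∷ 0 ∷ 0 ∷ 2 ∷ replicate 20 0)
  (0 ∷ 5 ∷ 0 ∷ 0 ∷ 5 ∷ replicate 20 5)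

certificate : Certificate
certificate =
  -- The range of the heaviest cell is fixed before anything else, because its upper end caps all
  -- twenty cells outside row 0.
  split 5 4
   (split 6 0
    -- A local contradiction, without the total: cells 5 and 6 differ by (0 , 1), whose level allows
    -- them at most `2 N` together, but cell 5 alone exceeds `4 N`.
    (cover 0 (5 & 6 ∷ []))
    (split 24 0
     (split 9 0
      (cover 0 (5 & 9 ∷ []))
      (split 21 0
       (cover 0 (5 & 21 ∷ []))
       (split 10 0
        (cover 0 (5 & 10 ∷ []))
        (split 17 0
         (split 16 0
          (cover 2 (16 & 17 ∷ 16 & 17 ∷ 4 & 24 ∷ 4 & 24 ∷ 8 & 13 ∷ 8 & 13 ∷ 15 & 15 ∷ 5 & 11 ∷ 5 & 11 ∷ 5 & 19 ∷ 5 & 19 ∷ 1 & 14 ∷ 1 & 14 ∷ 5 & 12 ∷ 5 & 12 ∷ 5 & 18 ∷ 5 & 18 ∷ 5 & 22 ∷ 5 & 22 ∷ 1 & 7 ∷ 1 & 7 ∷ 1 & 20 ∷ 1 & 20 ∷ 1 & 23 ∷ 1 & 23 ∷ []))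
          (cover 2 (14 & 17 ∷ 14 & 17 ∷ 4 & 24 ∷ 4 & 24 ∷ 8 & 13 ∷ 8 & 13 ∷ 15 & 15 ∷ 5 & 12 ∷ 5 & 12 ∷ 5 & 18 ∷ 5 & 18 ∷ 5 & 22 ∷ 5 & 22 ∷ 1 & 7 ∷ 1 & 7 ∷ 1 & 20 ∷ 1 & 20 ∷ 1 & 23 ∷ 1 & 23 ∷ 5 & 11 ∷ 5 & 11 ∷ 5 & 19 ∷ 5 & 19 ∷ [])))
         (split 13 0
          (cover 2 (13 & 16 ∷ 13 & 16 ∷ 4 & 24 ∷ 4 & 24 ∷ 15 & 15 ∷ 1 & 12 ∷ 1 & 12 ∷ 1 & 14 ∷ 1 & 14 ∷ 5 & 8 ∷ 5 & 8 ∷ 5 & 18 ∷ 5 & 18 ∷ 5 & 22 ∷ 5 & 22 ∷ 1 & 7 ∷ 1 & 7 ∷ 1 & 20 ∷ 1 & 20 ∷ 1 & 23 ∷ 1 & 23 ∷ 5 & 11 ∷ 5 & 11 ∷ 5 & 19 ∷ 5 & 19 ∷ []))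
          (split 23 0
           (cover 2 (23 & 24 ∷ 23 & 24 ∷ 4 & 24 ∷ 4 & 24 ∷ 15 & 15 ∷ 1 & 8 ∷ 1 & 8 ∷ 1 & 22 ∷ 1 & 22 ∷ 5 & 12 ∷ 5 & 12 ∷ 5 & 18 ∷ 5 & 18 ∷ 14 & 16 ∷ 14 & 16 ∷ 1 & 7 ∷ 1 & 7 ∷ 1 & 20 ∷ 1 & 20 ∷ 5 & 11 ∷ 5 & 11 ∷ 5 & 19 ∷ 5 & 19 ∷ []))
           (cover 2 (4 & 24 ∷ 4 & 24 ∷ 15 & 15 ∷ 1 & 7 ∷ 1 & 7 ∷ 1 & 20 ∷ 1 & 20 ∷ 5 & 11 ∷ 5 & 11 ∷ 5 & 19 ∷ 5 & 19 ∷ 8 & 14 ∷ 8 & 14 ∷ 12 & 18 ∷ 12 & 18 ∷ 16 & 22 ∷ 16 & 22 ∷ []))))))))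
     (split 9 0
      (cover 0 (5 & 9 ∷ []))
      (split 10 0
       (cover 0 (5 & 10 ∷ []))
       (split 21 0
        (cover 0 (5 & 21 ∷ []))
        (split 15 0
         (split 12 0
          (split 13 0
           (cover 2 (12 & 13 ∷ 12 & 13 ∷ 15 & 15 ∷ 1 & 11 ∷ 1 & 11 ∷ 1 & 19 ∷ 1 & 19 ∷ 5 & 7 ∷ 5 & 7 ∷ 5 & 17 ∷ 5 & 17 ∷ 5 & 23 ∷ 5 & 23 ∷ 1 & 14 ∷ 1 & 14 ∷ 4 & 16 ∷ 4 & 16 ∷ 5 & 8 ∷ 5 & 8 ∷ 5 & 18 ∷ 5 & 18 ∷ 5 & 22 ∷ 5 & 22 ∷ 5 & 20 ∷ 5 & 20 ∷ []))
           (split 19 0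
            (cover 2 (12 & 19 ∷ 12 & 19 ∷ 15 & 15 ∷ 4 & 11 ∷ 4 & 11 ∷ 5 & 7 ∷ 5 & 7 ∷ 5 & 17 ∷ 5 & 17 ∷ 5 & 23 ∷ 5 & 23 ∷ 5 & 20 ∷ 5 & 20 ∷ 1 & 18 ∷ 1 & 18 ∷ 5 & 14 ∷ 5 & 14 ∷ 5 & 16 ∷ 5 & 16 ∷ 8 & 22 ∷ 8 & 22 ∷ []))
            (split 11 0
             (cover 2 (11 & 12 ∷ 15 & 15 ∷ 1 & 12 ∷ 4 & 18 ∷ 4 & 18 ∷ 5 & 16 ∷ 5 & 16 ∷ 8 & 22 ∷ 8 & 22 ∷ 1 & 11 ∷ 5 & 7 ∷ 5 & 7 ∷ 5 & 17 ∷ 5 & 17 ∷ 5 & 23 ∷ 5 & 23 ∷ 4 & 14 ∷ 4 & 14 ∷ 5 & 20 ∷ 5 & 20 ∷ []))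
             (cover 2 (15 & 15 ∷ 5 & 7 ∷ 5 & 7 ∷ 5 & 17 ∷ 5 & 17 ∷ 5 & 23 ∷ 5 & 23 ∷ 1 & 16 ∷ 1 & 16 ∷ 4 & 14 ∷ 4 & 14 ∷ 5 & 20 ∷ 5 & 20 ∷ 8 & 18 ∷ 8 & 18 ∷ 12 & 22 ∷ 12 & 22 ∷ [])))))
          (split 18 0
           (split 19 0
            (cover 2 (7 & 8 ∷ 18 & 19 ∷ 18 & 19 ∷ 7 & 22 ∷ 15 & 15 ∷ 1 & 11 ∷ 1 & 11 ∷ 4 & 16 ∷ 4 & 16 ∷ 5 & 20 ∷ 5 & 20 ∷ 5 & 13 ∷ 5 & 13 ∷ 5 & 17 ∷ 5 & 17 ∷ 5 & 23 ∷ 5 & 23 ∷ 5 & 14 ∷ 5 & 14 ∷ 8 & 22 ∷ []))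
            (split 17 0
             (cover 2 (7 & 8 ∷ 7 & 8 ∷ 17 & 18 ∷ 17 & 18 ∷ 15 & 15 ∷ 1 & 11 ∷ 1 & 11 ∷ 1 & 16 ∷ 1 & 16 ∷ 4 & 14 ∷ 4 & 14 ∷ 5 & 20 ∷ 5 & 20 ∷ 5 & 22 ∷ 5 & 22 ∷ 5 & 13 ∷ 5 & 13 ∷ 5 & 23 ∷ 5 & 23 ∷ []))
             (cover 2 (7 & 22 ∷ 7 & 22 ∷ 15 & 15 ∷ 1 & 11 ∷ 1 & 11 ∷ 1 & 16 ∷ 1 & 16 ∷ 4 & 14 ∷ 4 & 14 ∷ 5 & 20 ∷ 5 & 20 ∷ 8 & 18 ∷ 8 & 18 ∷ 5 & 13 ∷ 5 & 13 ∷ 5 & 23 ∷ 5 & 23 ∷ []))))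
           (split 22 0
            (split 23 0
             (cover 2 (22 & 23 ∷ 22 & 23 ∷ 15 & 15 ∷ 1 & 11 ∷ 1 & 11 ∷ 1 & 16 ∷ 1 & 16 ∷ 1 & 19 ∷ 1 & 19 ∷ 4 & 14 ∷ 5 & 20 ∷ 5 & 20 ∷ 4 & 7 ∷ 5 & 13 ∷ 5 & 13 ∷ 5 & 17 ∷ 5 & 17 ∷ 1 & 8 ∷ 1 & 8 ∷ 7 & 14 ∷ []))
             (cover 2 (7 & 22 ∷ 7 & 22 ∷ 15 & 15 ∷ 1 & 16 ∷ 1 & 16 ∷ 1 & 19 ∷ 1 & 19 ∷ 4 & 14 ∷ 4 & 14 ∷ 5 & 20 ∷ 5 & 20 ∷ 5 & 13 ∷ 5 & 13 ∷ 5 & 17 ∷ 5 & 17 ∷ 8 & 11 ∷ 8 & 11 ∷ [])))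
            (split 16 0
             (cover 1 (8 & 23 ∷ 15 & 16 ∷ 4 & 14 ∷ 5 & 20 ∷ 7 & 13 ∷ 1 & 17 ∷ 5 & 11 ∷ 5 & 19 ∷ []))
             (cover 2 (8 & 23 ∷ 8 & 13 ∷ 15 & 15 ∷ 1 & 11 ∷ 1 & 11 ∷ 1 & 19 ∷ 1 & 19 ∷ 4 & 14 ∷ 4 & 14 ∷ 5 & 20 ∷ 5 & 20 ∷ 7 & 17 ∷ 7 & 17 ∷ 13 & 23 ∷ []))))))
         (split 8 0
          (split 13 0
           (split 12 0
            (cover 1 (8 & 13 ∷ 1 & 11 ∷ 1 & 19 ∷ 5 & 7 ∷ 5 & 17 ∷ 5 & 23 ∷ 1 & 14 ∷ 4 & 16 ∷ 5 & 18 ∷ 5 & 22 ∷ 12 & 20 ∷ []))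
            (split 16 0
             (cover 1 (8 & 13 ∷ 1 & 7 ∷ 1 & 23 ∷ 17 & 20 ∷ 1 & 14 ∷ 4 & 16 ∷ 5 & 18 ∷ 5 & 22 ∷ 5 & 11 ∷ 5 & 19 ∷ []))
             (cover 1 (8 & 13 ∷ 1 & 23 ∷ 4 & 7 ∷ 11 & 19 ∷ 17 & 20 ∷ 1 & 14 ∷ 5 & 18 ∷ 5 & 22 ∷ []))))
           (split 23 0
            (split 16 0
             (cover 1 (8 & 23 ∷ 4 & 7 ∷ 17 & 20 ∷ 5 & 11 ∷ 5 & 19 ∷ 1 & 22 ∷ 5 & 12 ∷ 5 & 18 ∷ 14 & 16 ∷ []))
             (split 17 0
              (cover 1 (8 & 23 ∷ 4 & 7 ∷ 11 & 19 ∷ 17 & 20 ∷ 1 & 14 ∷ 5 & 12 ∷ 5 & 18 ∷ 5 & 22 ∷ []))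
              (cover 2 (8 & 23 ∷ 8 & 23 ∷ 4 & 7 ∷ 4 & 7 ∷ 11 & 19 ∷ 11 & 19 ∷ 1 & 22 ∷ 1 & 22 ∷ 5 & 12 ∷ 5 & 12 ∷ 14 & 14 ∷ 18 & 20 ∷ 18 & 20 ∷ []))))
            (split 17 0
             (split 16 0
              (cover 1 (16 & 17 ∷ 4 & 7 ∷ 5 & 11 ∷ 5 & 19 ∷ 1 & 14 ∷ 5 & 12 ∷ 5 & 18 ∷ 5 & 22 ∷ 8 & 20 ∷ []))
              (cover 2 (4 & 7 ∷ 4 & 7 ∷ 8 & 11 ∷ 8 & 11 ∷ 17 & 20 ∷ 17 & 20 ∷ 19 & 19 ∷ 1 & 14 ∷ 1 & 14 ∷ 5 & 12 ∷ 5 & 12 ∷ 5 & 18 ∷ 5 & 18 ∷ 5 & 22 ∷ 5 & 22 ∷ [])))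
             (split 7 0
              (split 11 0
               (cover 2 (7 & 8 ∷ 18 & 19 ∷ 11 & 18 ∷ 1 & 8 ∷ 4 & 22 ∷ 4 & 22 ∷ 5 & 12 ∷ 5 & 12 ∷ 1 & 7 ∷ 11 & 19 ∷ 5 & 16 ∷ 5 & 16 ∷ 14 & 20 ∷ 14 & 20 ∷ []))
               (cover 2 (7 & 8 ∷ 14 & 19 ∷ 16 & 19 ∷ 1 & 8 ∷ 4 & 22 ∷ 4 & 22 ∷ 5 & 12 ∷ 5 & 12 ∷ 14 & 16 ∷ 18 & 20 ∷ 18 & 20 ∷ 1 & 7 ∷ [])))
              (split 11 0
               (cover 2 (11 & 22 ∷ 11 & 22 ∷ 19 & 19 ∷ 1 & 12 ∷ 1 & 12 ∷ 4 & 18 ∷ 4 & 18 ∷ 5 & 16 ∷ 5 & 16 ∷ 8 & 8 ∷ 14 & 20 ∷ 14 & 20 ∷ []))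
               (split 19 0
                (cover 2 (19 & 19 ∷ 1 & 12 ∷ 1 & 12 ∷ 4 & 18 ∷ 4 & 18 ∷ 5 & 16 ∷ 5 & 16 ∷ 8 & 22 ∷ 8 & 22 ∷ 14 & 20 ∷ 14 & 20 ∷ []))
                -- Both (0 , 1) and (1 , 0) carry weight, so both coefficients of the functional
                -- must be 1 or 4. Up to a common sign this leaves `strip 1 1` and `strip 1 4`.
                (strip 1 1)))))))
          (split 12 0
           (split 11 0
            (cover 1 (11 & 12 ∷ 4 & 18 ∷ 5 & 16 ∷ 14 & 20 ∷ 19 & 22 ∷ 1 & 13 ∷ 5 & 7 ∷ 5 & 17 ∷ 5 & 23 ∷ []))
            (split 7 0
             (cover 1 (7 & 12 ∷ 4 & 22 ∷ 14 & 16 ∷ 18 & 20 ∷ 1 & 13 ∷ 1 & 19 ∷ 5 & 17 ∷ 5 & 23 ∷ []))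
             (split 13 0
              (cover 1 (12 & 13 ∷ 1 & 19 ∷ 5 & 23 ∷ 17 & 20 ∷ 1 & 14 ∷ 4 & 16 ∷ 5 & 18 ∷ 5 & 22 ∷ []))
              (split 17 0
               (cover 1 (12 & 17 ∷ 1 & 19 ∷ 5 & 23 ∷ 1 & 14 ∷ 4 & 16 ∷ 5 & 18 ∷ 20 & 22 ∷ []))
               (split 19 0
                (cover 2 (12 & 19 ∷ 1 & 19 ∷ 5 & 23 ∷ 5 & 23 ∷ 1 & 12 ∷ 4 & 18 ∷ 4 & 18 ∷ 5 & 16 ∷ 5 & 16 ∷ 14 & 20 ∷ 14 & 20 ∷ 22 & 22 ∷ []))
                (split 23 0
                 (cover 2 (12 & 23 ∷ 5 & 23 ∷ 1 & 22 ∷ 1 & 22 ∷ 5 & 12 ∷ 14 & 16 ∷ 14 & 16 ∷ 18 & 20 ∷ 18 & 20 ∷ []))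
                 (strip 1 1)))))))
           (split 14 0
            (split 13 0
             (cover 1 (13 & 14 ∷ 4 & 16 ∷ 5 & 18 ∷ 5 & 22 ∷ 1 & 17 ∷ 5 & 19 ∷ 7 & 23 ∷ 11 & 20 ∷ []))
             (split 17 0
              (cover 2 (14 & 17 ∷ 1 & 17 ∷ 5 & 19 ∷ 5 & 19 ∷ 7 & 23 ∷ 7 & 23 ∷ 11 & 20 ∷ 11 & 20 ∷ 1 & 14 ∷ 4 & 16 ∷ 4 & 16 ∷ 5 & 18 ∷ 5 & 18 ∷ 5 & 22 ∷ 5 & 22 ∷ []))
              (split 19 0
               (cover 2 (22 & 23 ∷ 22 & 23 ∷ 14 & 19 ∷ 14 & 19 ∷ 7 & 7 ∷ 11 & 20 ∷ 11 & 20 ∷ 1 & 18 ∷ 1 & 18 ∷ 5 & 16 ∷ 5 & 16 ∷ []))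
               (split 11 0
                (cover 2 (22 & 23 ∷ 4 & 18 ∷ 4 & 18 ∷ 5 & 16 ∷ 5 & 16 ∷ 11 & 22 ∷ 14 & 20 ∷ 7 & 7 ∷ 11 & 20 ∷ 14 & 23 ∷ []))
                (split 7 0
                 (cover 2 (4 & 22 ∷ 4 & 22 ∷ 14 & 23 ∷ 14 & 23 ∷ 16 & 16 ∷ 18 & 20 ∷ 18 & 20 ∷ 7 & 7 ∷ []))
                 (split 23 0
                  (cover 2 (14 & 23 ∷ 16 & 23 ∷ 1 & 22 ∷ 1 & 22 ∷ 5 & 18 ∷ 5 & 18 ∷ 14 & 16 ∷ []))
                  (strip 1 1)))))))
            (split 16 0
             (split 13 0
              (cover 2 (13 & 16 ∷ 4 & 16 ∷ 5 & 22 ∷ 5 & 22 ∷ 18 & 20 ∷ 18 & 20 ∷ 1 & 17 ∷ 1 & 17 ∷ 4 & 13 ∷ 5 & 11 ∷ 5 & 11 ∷ 5 & 19 ∷ 5 & 19 ∷ 7 & 23 ∷ 7 & 23 ∷ []))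
              (split 7 0
               (cover 2 (4 & 22 ∷ 4 & 22 ∷ 16 & 16 ∷ 18 & 20 ∷ 18 & 20 ∷ 1 & 17 ∷ 1 & 17 ∷ 5 & 11 ∷ 5 & 11 ∷ 5 & 19 ∷ 5 & 19 ∷ 7 & 23 ∷ 7 & 23 ∷ []))
               (split 11 0
                (cover 2 (22 & 23 ∷ 22 & 23 ∷ 11 & 16 ∷ 4 & 18 ∷ 4 & 18 ∷ 16 & 20 ∷ 1 & 17 ∷ 1 & 17 ∷ 5 & 19 ∷ 5 & 19 ∷ 11 & 20 ∷ []))
                (split 17 0
                 (cover 2 (4 & 17 ∷ 4 & 17 ∷ 5 & 19 ∷ 5 & 19 ∷ 23 & 23 ∷ 1 & 16 ∷ 1 & 16 ∷ 5 & 18 ∷ 5 & 18 ∷ 20 & 22 ∷ 20 & 22 ∷ []))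
                 (split 19 0
                  (cover 2 (22 & 23 ∷ 22 & 23 ∷ 16 & 19 ∷ 5 & 19 ∷ 1 & 18 ∷ 1 & 18 ∷ 5 & 16 ∷ []))
                  (split 23 0
                   (cover 1 (1 & 22 ∷ 5 & 18 ∷ 16 & 23 ∷ []))
                   (strip 1 1)))))))
             (split 18 0
              (cover 1 (13 & 18 ∷ 22 & 23 ∷ 1 & 19 ∷ 4 & 11 ∷ 5 & 17 ∷ 7 & 20 ∷ []))
              (split 22 0
               (cover 2 (1 & 23 ∷ 1 & 23 ∷ 4 & 7 ∷ 4 & 7 ∷ 5 & 13 ∷ 5 & 13 ∷ 11 & 11 ∷ 17 & 20 ∷ 17 & 20 ∷ 19 & 22 ∷ 19 & 22 ∷ []))
               (strip 1 4)))))))))))))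
   (split 5 3
    (split 6 0
     (cover 0 (5 & 6 ∷ []))
     (split 9 0
      (cover 0 (5 & 9 ∷ []))
      (split 10 0
       (cover 0 (5 & 10 ∷ []))
       (split 21 0
        (cover 0 (5 & 21 ∷ []))
        (split 24 0
         (split 12 0
          (split 13 0
           (split 17 0
            (split 18 0
             (split 19 0
              (split 14 0
               (cover 2 (12 & 19 ∷ 12 & 19 ∷ 13 & 18 ∷ 13 & 18 ∷ 14 & 17 ∷ 14 & 17 ∷ 22 & 23 ∷ 22 & 23 ∷ 4 & 24 ∷ 4 & 24 ∷ 11 & 16 ∷ 11 & 16 ∷ 15 & 15 ∷ 5 & 8 ∷ 5 & 8 ∷ 1 & 7 ∷ 1 & 7 ∷ 1 & 20 ∷ 1 & 20 ∷ []))
               (cover 2 (12 & 19 ∷ 12 & 19 ∷ 13 & 18 ∷ 13 & 18 ∷ 22 & 23 ∷ 22 & 23 ∷ 12 & 17 ∷ 12 & 17 ∷ 4 & 24 ∷ 4 & 24 ∷ 11 & 16 ∷ 11 & 16 ∷ 15 & 15 ∷ 5 & 8 ∷ 5 & 8 ∷ 1 & 7 ∷ 1 & 7 ∷ 1 & 20 ∷ 1 & 20 ∷ [])))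
              (cover 2 (13 & 18 ∷ 13 & 18 ∷ 22 & 23 ∷ 22 & 23 ∷ 12 & 17 ∷ 12 & 17 ∷ 4 & 24 ∷ 4 & 24 ∷ 11 & 16 ∷ 11 & 16 ∷ 15 & 15 ∷ 1 & 14 ∷ 1 & 14 ∷ 5 & 8 ∷ 5 & 8 ∷ 1 & 7 ∷ 1 & 7 ∷ 1 & 20 ∷ 1 & 20 ∷ [])))
             (split 14 0
              (cover 2 (12 & 13 ∷ 12 & 13 ∷ 14 & 17 ∷ 14 & 17 ∷ 22 & 23 ∷ 22 & 23 ∷ 4 & 24 ∷ 4 & 24 ∷ 15 & 15 ∷ 16 & 19 ∷ 16 & 19 ∷ 1 & 11 ∷ 1 & 11 ∷ 5 & 8 ∷ 5 & 8 ∷ 1 & 7 ∷ 1 & 7 ∷ 1 & 20 ∷ 1 & 20 ∷ []))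
              (cover 2 (12 & 13 ∷ 12 & 13 ∷ 22 & 23 ∷ 22 & 23 ∷ 12 & 17 ∷ 12 & 17 ∷ 4 & 24 ∷ 4 & 24 ∷ 15 & 15 ∷ 16 & 19 ∷ 16 & 19 ∷ 1 & 11 ∷ 1 & 11 ∷ 5 & 8 ∷ 5 & 8 ∷ 1 & 7 ∷ 1 & 7 ∷ 1 & 20 ∷ 1 & 20 ∷ []))))
            (split 19 0
             (split 18 0
              (cover 2 (12 & 19 ∷ 12 & 19 ∷ 13 & 18 ∷ 13 & 18 ∷ 22 & 23 ∷ 22 & 23 ∷ 4 & 24 ∷ 4 & 24 ∷ 11 & 16 ∷ 11 & 16 ∷ 15 & 15 ∷ 1 & 14 ∷ 1 & 14 ∷ 5 & 8 ∷ 5 & 8 ∷ 1 & 7 ∷ 1 & 7 ∷ 1 & 20 ∷ 1 & 20 ∷ []))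
              (cover 2 (12 & 13 ∷ 12 & 13 ∷ 12 & 19 ∷ 12 & 19 ∷ 22 & 23 ∷ 22 & 23 ∷ 4 & 24 ∷ 4 & 24 ∷ 11 & 16 ∷ 11 & 16 ∷ 15 & 15 ∷ 1 & 14 ∷ 1 & 14 ∷ 5 & 8 ∷ 5 & 8 ∷ 1 & 7 ∷ 1 & 7 ∷ 1 & 20 ∷ 1 & 20 ∷ [])))
             (cover 2 (12 & 13 ∷ 12 & 13 ∷ 7 & 22 ∷ 7 & 22 ∷ 4 & 24 ∷ 4 & 24 ∷ 11 & 16 ∷ 11 & 16 ∷ 15 & 15 ∷ 18 & 23 ∷ 18 & 23 ∷ 1 & 14 ∷ 1 & 14 ∷ 5 & 8 ∷ 5 & 8 ∷ 1 & 20 ∷ 1 & 20 ∷ []))))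
           (split 17 0
            (split 19 0
             (split 18 0
              (cover 2 (8 & 23 ∷ 8 & 23 ∷ 12 & 19 ∷ 12 & 19 ∷ 17 & 18 ∷ 17 & 18 ∷ 7 & 22 ∷ 4 & 24 ∷ 4 & 24 ∷ 11 & 16 ∷ 11 & 16 ∷ 15 & 15 ∷ 5 & 7 ∷ 1 & 14 ∷ 1 & 14 ∷ 5 & 22 ∷ 1 & 20 ∷ 1 & 20 ∷ []))
              (cover 2 (8 & 23 ∷ 8 & 23 ∷ 12 & 19 ∷ 12 & 19 ∷ 4 & 24 ∷ 4 & 24 ∷ 11 & 16 ∷ 11 & 16 ∷ 15 & 15 ∷ 17 & 22 ∷ 17 & 22 ∷ 5 & 7 ∷ 5 & 7 ∷ 1 & 14 ∷ 1 & 14 ∷ 1 & 20 ∷ 1 & 20 ∷ [])))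
             (cover 2 (8 & 23 ∷ 8 & 23 ∷ 7 & 22 ∷ 7 & 22 ∷ 12 & 17 ∷ 12 & 17 ∷ 4 & 24 ∷ 4 & 24 ∷ 15 & 15 ∷ 1 & 11 ∷ 1 & 11 ∷ 1 & 14 ∷ 1 & 14 ∷ 1 & 16 ∷ 1 & 16 ∷ 5 & 18 ∷ 5 & 18 ∷ 1 & 20 ∷ 1 & 20 ∷ [])))
            (split 19 0
             (cover 2 (7 & 8 ∷ 7 & 8 ∷ 12 & 19 ∷ 12 & 19 ∷ 22 & 23 ∷ 22 & 23 ∷ 4 & 24 ∷ 4 & 24 ∷ 15 & 15 ∷ 1 & 11 ∷ 1 & 11 ∷ 1 & 18 ∷ 1 & 18 ∷ 5 & 14 ∷ 5 & 14 ∷ 5 & 16 ∷ 5 & 16 ∷ 1 & 20 ∷ 1 & 20 ∷ []))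
             (split 23 0
              (cover 2 (7 & 22 ∷ 7 & 22 ∷ 4 & 24 ∷ 4 & 24 ∷ 11 & 16 ∷ 11 & 16 ∷ 12 & 23 ∷ 12 & 23 ∷ 15 & 15 ∷ 1 & 8 ∷ 1 & 8 ∷ 5 & 18 ∷ 5 & 18 ∷ 14 & 14 ∷ 1 & 20 ∷ 1 & 20 ∷ []))
              (cover 2 (5 & 24 ∷ 7 & 22 ∷ 7 & 22 ∷ 4 & 24 ∷ 11 & 16 ∷ 11 & 16 ∷ 15 & 15 ∷ 1 & 20 ∷ 1 & 20 ∷ 4 & 5 ∷ 8 & 14 ∷ 8 & 14 ∷ 12 & 18 ∷ 12 & 18 ∷ []))))))
          (split 18 0
           (split 13 0
            (split 8 0
             (split 17 0
              (cover 2 (17 & 18 ∷ 17 & 18 ∷ 22 & 23 ∷ 22 & 23 ∷ 4 & 24 ∷ 4 & 24 ∷ 8 & 13 ∷ 8 & 13 ∷ 14 & 19 ∷ 14 & 19 ∷ 15 & 15 ∷ 1 & 7 ∷ 1 & 7 ∷ 1 & 16 ∷ 1 & 16 ∷ 1 & 20 ∷ 1 & 20 ∷ 5 & 11 ∷ 5 & 11 ∷ []))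
              (cover 2 (8 & 23 ∷ 8 & 23 ∷ 13 & 18 ∷ 13 & 18 ∷ 7 & 22 ∷ 7 & 22 ∷ 4 & 24 ∷ 4 & 24 ∷ 15 & 15 ∷ 16 & 19 ∷ 16 & 19 ∷ 1 & 14 ∷ 1 & 14 ∷ 1 & 20 ∷ 1 & 20 ∷ 5 & 11 ∷ 5 & 11 ∷ [])))
             (cover 2 (13 & 18 ∷ 13 & 18 ∷ 16 & 17 ∷ 16 & 17 ∷ 22 & 23 ∷ 22 & 23 ∷ 4 & 24 ∷ 4 & 24 ∷ 14 & 19 ∷ 14 & 19 ∷ 15 & 15 ∷ 1 & 7 ∷ 1 & 7 ∷ 1 & 20 ∷ 1 & 20 ∷ 5 & 11 ∷ 5 & 11 ∷ [])))
            (split 17 0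
             (cover 2 (8 & 23 ∷ 8 & 23 ∷ 17 & 18 ∷ 17 & 18 ∷ 7 & 22 ∷ 7 & 22 ∷ 4 & 24 ∷ 4 & 24 ∷ 14 & 19 ∷ 14 & 19 ∷ 15 & 15 ∷ 1 & 16 ∷ 1 & 16 ∷ 1 & 20 ∷ 1 & 20 ∷ 5 & 11 ∷ 5 & 11 ∷ []))
             (cover 2 (8 & 23 ∷ 18 & 19 ∷ 5 & 24 ∷ 7 & 22 ∷ 7 & 22 ∷ 4 & 24 ∷ 11 & 16 ∷ 11 & 16 ∷ 14 & 19 ∷ 15 & 15 ∷ 18 & 23 ∷ 1 & 20 ∷ 1 & 20 ∷ 4 & 5 ∷ 8 & 14 ∷ []))))
           (split 16 0
            (split 17 0
             (cover 2 (16 & 17 ∷ 16 & 17 ∷ 22 & 23 ∷ 22 & 23 ∷ 4 & 24 ∷ 4 & 24 ∷ 8 & 13 ∷ 8 & 13 ∷ 14 & 19 ∷ 14 & 19 ∷ 15 & 15 ∷ 5 & 11 ∷ 5 & 11 ∷ 1 & 7 ∷ 1 & 7 ∷ 1 & 20 ∷ 1 & 20 ∷ []))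
             (cover 2 (7 & 8 ∷ 7 & 8 ∷ 22 & 23 ∷ 22 & 23 ∷ 13 & 16 ∷ 13 & 16 ∷ 4 & 24 ∷ 4 & 24 ∷ 14 & 19 ∷ 14 & 19 ∷ 15 & 15 ∷ 5 & 11 ∷ 5 & 11 ∷ 1 & 20 ∷ 1 & 20 ∷ [])))
            (cover 2 (8 & 23 ∷ 8 & 23 ∷ 13 & 14 ∷ 13 & 14 ∷ 4 & 24 ∷ 4 & 24 ∷ 15 & 15 ∷ 17 & 22 ∷ 17 & 22 ∷ 1 & 7 ∷ 1 & 7 ∷ 1 & 20 ∷ 1 & 20 ∷ 5 & 11 ∷ 5 & 11 ∷ 5 & 19 ∷ 5 & 19 ∷ [])))))
         (split 15 0
          (split 19 0
           (split 12 0
            (split 13 0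
             (split 18 0
              (split 17 0
               (split 16 0
                (cover 2 (8 & 23 ∷ 8 & 23 ∷ 12 & 19 ∷ 12 & 19 ∷ 13 & 18 ∷ 13 & 18 ∷ 16 & 17 ∷ 16 & 17 ∷ 7 & 22 ∷ 7 & 22 ∷ 15 & 15 ∷ 4 & 11 ∷ 4 & 11 ∷ 1 & 14 ∷ 1 & 14 ∷ 5 & 20 ∷ 5 & 20 ∷ []))
                (cover 1 (8 & 23 ∷ 13 & 18 ∷ 15 & 19 ∷ 7 & 22 ∷ 12 & 17 ∷ 4 & 11 ∷ 1 & 14 ∷ 5 & 20 ∷ [])))
               (cover 2 (8 & 23 ∷ 8 & 23 ∷ 12 & 19 ∷ 12 & 19 ∷ 13 & 18 ∷ 13 & 18 ∷ 7 & 22 ∷ 7 & 22 ∷ 15 & 15 ∷ 1 & 11 ∷ 1 & 11 ∷ 1 & 14 ∷ 1 & 14 ∷ 4 & 16 ∷ 4 & 16 ∷ 5 & 20 ∷ 5 & 20 ∷ [])))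
              (split 14 0
               (cover 2 (8 & 23 ∷ 8 & 23 ∷ 12 & 19 ∷ 12 & 19 ∷ 13 & 14 ∷ 13 & 14 ∷ 7 & 22 ∷ 7 & 22 ∷ 15 & 15 ∷ 1 & 11 ∷ 1 & 11 ∷ 4 & 16 ∷ 4 & 16 ∷ 1 & 17 ∷ 1 & 17 ∷ 5 & 20 ∷ 5 & 20 ∷ []))
               (cover 1 (8 & 23 ∷ 12 & 13 ∷ 15 & 19 ∷ 7 & 22 ∷ 1 & 11 ∷ 4 & 17 ∷ 1 & 16 ∷ 5 & 20 ∷ []))))
             (split 17 0
              (split 18 0
               (cover 2 (8 & 23 ∷ 8 & 23 ∷ 12 & 19 ∷ 12 & 19 ∷ 17 & 18 ∷ 17 & 18 ∷ 15 & 15 ∷ 1 & 11 ∷ 1 & 11 ∷ 5 & 7 ∷ 5 & 7 ∷ 1 & 16 ∷ 1 & 16 ∷ 4 & 14 ∷ 4 & 14 ∷ 5 & 20 ∷ 5 & 20 ∷ 5 & 22 ∷ 5 & 22 ∷ []))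
               (cover 1 (8 & 23 ∷ 15 & 19 ∷ 12 & 17 ∷ 1 & 11 ∷ 5 & 7 ∷ 1 & 16 ∷ 4 & 14 ∷ 5 & 20 ∷ 5 & 22 ∷ [])))
              (cover 2 (8 & 23 ∷ 8 & 23 ∷ 12 & 19 ∷ 12 & 19 ∷ 7 & 22 ∷ 7 & 22 ∷ 15 & 15 ∷ 1 & 11 ∷ 1 & 11 ∷ 1 & 16 ∷ 1 & 16 ∷ 4 & 14 ∷ 4 & 14 ∷ 5 & 20 ∷ 5 & 20 ∷ 1 & 18 ∷ 1 & 18 ∷ []))))
            (split 18 0
             (split 17 0
              (split 16 0
               (cover 2 (8 & 23 ∷ 8 & 23 ∷ 15 & 16 ∷ 15 & 19 ∷ 16 & 17 ∷ 17 & 18 ∷ 18 & 19 ∷ 7 & 22 ∷ 7 & 22 ∷ 1 & 11 ∷ 1 & 11 ∷ 5 & 20 ∷ 5 & 20 ∷ 4 & 13 ∷ 4 & 13 ∷ 1 & 14 ∷ 1 & 14 ∷ []))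
               (cover 1 (8 & 23 ∷ 15 & 19 ∷ 17 & 18 ∷ 7 & 22 ∷ 1 & 11 ∷ 4 & 14 ∷ 5 & 20 ∷ 1 & 13 ∷ [])))
              (cover 2 (8 & 23 ∷ 8 & 23 ∷ 18 & 19 ∷ 18 & 19 ∷ 7 & 22 ∷ 7 & 22 ∷ 15 & 15 ∷ 1 & 11 ∷ 1 & 11 ∷ 1 & 16 ∷ 1 & 16 ∷ 4 & 14 ∷ 4 & 14 ∷ 5 & 20 ∷ 5 & 20 ∷ 1 & 13 ∷ 1 & 13 ∷ [])))
             (split 16 0
              (cover 2 (8 & 23 ∷ 8 & 23 ∷ 13 & 14 ∷ 15 & 16 ∷ 15 & 19 ∷ 7 & 22 ∷ 7 & 22 ∷ 16 & 19 ∷ 1 & 11 ∷ 1 & 11 ∷ 4 & 14 ∷ 5 & 20 ∷ 5 & 20 ∷ 1 & 17 ∷ 1 & 17 ∷ 4 & 13 ∷ []))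
              (cover 1 (15 & 19 ∷ 22 & 23 ∷ 8 & 13 ∷ 1 & 11 ∷ 4 & 14 ∷ 5 & 20 ∷ 7 & 17 ∷ [])))))
           (split 11 0
            (split 12 0
             (split 13 0
              (split 18 0
               (cover 2 (8 & 23 ∷ 8 & 23 ∷ 11 & 12 ∷ 11 & 12 ∷ 13 & 18 ∷ 13 & 18 ∷ 7 & 22 ∷ 7 & 22 ∷ 15 & 15 ∷ 4 & 17 ∷ 4 & 17 ∷ 1 & 14 ∷ 1 & 14 ∷ 1 & 16 ∷ 1 & 16 ∷ 5 & 20 ∷ 5 & 20 ∷ []))
               (cover 1 (8 & 23 ∷ 11 & 15 ∷ 12 & 13 ∷ 7 & 22 ∷ 4 & 17 ∷ 1 & 14 ∷ 1 & 16 ∷ 5 & 20 ∷ [])))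
              (cover 2 (7 & 8 ∷ 7 & 8 ∷ 11 & 12 ∷ 11 & 12 ∷ 14 & 17 ∷ 14 & 17 ∷ 22 & 23 ∷ 22 & 23 ∷ 15 & 15 ∷ 4 & 18 ∷ 4 & 18 ∷ 1 & 16 ∷ 1 & 16 ∷ 5 & 20 ∷ 5 & 20 ∷ [])))
             (split 16 0
              (cover 2 (8 & 23 ∷ 8 & 23 ∷ 11 & 15 ∷ 13 & 14 ∷ 13 & 14 ∷ 15 & 16 ∷ 7 & 22 ∷ 7 & 22 ∷ 11 & 16 ∷ 4 & 18 ∷ 4 & 18 ∷ 5 & 20 ∷ 5 & 20 ∷ 1 & 17 ∷ 1 & 17 ∷ []))
              (split 18 0
               (cover 1 (8 & 23 ∷ 11 & 15 ∷ 13 & 14 ∷ 7 & 22 ∷ 4 & 18 ∷ 5 & 20 ∷ 1 & 17 ∷ []))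
               (cover 2 (11 & 15 ∷ 22 & 23 ∷ 22 & 23 ∷ 8 & 13 ∷ 8 & 13 ∷ 1 & 15 ∷ 1 & 11 ∷ 4 & 14 ∷ 4 & 14 ∷ 5 & 20 ∷ 5 & 20 ∷ 7 & 17 ∷ 7 & 17 ∷ [])))))
            (split 13 0
             (split 12 0
              (cover 2 (8 & 23 ∷ 8 & 23 ∷ 12 & 13 ∷ 12 & 13 ∷ 7 & 22 ∷ 7 & 22 ∷ 15 & 15 ∷ 4 & 17 ∷ 4 & 17 ∷ 1 & 14 ∷ 1 & 14 ∷ 1 & 18 ∷ 1 & 18 ∷ 1 & 16 ∷ 1 & 16 ∷ 5 & 20 ∷ 5 & 20 ∷ []))
              (split 18 0
               (cover 2 (8 & 23 ∷ 8 & 23 ∷ 13 & 18 ∷ 13 & 18 ∷ 7 & 22 ∷ 7 & 22 ∷ 15 & 15 ∷ 1 & 14 ∷ 1 & 14 ∷ 4 & 16 ∷ 4 & 16 ∷ 5 & 20 ∷ 5 & 20 ∷ 1 & 17 ∷ 1 & 17 ∷ []))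
               (cover 2 (22 & 23 ∷ 22 & 23 ∷ 8 & 13 ∷ 8 & 13 ∷ 15 & 15 ∷ 1 & 14 ∷ 1 & 14 ∷ 4 & 16 ∷ 4 & 16 ∷ 5 & 20 ∷ 5 & 20 ∷ 7 & 17 ∷ 7 & 17 ∷ []))))
             (split 17 0
              (cover 2 (8 & 23 ∷ 8 & 23 ∷ 14 & 17 ∷ 14 & 17 ∷ 7 & 22 ∷ 7 & 22 ∷ 15 & 15 ∷ 1 & 16 ∷ 1 & 16 ∷ 5 & 20 ∷ 5 & 20 ∷ 1 & 18 ∷ 1 & 18 ∷ 4 & 12 ∷ 4 & 12 ∷ []))
              (cover 2 (22 & 23 ∷ 22 & 23 ∷ 7 & 12 ∷ 7 & 12 ∷ 15 & 15 ∷ 1 & 16 ∷ 1 & 16 ∷ 4 & 14 ∷ 4 & 14 ∷ 5 & 20 ∷ 5 & 20 ∷ 8 & 18 ∷ 8 & 18 ∷ []))))))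
          (split 8 0
           (split 7 0
            (split 20 0
             (split 12 0
              (split 13 0
               (split 17 0
                (split 18 0
                 (cover 1 (7 & 8 ∷ 12 & 13 ∷ 17 & 18 ∷ 1 & 11 ∷ 1 & 19 ∷ 5 & 23 ∷ 1 & 14 ∷ 4 & 16 ∷ 20 & 22 ∷ []))
                 (cover 1 (7 & 8 ∷ 12 & 17 ∷ 8 & 13 ∷ 1 & 11 ∷ 1 & 19 ∷ 5 & 23 ∷ 1 & 14 ∷ 4 & 16 ∷ 20 & 22 ∷ [])))
                (cover 1 (7 & 8 ∷ 12 & 13 ∷ 11 & 16 ∷ 4 & 22 ∷ 18 & 20 ∷ 1 & 19 ∷ 5 & 23 ∷ 1 & 14 ∷ [])))
               (split 17 0
                (cover 1 (7 & 8 ∷ 12 & 17 ∷ 11 & 16 ∷ 4 & 22 ∷ 18 & 20 ∷ 1 & 19 ∷ 5 & 23 ∷ 1 & 14 ∷ []))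
                (cover 1 (7 & 8 ∷ 11 & 16 ∷ 14 & 19 ∷ 4 & 22 ∷ 5 & 12 ∷ 18 & 20 ∷ 1 & 23 ∷ []))))
              (split 18 0
               (split 13 0
                (cover 2 (7 & 8 ∷ 7 & 8 ∷ 13 & 18 ∷ 13 & 18 ∷ 11 & 16 ∷ 1 & 23 ∷ 1 & 23 ∷ 17 & 20 ∷ 17 & 20 ∷ 1 & 14 ∷ 1 & 14 ∷ 4 & 16 ∷ 5 & 22 ∷ 5 & 22 ∷ 1 & 19 ∷ 1 & 19 ∷ 4 & 11 ∷ []))
                (cover 1 (7 & 8 ∷ 11 & 16 ∷ 14 & 19 ∷ 4 & 22 ∷ 18 & 20 ∷ 1 & 23 ∷ 5 & 17 ∷ [])))
               (cover 1 (7 & 8 ∷ 11 & 16 ∷ 14 & 19 ∷ 4 & 22 ∷ 1 & 23 ∷ 5 & 13 ∷ 17 & 20 ∷ []))))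
             (split 12 0
              (split 13 0
               (cover 1 (7 & 8 ∷ 12 & 13 ∷ 18 & 19 ∷ 22 & 23 ∷ 1 & 11 ∷ 5 & 17 ∷ 1 & 14 ∷ 4 & 16 ∷ []))
               (cover 1 (7 & 8 ∷ 14 & 17 ∷ 18 & 19 ∷ 11 & 16 ∷ 4 & 22 ∷ 5 & 12 ∷ 1 & 23 ∷ [])))
              (cover 1 (7 & 8 ∷ 16 & 17 ∷ 11 & 18 ∷ 14 & 19 ∷ 4 & 22 ∷ 1 & 23 ∷ 5 & 13 ∷ []))))
            (split 13 0
             (split 17 0
              (split 18 0
               (cover 2 (17 & 18 ∷ 17 & 18 ∷ 8 & 13 ∷ 8 & 13 ∷ 11 & 16 ∷ 1 & 23 ∷ 1 & 23 ∷ 1 & 14 ∷ 1 & 14 ∷ 4 & 16 ∷ 5 & 22 ∷ 5 & 22 ∷ 12 & 20 ∷ 12 & 20 ∷ 1 & 19 ∷ 1 & 19 ∷ 4 & 11 ∷ []))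
               (cover 1 (8 & 13 ∷ 11 & 16 ∷ 14 & 19 ∷ 1 & 23 ∷ 17 & 20 ∷ 4 & 12 ∷ 5 & 22 ∷ [])))
              (cover 1 (18 & 19 ∷ 8 & 13 ∷ 11 & 16 ∷ 1 & 23 ∷ 4 & 14 ∷ 5 & 22 ∷ 12 & 20 ∷ [])))
             (split 23 0
              (split 17 0
               (cover 1 (8 & 23 ∷ 18 & 19 ∷ 11 & 16 ∷ 17 & 20 ∷ 1 & 14 ∷ 4 & 12 ∷ 5 & 22 ∷ []))
               (cover 2 (8 & 23 ∷ 11 & 16 ∷ 11 & 16 ∷ 14 & 19 ∷ 14 & 19 ∷ 1 & 23 ∷ 1 & 8 ∷ 4 & 22 ∷ 4 & 22 ∷ 5 & 12 ∷ 5 & 12 ∷ 18 & 20 ∷ 18 & 20 ∷ [])))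
              (split 17 0
               (split 18 0
                (cover 1 (17 & 18 ∷ 1 & 14 ∷ 1 & 16 ∷ 5 & 12 ∷ 5 & 22 ∷ 8 & 20 ∷ 1 & 19 ∷ 4 & 11 ∷ []))
                (cover 1 (17 & 22 ∷ 11 & 19 ∷ 1 & 14 ∷ 4 & 16 ∷ 5 & 12 ∷ 8 & 20 ∷ [])))
               (split 11 0
                (cover 2 (11 & 22 ∷ 11 & 22 ∷ 19 & 19 ∷ 1 & 12 ∷ 1 & 12 ∷ 4 & 18 ∷ 4 & 18 ∷ 5 & 16 ∷ 5 & 16 ∷ 8 & 8 ∷ 14 & 20 ∷ 14 & 20 ∷ []))
                (split 19 0
                 (cover 2 (19 & 19 ∷ 1 & 12 ∷ 1 & 12 ∷ 4 & 18 ∷ 4 & 18 ∷ 5 & 16 ∷ 5 & 16 ∷ 8 & 22 ∷ 8 & 22 ∷ 14 & 20 ∷ 14 & 20 ∷ []))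
                 (strip 1 1)))))))
           (split 12 0
            (split 7 0
             (split 18 0
              (split 17 0
               (cover 1 (17 & 18 ∷ 7 & 12 ∷ 11 & 16 ∷ 4 & 22 ∷ 1 & 19 ∷ 5 & 23 ∷ 13 & 20 ∷ 1 & 14 ∷ []))
               (cover 1 (13 & 16 ∷ 7 & 12 ∷ 14 & 19 ∷ 4 & 22 ∷ 18 & 20 ∷ 1 & 11 ∷ 5 & 23 ∷ [])))
              (cover 1 (16 & 17 ∷ 7 & 12 ∷ 14 & 19 ∷ 4 & 22 ∷ 1 & 11 ∷ 5 & 23 ∷ 13 & 20 ∷ [])))
             (split 11 0
              (cover 1 (11 & 12 ∷ 22 & 23 ∷ 4 & 18 ∷ 5 & 16 ∷ 14 & 20 ∷ 1 & 13 ∷ 1 & 19 ∷ 5 & 17 ∷ []))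
              (split 13 0
               (cover 1 (12 & 13 ∷ 22 & 23 ∷ 1 & 19 ∷ 17 & 20 ∷ 1 & 14 ∷ 4 & 16 ∷ 5 & 18 ∷ []))
               (split 17 0
                (cover 1 (12 & 17 ∷ 1 & 19 ∷ 5 & 23 ∷ 1 & 14 ∷ 1 & 18 ∷ 4 & 16 ∷ 20 & 22 ∷ []))
                (split 19 0
                 (cover 2 (12 & 19 ∷ 22 & 23 ∷ 22 & 23 ∷ 1 & 19 ∷ 1 & 12 ∷ 4 & 18 ∷ 4 & 18 ∷ 5 & 16 ∷ 5 & 16 ∷ 14 & 20 ∷ 14 & 20 ∷ []))
                 (split 23 0
                  (cover 1 (12 & 23 ∷ 1 & 22 ∷ 5 & 18 ∷ 14 & 16 ∷ []))
                  (strip 1 1)))))))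
            (split 14 0
             (split 20 0
              (split 16 0
               (split 19 0
                (cover 1 (7 & 22 ∷ 14 & 19 ∷ 18 & 23 ∷ 1 & 17 ∷ 4 & 13 ∷ 11 & 20 ∷ 5 & 16 ∷ []))
                (split 22 0
                 (split 7 0
                  (cover 2 (13 & 14 ∷ 13 & 14 ∷ 16 & 17 ∷ 16 & 17 ∷ 7 & 22 ∷ 4 & 22 ∷ 18 & 20 ∷ 18 & 20 ∷ 5 & 11 ∷ 5 & 11 ∷ 1 & 23 ∷ 1 & 23 ∷ 4 & 7 ∷ []))
                  (split 11 0
                   (cover 1 (22 & 23 ∷ 11 & 16 ∷ 4 & 18 ∷ 14 & 20 ∷ 1 & 17 ∷ 5 & 13 ∷ []))
                   (split 13 0
                    (cover 1 (13 & 14 ∷ 4 & 16 ∷ 5 & 22 ∷ 18 & 20 ∷ 1 & 17 ∷ 1 & 23 ∷ []))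
                    (split 17 0
                     (cover 1 (14 & 17 ∷ 4 & 16 ∷ 5 & 18 ∷ 20 & 22 ∷ 1 & 23 ∷ []))
                     (split 23 0
                      (cover 1 (4 & 23 ∷ 1 & 22 ∷ 5 & 18 ∷ 14 & 16 ∷ []))
                      (strip 1 1))))))
                 (split 7 0
                  (cover 2 (14 & 23 ∷ 14 & 23 ∷ 16 & 16 ∷ 18 & 20 ∷ 18 & 20 ∷ 1 & 17 ∷ 1 & 17 ∷ 4 & 13 ∷ 4 & 13 ∷ 7 & 7 ∷ 5 & 11 ∷ 5 & 11 ∷ []))
                  (cover 1 (14 & 17 ∷ 11 & 16 ∷ 18 & 23 ∷ 1 & 13 ∷ [])))))
               (split 23 0
                (split 18 0
                 (cover 1 (13 & 14 ∷ 18 & 23 ∷ 1 & 17 ∷ 5 & 19 ∷ 4 & 11 ∷ 7 & 20 ∷ 1 & 22 ∷ []))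
                 (cover 1 (14 & 17 ∷ 4 & 13 ∷ 5 & 19 ∷ 7 & 23 ∷ 11 & 20 ∷ 1 & 22 ∷ [])))
                (cover 1 (7 & 22 ∷ 11 & 18 ∷ 14 & 19 ∷ 1 & 17 ∷ 4 & 13 ∷ []))))
              (cover 1 (7 & 22 ∷ 11 & 16 ∷ 14 & 19 ∷ 18 & 23 ∷ 1 & 17 ∷ 4 & 13 ∷ [])))
             (split 16 0
              (split 19 0
               (cover 1 (7 & 22 ∷ 16 & 19 ∷ 18 & 23 ∷ 1 & 17 ∷ 4 & 13 ∷ 5 & 11 ∷ []))
               (cover 1 (7 & 22 ∷ 11 & 16 ∷ 18 & 23 ∷ 1 & 17 ∷ 4 & 13 ∷ [])))
              (split 18 0
               (cover 1 (17 & 18 ∷ 22 & 23 ∷ 1 & 19 ∷ 4 & 11 ∷ 5 & 13 ∷ 7 & 20 ∷ []))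
               (split 22 0
                (cover 2 (1 & 23 ∷ 1 & 23 ∷ 4 & 7 ∷ 4 & 7 ∷ 5 & 13 ∷ 5 & 13 ∷ 11 & 11 ∷ 17 & 20 ∷ 17 & 20 ∷ 19 & 22 ∷ 19 & 22 ∷ []))
                (strip 1 4)))))))))))))
    -- Now the bound `2 N` on cells 5 and 6 equals what the level of 5 gives for 5 alone, so a cover
    -- with `D = 0` cannot close the case of a nonempty cell 6. The cap `3 N` outside row 0 closes
    -- it through the total.
    (split 5 2
     (split 6 0
      (split 24 0
       (split 9 0
        (split 21 0
         (cover 1 (5 & 9 ∷ 5 & 21 ∷ 8 & 23 ∷ 14 & 17 ∷ 18 & 19 ∷ 1 & 6 ∷ 4 & 24 ∷ 5 & 10 ∷ 7 & 12 ∷ 11 & 16 ∷ 13 & 22 ∷ 15 & 20 ∷ []))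
         (cover 1 (5 & 9 ∷ 8 & 23 ∷ 14 & 17 ∷ 18 & 19 ∷ 1 & 6 ∷ 4 & 24 ∷ 5 & 10 ∷ 7 & 12 ∷ 11 & 16 ∷ 13 & 22 ∷ 15 & 20 ∷ [])))
        (split 21 0
         (cover 1 (5 & 21 ∷ 8 & 23 ∷ 14 & 17 ∷ 18 & 19 ∷ 1 & 6 ∷ 4 & 24 ∷ 5 & 10 ∷ 7 & 12 ∷ 11 & 16 ∷ 13 & 22 ∷ 15 & 20 ∷ []))
         (cover 1 (8 & 23 ∷ 14 & 17 ∷ 18 & 19 ∷ 1 & 6 ∷ 4 & 24 ∷ 5 & 10 ∷ 7 & 12 ∷ 11 & 16 ∷ 13 & 22 ∷ 15 & 20 ∷ []))))
       (split 9 0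
        (split 21 0
         (cover 1 (5 & 9 ∷ 5 & 21 ∷ 8 & 23 ∷ 14 & 17 ∷ 18 & 19 ∷ 1 & 6 ∷ 4 & 6 ∷ 5 & 10 ∷ 7 & 12 ∷ 11 & 16 ∷ 13 & 22 ∷ 15 & 20 ∷ []))
         (cover 1 (5 & 9 ∷ 8 & 23 ∷ 14 & 17 ∷ 18 & 19 ∷ 1 & 6 ∷ 4 & 6 ∷ 5 & 10 ∷ 7 & 12 ∷ 11 & 16 ∷ 13 & 22 ∷ 15 & 20 ∷ [])))
        (split 21 0
         (cover 1 (5 & 21 ∷ 8 & 23 ∷ 14 & 17 ∷ 18 & 19 ∷ 1 & 6 ∷ 4 & 6 ∷ 5 & 10 ∷ 7 & 12 ∷ 11 & 16 ∷ 13 & 22 ∷ 15 & 20 ∷ []))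
         (cover 1 (8 & 23 ∷ 14 & 17 ∷ 18 & 19 ∷ 1 & 6 ∷ 4 & 6 ∷ 5 & 10 ∷ 7 & 12 ∷ 11 & 16 ∷ 13 & 22 ∷ 15 & 20 ∷ [])))))
      (split 9 0
       (split 24 0
        (split 21 0
         (cover 1 (5 & 21 ∷ 8 & 23 ∷ 14 & 17 ∷ 18 & 19 ∷ 1 & 9 ∷ 4 & 24 ∷ 5 & 10 ∷ 7 & 12 ∷ 11 & 16 ∷ 13 & 22 ∷ 15 & 20 ∷ []))
         (cover 1 (8 & 23 ∷ 14 & 17 ∷ 18 & 19 ∷ 1 & 9 ∷ 4 & 24 ∷ 5 & 10 ∷ 7 & 12 ∷ 11 & 16 ∷ 13 & 22 ∷ 15 & 20 ∷ [])))
        (split 21 0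
         (cover 1 (5 & 21 ∷ 7 & 8 ∷ 12 & 19 ∷ 13 & 18 ∷ 14 & 17 ∷ 22 & 23 ∷ 1 & 9 ∷ 4 & 9 ∷ 5 & 10 ∷ 11 & 16 ∷ 15 & 20 ∷ []))
         (cover 1 (7 & 8 ∷ 12 & 19 ∷ 13 & 18 ∷ 14 & 17 ∷ 22 & 23 ∷ 1 & 9 ∷ 4 & 9 ∷ 5 & 10 ∷ 11 & 16 ∷ 15 & 20 ∷ []))))
       (split 15 0
        (split 24 0
         (split 21 0
          (cover 1 (8 & 23 ∷ 14 & 17 ∷ 18 & 19 ∷ 1 & 21 ∷ 4 & 24 ∷ 5 & 10 ∷ 7 & 12 ∷ 11 & 16 ∷ 13 & 22 ∷ 15 & 20 ∷ []))
          (split 19 0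
           (cover 1 (7 & 8 ∷ 13 & 18 ∷ 14 & 17 ∷ 15 & 19 ∷ 22 & 23 ∷ 4 & 24 ∷ 5 & 10 ∷ 11 & 16 ∷ 1 & 12 ∷ 1 & 20 ∷ []))
           (cover 1 (7 & 8 ∷ 11 & 12 ∷ 13 & 14 ∷ 15 & 16 ∷ 17 & 18 ∷ 22 & 23 ∷ 4 & 24 ∷ 5 & 10 ∷ 1 & 20 ∷ []))))
         (split 21 0
          (split 16 0
           (cover 1 (5 & 21 ∷ 8 & 23 ∷ 10 & 11 ∷ 14 & 17 ∷ 15 & 16 ∷ 18 & 19 ∷ 1 & 21 ∷ 7 & 12 ∷ 13 & 22 ∷ 4 & 20 ∷ []))
           (cover 1 (8 & 23 ∷ 11 & 15 ∷ 14 & 17 ∷ 18 & 19 ∷ 1 & 21 ∷ 5 & 10 ∷ 7 & 12 ∷ 13 & 22 ∷ 4 & 20 ∷ [])))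
          (split 19 0
           (split 18 0
            (cover 1 (8 & 23 ∷ 16 & 17 ∷ 18 & 19 ∷ 5 & 10 ∷ 7 & 12 ∷ 13 & 22 ∷ 15 & 20 ∷ 1 & 11 ∷ 4 & 14 ∷ []))
            (cover 2 (7 & 8 ∷ 8 & 23 ∷ 11 & 12 ∷ 13 & 14 ∷ 14 & 17 ∷ 16 & 17 ∷ 22 & 23 ∷ 5 & 10 ∷ 5 & 10 ∷ 7 & 12 ∷ 13 & 22 ∷ 15 & 20 ∷ 15 & 20 ∷ 1 & 11 ∷ 1 & 19 ∷ 4 & 16 ∷ 4 & 19 ∷ [])))
           (cover 2 (7 & 8 ∷ 8 & 23 ∷ 11 & 12 ∷ 13 & 18 ∷ 14 & 17 ∷ 17 & 18 ∷ 22 & 23 ∷ 5 & 10 ∷ 5 & 10 ∷ 7 & 12 ∷ 13 & 22 ∷ 15 & 20 ∷ 15 & 20 ∷ 1 & 11 ∷ 1 & 16 ∷ 4 & 14 ∷ 4 & 16 ∷ [])))))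
        (split 24 0
         (cover 1 (5 & 21 ∷ 7 & 8 ∷ 12 & 13 ∷ 14 & 17 ∷ 18 & 19 ∷ 22 & 23 ∷ 4 & 24 ∷ 5 & 10 ∷ 11 & 16 ∷ 1 & 20 ∷ []))
         (split 21 0
          (cover 1 (7 & 8 ∷ 11 & 12 ∷ 13 & 18 ∷ 14 & 17 ∷ 22 & 23 ∷ 1 & 21 ∷ 5 & 10 ∷ 16 & 19 ∷ 4 & 20 ∷ []))
          (split 10 0
           (split 12 0
            (split 13 0
             (cover 2 (7 & 8 ∷ 7 & 8 ∷ 12 & 13 ∷ 12 & 13 ∷ 14 & 17 ∷ 14 & 17 ∷ 18 & 19 ∷ 18 & 19 ∷ 22 & 23 ∷ 22 & 23 ∷ 10 & 20 ∷ 10 & 20 ∷ 1 & 16 ∷ 1 & 16 ∷ 4 & 11 ∷ 4 & 11 ∷ 5 & 5 ∷ []))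
             (cover 2 (7 & 8 ∷ 8 & 23 ∷ 11 & 12 ∷ 14 & 17 ∷ 18 & 19 ∷ 18 & 19 ∷ 22 & 23 ∷ 7 & 12 ∷ 10 & 20 ∷ 10 & 20 ∷ 17 & 22 ∷ 1 & 16 ∷ 1 & 16 ∷ 4 & 11 ∷ 4 & 14 ∷ 5 & 5 ∷ [])))
            (cover 2 (7 & 8 ∷ 7 & 8 ∷ 13 & 14 ∷ 13 & 18 ∷ 14 & 17 ∷ 16 & 17 ∷ 18 & 19 ∷ 22 & 23 ∷ 22 & 23 ∷ 10 & 20 ∷ 10 & 20 ∷ 1 & 11 ∷ 1 & 16 ∷ 4 & 11 ∷ 4 & 19 ∷ 5 & 5 ∷ [])))
           (split 8 0
            (split 7 0
             (cover 1 (7 & 8 ∷ 12 & 13 ∷ 14 & 17 ∷ 18 & 19 ∷ 11 & 16 ∷ 4 & 22 ∷ 1 & 23 ∷ []))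
             (split 11 0
              (cover 2 (8 & 23 ∷ 12 & 13 ∷ 8 & 13 ∷ 11 & 16 ∷ 11 & 16 ∷ 14 & 19 ∷ 14 & 19 ∷ 17 & 22 ∷ 17 & 22 ∷ 1 & 23 ∷ 1 & 12 ∷ 4 & 18 ∷ 4 & 18 ∷ []))
              (split 13 0
               (cover 1 (8 & 23 ∷ 12 & 13 ∷ 18 & 19 ∷ 17 & 22 ∷ 1 & 14 ∷ 4 & 16 ∷ []))
               (split 17 0
                (cover 1 (8 & 23 ∷ 12 & 19 ∷ 17 & 22 ∷ 1 & 14 ∷ 1 & 18 ∷ 4 & 16 ∷ []))
                (split 19 0
                 (cover 2 (8 & 23 ∷ 22 & 23 ∷ 14 & 19 ∷ 14 & 19 ∷ 1 & 12 ∷ 1 & 12 ∷ 4 & 18 ∷ 4 & 18 ∷ 5 & 16 ∷ 5 & 16 ∷ 8 & 22 ∷ []))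
                 (split 23 0
                  (cover 1 (12 & 23 ∷ 1 & 8 ∷ 4 & 22 ∷ 5 & 18 ∷ 14 & 16 ∷ []))
                  (strip 1 1)))))))
            (split 12 0
             (split 7 0
              (cover 2 (13 & 18 ∷ 16 & 17 ∷ 16 & 17 ∷ 22 & 23 ∷ 7 & 12 ∷ 7 & 12 ∷ 14 & 19 ∷ 14 & 19 ∷ 18 & 23 ∷ 4 & 22 ∷ 1 & 11 ∷ 1 & 13 ∷ 4 & 11 ∷ []))
              (split 11 0
               (cover 1 (11 & 12 ∷ 16 & 17 ∷ 22 & 23 ∷ 14 & 19 ∷ 4 & 18 ∷ 1 & 13 ∷ []))
               (split 13 0
                (cover 2 (12 & 13 ∷ 12 & 13 ∷ 14 & 17 ∷ 14 & 17 ∷ 18 & 19 ∷ 22 & 23 ∷ 22 & 23 ∷ 1 & 19 ∷ 1 & 18 ∷ 4 & 16 ∷ 4 & 16 ∷ []))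
                (split 17 0
                 (cover 1 (12 & 19 ∷ 14 & 17 ∷ 22 & 23 ∷ 1 & 18 ∷ 4 & 16 ∷ []))
                 (split 19 0
                  (cover 1 (22 & 23 ∷ 14 & 19 ∷ 1 & 12 ∷ 4 & 18 ∷ 5 & 16 ∷ []))
                  (split 23 0
                   (cover 1 (12 & 23 ∷ 1 & 22 ∷ 5 & 18 ∷ 14 & 16 ∷ []))
                   (strip 1 1)))))))
             (split 14 0
              (cover 1 (7 & 22 ∷ 11 & 16 ∷ 14 & 19 ∷ 18 & 23 ∷ 1 & 17 ∷ 4 & 13 ∷ []))
              (split 16 0
               (cover 1 (18 & 19 ∷ 22 & 23 ∷ 11 & 16 ∷ 1 & 17 ∷ 4 & 13 ∷ []))
               (split 18 0
                (cover 1 (18 & 19 ∷ 22 & 23 ∷ 1 & 13 ∷ 1 & 17 ∷ 4 & 11 ∷ 7 & 20 ∷ []))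
                (split 22 0
                 (cover 1 (13 & 22 ∷ 1 & 23 ∷ 4 & 7 ∷ 5 & 17 ∷ 11 & 19 ∷ []))
                 (strip 1 4)))))))))))))
     -- Here every cell outside row 0 is at most `2 N`. The ten pairs match these twenty cells so
     -- that the sum or a difference of each pair is (0 , 1); hence each pair has at most `2 N`. Row
     -- 0 adds at most `10 N`, and the total is exactly `30 N`.
     (cover 1 (5 & 21 ∷ 6 & 20 ∷ 7 & 24 ∷ 8 & 9 ∷ 10 & 16 ∷ 11 & 15 ∷ 12 & 19 ∷ 13 & 14 ∷ 17 & 18 ∷ 22 & 23 ∷ []))))

abstract
  certificate-checks : T (check initial certificate)
  certificate-checks = tt

-- Cosets of a subspace of codimension 2

InStrip : Vec5 n → List (Vec5 n) → Set
InStrip u A = ∀ {x} → x ∈ A → ⟨ u , x ⟩ ≡ # 1 ⊎ ⟨ u , x ⟩ ≡ # 4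

maximum : ∀ (f : Fin (suc n) → ℕ) → ∃ λ i → ∀ j → f j ≤ f i
maximum {zero}  f = zero , λ { zero → ℕ.≤-refl }
maximum {suc n} f with maximum (f ∘ suc)
... | i , max with ℕ.≤-total (f zero) (f (suc i))
... | inj₁ f₀≤ = suc i , λ { zero → f₀≤ ; (suc j) → max j }
... | inj₂ ≤f₀ = zero , λ { zero → ℕ.≤-refl ; (suc j) → ℕ.≤-trans (max j) ≤f₀ }

maximum₂ : ∀ (f : Fin (suc n) → Fin (suc m) → ℕ) → ∃ λ i → ∃ λ j → ∀ i′ j′ → f i′ j′ ≤ f i j
maximum₂ f = let i , max = maximum (λ i → f i (proj₁ (maximum (f i)))) in
  i , proj₁ (maximum (f i)) , λ i′ j′ → ℕ.≤-trans (proj₂ (maximum (f i′)) j′) (max i′)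

Σ-all≡sum : ∀ {n} (f : Fin n → ℕ) → Σ-all f ≡ sum (map f (allFin n))
Σ-all≡sum f = trans (go f) (cong sum (sym (List.map-tabulate id f)))
  where
  go : ∀ {n} (f : Fin n → ℕ) → Σ-all f ≡ sum (List.tabulate f)
  go {zero}  f = refl
  go {suc n} f = cong (f zero +_) (go (f ∘ suc))

sum-*ˡ : ∀ {B : Set} c (f : B → ℕ) xs → sum (map (λ x → c * f x) xs) ≡ c * sum (map f xs)
sum-*ˡ c f []       = sym (ℕ.*-zeroʳ c)
sum-*ˡ c f (x ∷ xs) = trans (cong (c * f x +_) (sum-*ˡ c f xs)) (sym (ℕ.*-distribˡ-+ c (f x) _))

nonempty : ∀ {B : Set} {xs : List B} → 0 < length xs → ∃ (_∈ xs)
nonempty {xs = x ∷ _} _ = x , here refl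

row-cell : ∀ i j → row (cell i j) ≡ i
row-cell i j = cong proj₁ (Fin.remQuot-combine {5} {5} i j)

col-cell : ∀ i j → col (cell i j) ≡ j
col-cell i j = cong proj₂ (Fin.remQuot-combine {5} {5} i j)

cell-row-col : ∀ p → cell (row p) (col p) ≡ p
cell-row-col p = Fin.combine-remQuot {5} 5 p

module Cells (A : List (Vec5 n)) (uA : Unique A) (U V : Vec5 n) where

  At? : ∀ i j (x : Vec5 n) → Dec (⟨ U , x ⟩ ≡ i × ⟨ V , x ⟩ ≡ j)
  At? i j x = (⟨ U , x ⟩ Fin.≟ i) ×-dec (⟨ V , x ⟩ Fin.≟ j)

  cellAt : F5 → F5 → List (Vec5 n)
  cellAt i j = filter (At? i j) A

  count : F5 → F5 → ℕ
  count i j = length (cellAt i j)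

  ∈-cellAt⁻ : ∀ {i j x} → x ∈ cellAt i j → x ∈ A × ⟨ U , x ⟩ ≡ i × ⟨ V , x ⟩ ≡ j
  ∈-cellAt⁻ {i} {j} = ∈.∈-filter⁻ (At? i j) {xs = A}

  ∈-cellAt⁺ : ∀ {i j x} → x ∈ A → ⟨ U , x ⟩ ≡ i → ⟨ V , x ⟩ ≡ j → x ∈ cellAt i j
  ∈-cellAt⁺ {i} {j} x∈ ux vx = ∈.∈-filter⁺ (At? i j) x∈ (ux , vx)

  unique-cellAt : ∀ i j → Unique (cellAt i j)
  unique-cellAt i j = Unique.filter⁺ (At? i j) uA

  weight : Cell → ℕ
  weight p = 5 * count (row p) (col p)

  weight-total : Σ-all weight ≡ 5 * length A
  weight-total = trans (Σ-all≡sum weight) (trans (sum-*ˡ 5 (λ p → count (row p) (col p)) (allFin 25)) (cong (5 *_)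
    (trans (cong sum (List.map-cong same (allFin 25))) (fibre-sum (λ x → cell ⟨ U , x ⟩ ⟨ V , x ⟩) A))))
    where
    same : ∀ p → count (row p) (col p) ≡ length (filter (λ x → cell ⟨ U , x ⟩ ⟨ V , x ⟩ Fin.≟ p) A)
    same p = cong length (List.filter-≐ (At? (row p) (col p)) (λ x → cell ⟨ U , x ⟩ ⟨ V , x ⟩ Fin.≟ p)
      ( (λ { (ux , vx) → trans (cong₂ cell ux vx) (cell-row-col p) })
      , (λ { {x} refl → sym (row-cell ⟨ U , x ⟩ ⟨ V , x ⟩) , sym (col-cell ⟨ U , x ⟩ ⟨ V , x ⟩) })) A)

row-beyond : ∀ p → 5 ≤ toℕ p → ∃ λ i → row p ≡ suc i
row-beyond = from-yes (Fin.all? λ p → (5 ≤? toℕ p) →-dec Fin.any? λ i → row p Fin.≟ suc i)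

-- π is a third linear map, injective on each cell, so cells become subsets of F₅^m.
module Projected (A : List (Vec5 n)) (uA : Unique A) (sf : SumFree A) (U V : Vec5 n) (π : Vec5 n → Vec5 m)
  (π-⊕ : ∀ x y → π (x ⊕ y) ≡ π x ⊕ π y)
  (joint : ∀ {x y} → ⟨ U , x ⟩ ≡ ⟨ U , y ⟩ → ⟨ V , x ⟩ ≡ ⟨ V , y ⟩ → π x ≡ π y → x ≡ y)
  where
  open Cells A uA U V

  π-injective : ∀ {i j x y} → x ∈ cellAt i j → y ∈ cellAt i j → π x ≡ π y → x ≡ y
  π-injective x∈ y∈ with ∈-cellAt⁻ x∈ | ∈-cellAt⁻ y∈
  ... | _ , ux , vx | _ , uy , vy = joint (trans ux (sym uy)) (trans vx (sym vy))

  count≤ : ∀ i j → count i j ≤ 5 ^ m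
  count≤ i j = subst (_≤ 5 ^ m) (List.length-map π (cellAt i j)) (length≤5^ (unique-map π π-injective (unique-cellAt i j)))

  sum-avoided : ∀ {i j i′ j′ i″ j″ x y z} → i″ ≡ i +₅ i′ → j″ ≡ j +₅ j′ →
    x ∈ cellAt i j → y ∈ cellAt i′ j′ → z ∈ cellAt i″ j″ → ¬ π x ⊕ π y ≡ π z
  sum-avoided {x = x} {y} {z} refl refl x∈ y∈ z∈ e with ∈-cellAt⁻ x∈ | ∈-cellAt⁻ y∈ | ∈-cellAt⁻ z∈
  ... | x∈A , ux , vx | y∈A , uy , vy | z∈A , uz , vz = sf x y z x∈A y∈A z∈A
    (joint (trans (⟨,⟩-⊕ʳ U x y) (trans (cong₂ _+₅_ ux uy) (sym uz)))
           (trans (⟨,⟩-⊕ʳ V x y) (trans (cong₂ _+₅_ vx vy) (sym vz)))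
           (trans (π-⊕ x y) e))

  count-sum-⊞ : ∀ {i j i′ j′ i″ j″} k → k ≤ 5 → i″ ≡ i +₅ i′ → j″ ≡ j +₅ j′ → 0 < count i j → 0 < count i′ j′ →
    k * 5 ^ m < 5 * count i″ j″ → 5 * (count i j + count i′ j′) ≤ (5 ∸ k) * 5 ^ m
  count-sum-⊞ {i} {j} {i′} {j′} {i″} {j″} k k≤5 ei ej X>0 Y>0 Z> =
    subst₂ (λ a b → 5 * (a + b) ≤ (5 ∸ k) * 5 ^ m) (List.length-map π X) (List.length-map π Y)
      (kneser k≤5 (unique-map π π-injective (unique-cellAt i j)) (unique-map π π-injective (unique-cellAt i′ j′))
        (unique-map π π-injective (unique-cellAt i″ j″))
        (∈.∈-map⁺ π (proj₂ (nonempty X>0))) (∈.∈-map⁺ π (proj₂ (nonempty Y>0))) (∈.∈-map⁺ π (proj₂ (nonempty Z>0)))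
        avoid (subst (λ c → k * 5 ^ m < 5 * c) (sym (List.length-map π Z)) Z>))
    where
    X = cellAt i j
    Y = cellAt i′ j′
    Z = cellAt i″ j″
    Z>0 : 0 < count i″ j″
    Z>0 = ℕ.*-cancelˡ-< 5 0 _ (ℕ.≤-<-trans z≤n Z>)
    avoid : ∀ {x y z} → x ∈ map π X → y ∈ map π Y → z ∈ map π Z → ¬ x ⊕ y ≡ z
    avoid x∈ y∈ z∈ with ∈.∈-map⁻ π x∈ | ∈.∈-map⁻ π y∈ | ∈.∈-map⁻ π z∈
    ... | _ , x∈′ , refl | _ , y∈′ , refl | _ , z∈′ , refl = sum-avoided ei ej x∈′ y∈′ z∈′

  -- The cell of `Z` is a difference of the other two, so `kneser` is applied to `X` and `-Y`: a
  -- relation `x - y = z` would be the sum `z + y = x` in `A`.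
  count-sum-⊟ : ∀ {i j i′ j′ i″ j″} k → k ≤ 5 → i ≡ i″ +₅ i′ → j ≡ j″ +₅ j′ → 0 < count i j → 0 < count i′ j′ →
    k * 5 ^ m < 5 * count i″ j″ → 5 * (count i j + count i′ j′) ≤ (5 ∸ k) * 5 ^ m
  count-sum-⊟ {i} {j} {i′} {j′} {i″} {j″} k k≤5 ei ej X>0 Y>0 Z> =
    subst₂ (λ a b → 5 * (a + b) ≤ (5 ∸ k) * 5 ^ m) (List.length-map π X) (List.length-map -π Y)
      (kneser k≤5 (unique-map π π-injective (unique-cellAt i j))
        (unique-map -π (λ y∈ y∈′ e → π-injective y∈ y∈′ (·-cancelˡ (# 4) _ _ (λ ()) e)) (unique-cellAt i′ j′))
        (unique-map π π-injective (unique-cellAt i″ j″))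
        (∈.∈-map⁺ π (proj₂ (nonempty X>0))) (∈.∈-map⁺ -π (proj₂ (nonempty Y>0))) (∈.∈-map⁺ π (proj₂ (nonempty Z>0)))
        avoid (subst (λ c → k * 5 ^ m < 5 * c) (sym (List.length-map π Z)) Z>))
    where
    -π : Vec5 n → Vec5 m
    -π x = # 4 · π x
    X = cellAt i j
    Y = cellAt i′ j′
    Z = cellAt i″ j″
    Z>0 : 0 < count i″ j″
    Z>0 = ℕ.*-cancelˡ-< 5 0 _ (ℕ.≤-<-trans z≤n Z>)
    avoid : ∀ {x y z} → x ∈ map π X → y ∈ map -π Y → z ∈ map π Z → ¬ x ⊕ y ≡ z
    avoid x∈ y∈ z∈ e with ∈.∈-map⁻ π x∈ | ∈.∈-map⁻ -π y∈ | ∈.∈-map⁻ π z∈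
    ... | a , a∈ , refl | b , b∈ , refl | c , c∈ , refl = sum-avoided ei ej c∈ b∈ a∈
      (trans (cong (_⊕ π b) (sym e)) (x⊖y⊕y≡x (π a) (π b)))

  private
    row-⊟ : ∀ p q → row p ≡ row (p ⊟ q) +₅ row q
    row-⊟ p q = sym (trans (cong (_+₅ row q) (row-cell (row p +₅ # 4 *₅ row q) (col p +₅ # 4 *₅ col q))) (a-b+b≡a (row p) (row q)))

    col-⊟ : ∀ p q → col p ≡ col (p ⊟ q) +₅ col q
    col-⊟ p q = sym (trans (cong (_+₅ col q) (col-cell (row p +₅ # 4 *₅ row q) (col p +₅ # 4 *₅ col q))) (a-b+b≡a (col p) (col q)))

    in-weights : ∀ p q {c} → 5 * (count (row p) (col p) + count (row q) (col q)) ≤ c → weight p + weight q ≤ c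
    in-weights p q {c} = subst (_≤ c) (ℕ.*-distribˡ-+ 5 (count (row p) (col p)) (count (row q) (col q)))

    positive : ∀ p → 0 < weight p → 0 < count (row p) (col p)
    positive p = ℕ.*-cancelˡ-< 5 0 _

  weight-triangle : ∀ {x y z} k → k ≤ 5 → Triangle x y z → 0 < weight x → 0 < weight y →
    k * 5 ^ m < weight z → weight x + weight y ≤ (5 ∸ k) * 5 ^ m
  weight-triangle {x} {y} k k≤5 (inj₁ refl) x>0 y>0 z> = in-weights x y
    (count-sum-⊞ k k≤5 (row-cell (row x +₅ row y) (col x +₅ col y)) (col-cell (row x +₅ row y) (col x +₅ col y)) (positive x x>0) (positive y y>0) z>)
  weight-triangle {x} {y} k k≤5 (inj₂ (inj₁ refl)) x>0 y>0 z> = in-weights x y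
    (count-sum-⊟ k k≤5 (row-⊟ x y) (col-⊟ x y) (positive x x>0) (positive y y>0) z>)
  weight-triangle {x} {y} k k≤5 (inj₂ (inj₂ refl)) x>0 y>0 z> = subst (_≤ (5 ∸ k) * 5 ^ m) (ℕ.+-comm (weight y) (weight x)) (in-weights y x
    (count-sum-⊟ k k≤5 (row-⊟ y x) (col-⊟ y x) (positive y y>0) (positive x x>0) z>))

  large-row⇒strip : 6 * 5 ^ suc m < 5 * length A → (∀ {x} → x ∈ A → ⟨ U , x ⟩ ≡ zero → ⟨ V , x ⟩ ≡ # 1 ⊎ ⟨ V , x ⟩ ≡ # 4) →
    3 * 5 ^ m < 5 * count (# 0) (# 1) → 1 * 5 ^ m < 5 * count (# 0) (# 4) →
    (∀ i j → count (suc i) j ≤ count (# 1) (# 0)) → ∃ λ w → InStrip w A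
  large-row⇒strip large row₀ b> c> max = combination (check-sound weighting initial certificate certificate-checks valid)
    where
    weighting : Weighting (5 ^ m) weight
    weighting = record
      { unit>0   = ℕ.m^n>0 5 m
      ; bounded  = λ p → ℕ.*-monoʳ-≤ 5 (count≤ (row p) (col p))
      ; triangle = λ {x} {y} {z} → weight-triangle {x} {y} {z}
      ; β₅-max   = λ p 5≤p → ℕ.*-monoʳ-≤ 5 (let i , e = row-beyond p 5≤p in
                     subst (λ r → count r (col p) ≤ count (# 1) (# 0)) (sym e) (max i (col p)))
      ; large    = subst₂ _<_ (eq (5 ^ m)) (sym weight-total) large
      }
      where
      eq : ∀ q → 6 * (5 * q) ≡ 30 * q
      eq = solve-∀
    empty : ∀ j → ¬ (j ≡ # 1 ⊎ j ≡ # 4) → 5 * count zero j ≤ 0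
    empty j j∉ = ℕ.≮⇒≥ λ w>0 → let x , x∈ = nonempty (ℕ.*-cancelˡ-< 5 0 _ w>0) ; x∈A , ux , vx = ∈-cellAt⁻ x∈ in
      j∉ (subst (λ v → v ≡ # 1 ⊎ v ≡ # 4) vx (row₀ x∈A ux))
    valid : Valid weighting initial
    valid = record { level-valid = levels-valid ; height-valid = heights-valid }
      where
      levels-valid : ∀ p {l} → State.level initial p ≡ suc l → l * 5 ^ m < weight p
      levels-valid (suc zero)                   refl = b>
      levels-valid (suc (suc (suc (suc zero)))) refl = c>
      levels-valid (suc (suc (suc (suc (suc p))))) e = ⊥-elim (0≢suc (trans (sym (Vec.lookup-replicate p 0)) e))
        where
        0≢suc : ∀ {l} → ¬ 0 ≡ suc l
        0≢suc ()
      heights-valid : ∀ p → weight p ≤ State.height initial p * 5 ^ m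
      heights-valid zero                   = empty (# 0) (λ { (inj₁ ()) ; (inj₂ ()) })
      heights-valid (suc zero)             = Weighting.bounded weighting (# 1)
      heights-valid (suc (suc zero))       = empty (# 2) (λ { (inj₁ ()) ; (inj₂ ()) })
      heights-valid (suc (suc (suc zero))) = empty (# 3) (λ { (inj₁ ()) ; (inj₂ ()) })
      heights-valid (suc (suc (suc (suc zero)))) = Weighting.bounded weighting (# 4)
      heights-valid p@(suc (suc (suc (suc (suc q))))) =
        subst (λ h → weight p ≤ h * 5 ^ m) (sym (Vec.lookup-replicate q 5)) (Weighting.bounded weighting p)
    combination : (∃ λ a → ∃ λ b → ∀ p → 0 < weight p → OnStrip a b p) → ∃ λ w → InStrip w A
    combination (a , b , on) = a · U ⊕ b · V , λ {x} x∈ → subst (λ c → c ≡ # 1 ⊎ c ≡ # 4) (sym (value x)) (on (cell ⟨ U , x ⟩ ⟨ V , x ⟩)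
      (ℕ.*-monoʳ-< 5 (∈.∈-length (∈-cellAt⁺ x∈ (sym (row-cell ⟨ U , x ⟩ ⟨ V , x ⟩)) (sym (col-cell ⟨ U , x ⟩ ⟨ V , x ⟩))))))
      where
      value : ∀ x → ⟨ a · U ⊕ b · V , x ⟩ ≡ a *₅ row (cell ⟨ U , x ⟩ ⟨ V , x ⟩) +₅ b *₅ col (cell ⟨ U , x ⟩ ⟨ V , x ⟩)
      value x = trans (⟨,⟩-⊕ˡ (a · U) (b · V) x) (cong₂ _+₅_
        (trans (⟨,⟩-·ˡ a U x) (cong (a *₅_) (sym (row-cell ⟨ U , x ⟩ ⟨ V , x ⟩))))
        (trans (⟨,⟩-·ˡ b V x) (cong (b *₅_) (sym (col-cell ⟨ U , x ⟩ ⟨ V , x ⟩)))))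

module _ (A : List (Vec5 n)) (uA : Unique A) where
  private
    module C = Cells A uA

  count-mono : ∀ U V U′ V′ {i j i′ j′} → (∀ x → ⟨ U , x ⟩ ≡ i → ⟨ V , x ⟩ ≡ j → ⟨ U′ , x ⟩ ≡ i′ × ⟨ V′ , x ⟩ ≡ j′) →
    C.count U V i j ≤ C.count U′ V′ i′ j′
  count-mono U V U′ V′ {i} {j} {i′} {j′} imp = ⊆⇒length≤ (C.unique-cellAt U V i j) λ {x} x∈ →
    let x∈A , ux , vx = C.∈-cellAt⁻ U V x∈ ; ux′ , vx′ = imp x ux vx in C.∈-cellAt⁺ U′ V′ x∈A ux′ vx′

abstract
  inverse : ∀ (i : Fin 4) → ∃ λ e → e *₅ suc i ≡ # 1 × ∀ a → suc i *₅ (e *₅ a) ≡ a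
  inverse = from-yes (Fin.all? λ i → Fin.any? λ e → (e *₅ suc i Fin.≟ # 1) ×-dec Fin.all? λ a → suc i *₅ (e *₅ a) Fin.≟ a)

  4*-strip : ∀ a → a ≡ # 1 ⊎ a ≡ # 4 → # 4 *₅ a ≡ # 1 ⊎ # 4 *₅ a ≡ # 4
  4*-strip = from-yes (Fin.all? λ a → ((a Fin.≟ # 1) ⊎-dec (a Fin.≟ # 4)) →-dec ((# 4 *₅ a Fin.≟ # 1) ⊎-dec (# 4 *₅ a Fin.≟ # 4)))

  b-ja+ja≡b : ∀ a b j → (b +₅ # 4 *₅ (j *₅ a)) +₅ j *₅ a ≡ b
  b-ja+ja≡b = from-yes (Fin.all? λ a → Fin.all? λ b → Fin.all? λ j → (b +₅ # 4 *₅ (j *₅ a)) +₅ j *₅ a Fin.≟ b)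

module Extension (A : List (Vec5 n)) (uA : Unique A) (sf : SumFree A) (large : 6 * 5 ^ suc m < 5 * length A)
  (π : Vec5 n → Vec5 m) (π-⊕ : ∀ x y → π (x ⊕ y) ≡ π x ⊕ π y)
  where
  private
    module C = Cells A uA

  Joint : Vec5 n → Vec5 n → Set
  Joint U V = ∀ {x y} → ⟨ U , x ⟩ ≡ ⟨ U , y ⟩ → ⟨ V , x ⟩ ≡ ⟨ V , y ⟩ → π x ≡ π y → x ≡ y

  Row₀ : Vec5 n → Vec5 n → Set
  Row₀ U V = ∀ {x} → x ∈ A → ⟨ U , x ⟩ ≡ zero → ⟨ V , x ⟩ ≡ # 1 ⊎ ⟨ V , x ⟩ ≡ # 4

  -- A shear, with a rescaling of U, moves the heaviest cell outside row 0 to (1 , 0).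
  shear : ∀ U V → Joint U V → Row₀ U V → 3 * 5 ^ m < 5 * C.count U V (# 0) (# 1) → 1 * 5 ^ m < 5 * C.count U V (# 0) (# 4) →
    ∃ λ w → InStrip w A
  shear U V joint row₀ b> c> = Projected.large-row⇒strip A uA sf U′ V′ π π-⊕ joint′ large row₀′
    (ℕ.<-≤-trans b> (ℕ.*-monoʳ-≤ 5 (row₀-count (# 1)))) (ℕ.<-≤-trans c> (ℕ.*-monoʳ-≤ 5 (row₀-count (# 4))))
    λ i′ j′ → ℕ.≤-trans (below i′ j′) top
    where
    heaviest = maximum₂ (λ (i : Fin 4) (j : Fin 5) → C.count U V (suc i) j)
    i = proj₁ heaviest
    j = proj₁ (proj₂ heaviest)
    e = proj₁ (inverse i)
    -- As `e` inverts the row `suc i` of the heaviest cell, `U′` is 1 there; subtracting `j · U′`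
    -- then makes `V′` zero there. On row 0 the functional `V` is unchanged.
    U′ = e · U
    V′ = V ⊖ j · U′
    U′-value : ∀ x → ⟨ U′ , x ⟩ ≡ e *₅ ⟨ U , x ⟩
    U′-value = ⟨,⟩-·ˡ e U
    U-value : ∀ x → ⟨ U , x ⟩ ≡ suc i *₅ ⟨ U′ , x ⟩
    U-value x = sym (trans (cong (suc i *₅_) (U′-value x)) (proj₂ (proj₂ (inverse i)) ⟨ U , x ⟩))
    V′-value : ∀ x → ⟨ V′ , x ⟩ ≡ ⟨ V , x ⟩ +₅ # 4 *₅ (j *₅ ⟨ U′ , x ⟩)
    V′-value x = trans (⟨,⟩-⊖ˡ V (j · U′) x) (cong (λ c → ⟨ V , x ⟩ +₅ # 4 *₅ c) (⟨,⟩-·ˡ j U′ x))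
    V-value : ∀ x → ⟨ V , x ⟩ ≡ ⟨ V′ , x ⟩ +₅ j *₅ ⟨ U′ , x ⟩
    V-value x = sym (trans (cong (_+₅ j *₅ ⟨ U′ , x ⟩) (V′-value x)) (b-ja+ja≡b ⟨ U′ , x ⟩ ⟨ V , x ⟩ j))
    joint′ : Joint U′ V′
    joint′ {x} {y} ux vx = joint
      (trans (U-value x) (trans (cong (suc i *₅_) ux) (sym (U-value y))))
      (trans (V-value x) (trans (cong₂ (λ a b → b +₅ j *₅ a) ux vx) (sym (V-value y))))
    zero-row : ∀ x → ⟨ U′ , x ⟩ ≡ zero → ⟨ U , x ⟩ ≡ zero × ⟨ V , x ⟩ ≡ ⟨ V′ , x ⟩
    zero-row x ux = trans (U-value x) (trans (cong (suc i *₅_) ux) (*₅-comm (suc i) zero)) ,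
      trans (V-value x) (trans (cong (λ a → ⟨ V′ , x ⟩ +₅ j *₅ a) ux)
        (trans (cong (⟨ V′ , x ⟩ +₅_) (*₅-comm j zero)) (trans (+₅-comm ⟨ V′ , x ⟩ zero) (+₅-identityˡ _))))
    row₀′ : Row₀ U′ V′
    row₀′ {x} x∈ ux = let ux₀ , vx = zero-row x ux in subst (λ v → v ≡ # 1 ⊎ v ≡ # 4) vx (row₀ x∈ ux₀)
    row₀-count : ∀ j′ → C.count U V (# 0) j′ ≤ C.count U′ V′ (# 0) j′
    row₀-count j′ = count-mono A uA U V U′ V′ λ x ux vx →
      let ux′ = trans (U′-value x) (trans (cong (e *₅_) ux) (*₅-comm e zero))
      in ux′ , trans (sym (proj₂ (zero-row x ux′))) vx
    below : ∀ i′ j′ → C.count U′ V′ (suc i′) j′ ≤ C.count U V (suc i) j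
    -- Rescaling by a unit keeps nonzero rows nonzero, so each new cell outside row 0 lies inside an
    -- old one, to which maximality applies.
    below i′ j′ = ℕ.≤-trans (count-mono A uA U′ V′ U V {j′ = j′ +₅ j *₅ suc i′} λ x ux vx →
        trans (U-value x) (cong (suc i *₅_) ux) , trans (V-value x) (cong₂ (λ a b → b +₅ j *₅ a) ux vx))
      (nonzero-row (suc i *₅ suc i′) (unit-product i i′))
      where
      unit-product : ∀ (a b : Fin 4) → ∃ λ c → suc a *₅ suc b ≡ suc c
      unit-product = from-yes (Fin.all? λ a → Fin.all? λ b → Fin.any? λ (c : Fin 4) → suc a *₅ suc b Fin.≟ suc c)
      nonzero-row : ∀ r {j″} → ∃ (λ c → r ≡ suc c) → C.count U V r j″ ≤ C.count U V (suc i) j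
      nonzero-row _ (c , refl) = proj₂ (proj₂ heaviest) c _
    top : C.count U V (suc i) j ≤ C.count U′ V′ (# 1) (# 0)
    top = count-mono A uA U V U′ V′ λ x ux vx →
      let ux′ = trans (U′-value x) (trans (cong (e *₅_) ux) (proj₁ (proj₂ (inverse i))))
      in ux′ , +₅-cancelʳ ⟨ V′ , x ⟩ zero (j *₅ # 1) (trans (cong (λ a → ⟨ V′ , x ⟩ +₅ j *₅ a) (sym ux′))
           (trans (sym (V-value x)) (trans vx (trans (sym (*₅-identityˡ j)) (trans (*₅-comm (# 1) j) (sym (+₅-identityˡ _)))))))

  large-section⇒strip : ∀ U V → Joint U V → Row₀ U V → 6 * 5 ^ m < 5 * length (kernelOf U A) → ∃ λ w → InStrip w A
  large-section⇒strip U V joint row₀ large₀ = go (3 * 5 ^ m <? 5 * C.count U V (# 0) (# 1))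
    where
    open ℕ.≤-Reasoning
    b = C.count U V (# 0) (# 1)
    c = C.count U V (# 0) (# 4)
    section≤ : length (kernelOf U A) ≤ b + c
    section≤ = subst (length (kernelOf U A) ≤_) (List.length-++ (C.cellAt U V (# 0) (# 1)))
      (⊆⇒length≤ (Unique.filter⁺ (U ⊥?_) uA) λ {x} x∈ → let x∈A , ux = ∈.∈-filter⁻ (U ⊥?_) {xs = A} x∈ in
        [ (λ vx → ∈.∈-++⁺ˡ (C.∈-cellAt⁺ U V x∈A ux vx))
        , (λ vx → ∈.∈-++⁺ʳ (C.cellAt U V (# 0) (# 1)) (C.∈-cellAt⁺ U V x∈A ux vx)) ]′ (row₀ x∈A ux))
    6<b+c : 6 * 5 ^ m < 5 * b + 5 * c
    6<b+c = begin-strict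
      6 * 5 ^ m                    <⟨ large₀ ⟩
      5 * length (kernelOf U A)    ≤⟨ ℕ.*-monoʳ-≤ 5 section≤ ⟩
      5 * (b + c)                  ≡⟨ ℕ.*-distribˡ-+ 5 b c ⟩
      5 * b + 5 * c                ∎
    remainder : ∀ {x y} k l → k + l ≡ 6 → x ≤ k * 5 ^ m → 6 * 5 ^ m < x + y → l * 5 ^ m < y
    remainder {x} {y} k l k+l≡6 x≤ 6< = ℕ.+-cancelˡ-< (k * 5 ^ m) _ _ (begin-strict
      k * 5 ^ m + l * 5 ^ m        ≡⟨ sym (ℕ.*-distribʳ-+ (5 ^ m) k l) ⟩
      (k + l) * 5 ^ m              ≡⟨ cong (_* 5 ^ m) k+l≡6 ⟩
      6 * 5 ^ m                    <⟨ 6< ⟩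
      x + y                        ≤⟨ ℕ.+-monoˡ-≤ y x≤ ⟩
      k * 5 ^ m + y                ∎)
    count≤5 : ∀ i j → 5 * C.count U V i j ≤ 5 * 5 ^ m
    count≤5 i j = ℕ.*-monoʳ-≤ 5 (Projected.count≤ A uA sf U V π π-⊕ joint i j)
    -V = # 4 · V
    negated : ∀ j → C.count U V (# 0) j ≤ C.count U -V (# 0) (# 4 *₅ j)
    negated j = count-mono A uA U V U -V λ x ux vx → ux , trans (⟨,⟩-·ˡ (# 4) V x) (cong (# 4 *₅_) vx)
    -- In units of `5 ^ m`, two weights of at most 5 add up to more than 6: each exceeds 1, and if
    -- the one at (0 , 1) does not exceed 3, then the other does. In that case `-V` exchanges the
    -- two.
    go : Dec (3 * 5 ^ m < 5 * b) → ∃ λ w → InStrip w A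
    go (yes b>) = shear U V joint row₀ b> (remainder 5 1 refl (count≤5 (# 0) (# 1)) 6<b+c)
    go (no b≯)  = shear U -V
      (λ {x} {y} ux vx → joint ux (*₅-cancelˡ (# 4) _ _ (λ ()) (trans (sym (⟨,⟩-·ˡ (# 4) V x)) (trans vx (⟨,⟩-·ˡ (# 4) V y)))))
      (λ {x} x∈ ux → subst (λ v → v ≡ # 1 ⊎ v ≡ # 4) (sym (⟨,⟩-·ˡ (# 4) V x)) (4*-strip ⟨ V , x ⟩ (row₀ x∈ ux)))
      (ℕ.<-≤-trans (remainder 3 3 refl (ℕ.≮⇒≥ b≯) 6<b+c) (ℕ.*-monoʳ-≤ 5 (negated (# 4))))
      (ℕ.<-≤-trans (remainder 5 1 refl (count≤5 (# 0) (# 4)) (subst (6 * 5 ^ m <_) (ℕ.+-comm (5 * b) (5 * c)) 6<b+c))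
        (ℕ.*-monoʳ-≤ 5 (negated (# 1))))

-- Induction on the dimension

abstract
  -- For `s` nonzero, `s *₅ s *₅ s` is the inverse of `s`, so the value is `t / s`. The hypotheses
  -- say that `s` and `t` are nonzero and that `t / s` is neither 2 nor 3. The summand `zero` comes
  -- from `⟨_,_⟩` in dimension 1.
  line-strip : ∀ s t → ¬ s +₅ s ≡ s → ¬ t +₅ t ≡ t → ¬ s +₅ s ≡ t → ¬ t +₅ t ≡ s →
    s *₅ s *₅ s *₅ t +₅ zero ≡ # 1 ⊎ s *₅ s *₅ s *₅ t +₅ zero ≡ # 4
  line-strip = from-yes (Fin.all? λ s → Fin.all? λ t → ¬? (s +₅ s Fin.≟ s) →-dec (¬? (t +₅ t Fin.≟ t) →-dec
    (¬? (s +₅ s Fin.≟ t) →-dec (¬? (t +₅ t Fin.≟ s) →-dec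
      ((s *₅ s *₅ s *₅ t +₅ zero Fin.≟ # 1) ⊎-dec (s *₅ s *₅ s *₅ t +₅ zero Fin.≟ # 4))))))

strip-functional : ∀ m (A : List (Vec5 (suc m))) → Unique A → SumFree A → 6 * 5 ^ m < 5 * length A → ∃ λ u → InStrip u A
strip-functional zero [] _ _ ()
strip-functional zero A@((s ∷ []) ∷ _) _ sf _ = (s *₅ s *₅ s) ∷ [] , λ { {t ∷ []} t∈ →
  line-strip s t (λ e → sf _ _ _ s∈ s∈ s∈ (cong (_∷ []) e)) (λ e → sf _ _ _ t∈ t∈ t∈ (cong (_∷ []) e))
    (λ e → sf _ _ _ s∈ s∈ t∈ (cong (_∷ []) e)) (λ e → sf _ _ _ t∈ t∈ s∈ (cong (_∷ []) e)) }
  where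
  s∈ : s ∷ [] ∈ A
  s∈ = here refl
strip-functional (suc m) A uA sf large = Extension.large-section⇒strip A uA sf large π π-⊕ U V joint row₀ large₀
  where
  section = large-section m uA sf large
  U = proj₁ section
  large₀ = proj₂ (proj₂ section)
  A₀ = kernelOf U A
  U-pivot = pivot U (proj₁ (proj₂ section))
  k = proj₁ U-pivot
  drop-pivot : Vec5 (2 + m) → Vec5 (suc m)
  drop-pivot x = removeAt x k
  in-kernel : ∀ {x} → x ∈ A₀ → x ∈ A × ⟨ U , x ⟩ ≡ zero
  in-kernel = ∈.∈-filter⁻ (U ⊥?_) {xs = A}
  drop-pivot-injective : ∀ x y → ⟨ U , x ⟩ ≡ ⟨ U , y ⟩ → drop-pivot x ≡ drop-pivot y → x ≡ y
  drop-pivot-injective x y = removeAt-injective U x y k (proj₂ U-pivot)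
  A′ = map drop-pivot A₀
  uA′ : Unique A′
  uA′ = unique-map drop-pivot (λ {x} {y} x∈ y∈ → drop-pivot-injective x y (trans (proj₂ (in-kernel x∈)) (sym (proj₂ (in-kernel y∈)))))
    (Unique.filter⁺ (U ⊥?_) uA)
  sf′ : SumFree A′
  sf′ _ _ _ a∈ b∈ c∈ e with ∈.∈-map⁻ drop-pivot a∈ | ∈.∈-map⁻ drop-pivot b∈ | ∈.∈-map⁻ drop-pivot c∈
  ... | a , a∈₀ , refl | b , b∈₀ , refl | c , c∈₀ , refl with in-kernel a∈₀ | in-kernel b∈₀ | in-kernel c∈₀
  ... | a∈A , ua | b∈A , ub | c∈A , uc = sf a b c a∈A b∈A c∈A (drop-pivot-injective (a ⊕ b) c
    (trans (⟨,⟩-⊕ʳ U a b) (trans (cong₂ _+₅_ ua ub) (sym uc))) (trans (removeAt-⊕ a b k) e))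
  induction = strip-functional m A′ uA′ sf′ (subst (λ l → 6 * 5 ^ m < 5 * l) (sym (List.length-map drop-pivot A₀)) large₀)
  v = proj₁ induction
  -- The functional `v` on the kernel of `U` is extended to the whole space by ignoring the pivot
  -- coordinate.
  V = insertAt v k zero
  V-value : ∀ x → ⟨ V , x ⟩ ≡ ⟨ v , drop-pivot x ⟩
  V-value = ⟨,⟩-insertAt v k
  v≢𝟎 : ¬ v ≡ 𝟎
  v≢𝟎 v≡𝟎 = let x , x∈ = nonempty (ℕ.*-cancelˡ-< 5 0 (length A₀) (ℕ.≤-<-trans z≤n large₀)) in
    absurd (subst (λ a → a ≡ # 1 ⊎ a ≡ # 4) (trans (cong (λ v → ⟨ v , drop-pivot x ⟩) v≡𝟎) (𝟎-⟨,⟩ (drop-pivot x)))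
      (proj₂ induction (∈.∈-map⁺ drop-pivot x∈)))
    where
    absurd : ¬ (zero ≡ # 1 ⊎ zero ≡ # 4)
    absurd (inj₁ ())
    absurd (inj₂ ())
  v-pivot = pivot v v≢𝟎
  k′ = proj₁ v-pivot
  -- The coordinates left after deleting both pivots; together with the values of `U` and `V` they
  -- determine a vector.
  π : Vec5 (2 + m) → Vec5 m
  π x = removeAt (drop-pivot x) k′
  π-⊕ : ∀ x y → π (x ⊕ y) ≡ π x ⊕ π y
  π-⊕ x y = trans (cong (λ z → removeAt z k′) (removeAt-⊕ x y k)) (removeAt-⊕ (drop-pivot x) (drop-pivot y) k′)
  joint : ∀ {x y} → ⟨ U , x ⟩ ≡ ⟨ U , y ⟩ → ⟨ V , x ⟩ ≡ ⟨ V , y ⟩ → π x ≡ π y → x ≡ y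
  joint {x} {y} ux vx πx = drop-pivot-injective x y ux (removeAt-injective v (drop-pivot x) (drop-pivot y) k′ (proj₂ v-pivot)
    (trans (sym (V-value x)) (trans vx (V-value y))) πx)
  row₀ : ∀ {x} → x ∈ A → ⟨ U , x ⟩ ≡ zero → ⟨ V , x ⟩ ≡ # 1 ⊎ ⟨ V , x ⟩ ≡ # 4
  row₀ {x} x∈ ux = subst (λ a → a ≡ # 1 ⊎ a ≡ # 4) (sym (V-value x))
    (proj₂ induction (∈.∈-map⁺ drop-pivot (∈.∈-filter⁺ (U ⊥?_) x∈ ux)))

-- From a functional to normality

abstract
  a-3[2a]≡0 : ∀ a → a +₅ # 4 *₅ (# 2 *₅ a *₅ # 3) ≡ zero
  a-3[2a]≡0 = from-yes (Fin.all? λ a → a +₅ # 4 *₅ (# 2 *₅ a *₅ # 3) Fin.≟ zero)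

⟨,⟩-⊖ʳ : ∀ (u x y : Vec5 n) → ⟨ u , x ⊖ y ⟩ ≡ ⟨ u , x ⟩ +₅ # 4 *₅ ⟨ u , y ⟩
⟨,⟩-⊖ʳ u x y = trans (⟨,⟩-⊕ʳ u x (# 4 · y)) (cong (⟨ u , x ⟩ +₅_) (⟨,⟩-·ʳ u (# 4) y))

strip⇒normal : ∀ {A : List (Vec5 n)} u → ∃ (_∈ A) → InStrip u A → Normal A
strip⇒normal {n} {A} u (a , a∈) inStrip = V , V-subspace , (w , w∉V , decompose) , w , w∉V , shift
  where
  V : Vec5 n → Set
  V x = ⟨ u , x ⟩ ≡ zero
  V-subspace : IsSubspace V
  V-subspace = record
    { zero∈    = ⟨,⟩-𝟎 u
    ; ⊕-closed = λ x y ux uy → trans (⟨,⟩-⊕ʳ u x y) (cong₂ _+₅_ ux uy)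
    ; ·-closed = λ c x ux → trans (⟨,⟩-·ʳ u c x) (trans (cong (c *₅_) ux) (*₅-comm c zero))
    }
  -- The value 3 turns the strip into the required shifts: 2 · 3 = 1 and 3 · 3 = 4. A multiple of
  -- any element of `A` provides it.
  direction : ∃ λ w → ⟨ u , w ⟩ ≡ # 3
  direction = [ (λ ua → # 3 · a , trans (⟨,⟩-·ʳ u (# 3) a) (cong (# 3 *₅_) ua))
              , (λ ua → # 2 · a , trans (⟨,⟩-·ʳ u (# 2) a) (cong (# 2 *₅_) ua)) ]′ (inStrip a∈)
  w = proj₁ direction
  uw≡3 = proj₂ direction
  w∉V : ¬ V w
  w∉V uw≡0 = Fin.0≢1+n (trans (sym uw≡0) uw≡3)
  remainder : ∀ c x → x ≡ c · w ⊕ (x ⊖ c · w)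
  remainder c x = sym (trans (⊕-comm (c · w) (x ⊖ c · w)) (x⊖y⊕y≡x x (c · w)))
  remainder-value : ∀ c x → ⟨ u , x ⊖ c · w ⟩ ≡ ⟨ u , x ⟩ +₅ # 4 *₅ (c *₅ # 3)
  remainder-value c x = trans (⟨,⟩-⊖ʳ u x (c · w)) (cong (λ a → ⟨ u , x ⟩ +₅ # 4 *₅ a)
    (trans (⟨,⟩-·ʳ u c w) (cong (c *₅_) uw≡3)))
  decompose : ∀ x → ∃ λ l → ∃ λ v → V v × x ≡ l · w ⊕ v
  decompose x = l , x ⊖ l · w , trans (remainder-value l x) (a-3[2a]≡0 ⟨ u , x ⟩) , remainder l x
    where
    -- Division by `⟨ u , w ⟩ = 3`, whose inverse is 2.
    l = # 2 *₅ ⟨ u , x ⟩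
  shift : ∀ x → x ∈ A → InShift V w x
  shift x x∈ with inStrip x∈
  ... | inj₁ ux = x ⊖ # 2 · w , trans (remainder-value (# 2) x) (cong (_+₅ # 4 *₅ (# 2 *₅ # 3)) ux) , inj₁ (remainder (# 2) x)
  ... | inj₂ ux = x ⊖ # 3 · w , trans (remainder-value (# 3) x) (cong (_+₅ # 4 *₅ (# 3 *₅ # 3)) ux) , inj₂ (remainder (# 3) x)

theorem1p4 : (n : ℕ) → n ≥ 1 → (A : List (Vec5 n)) → Unique A → SumFree A →
    6 * 5 ^ (n ∸ 1) < 5 * length A → Normal A
theorem1p4 (suc m) _ A uA sf large = let u , inStrip = strip-functional m A uA sf large in
  strip⇒normal u (nonempty (ℕ.*-cancelˡ-< 5 0 (length A) (ℕ.≤-<-trans z≤n large))) inStrip
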